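{- Over the Baire space $\omega^\omega$, the modified BSS-machines compute exactly the same class of functions as the MS-machines. That is, a partial function $f:\mathbb{N}^p\times(\omega^\omega)^q\to Y$, with $p+q\ge1$ and $Y\in\{\mathbb{N},\omega^\omega\}$, is computable by a modified BSS-machine over $\omega^\omega$ if and only if it is MS-computable over $\omega^\omega$.
   Context: Write $\mathbb{N}=\omega=\{0,1,2,\dots\}$, $\mathcal{N}=\omega^\omega$ (Baire space), and $0_{\mathcal{N}}$ for the constant zero sequence. All functions may be partial. Universal TTE-computable functions. Fix standard effective enumerations of oracle Turing machines with $q$ oracles from $\mathcal{N}$ ($q\ge 0$). $\Phi^{\vec x}(e,i)$ is the result of the $e$-th machine on input $i$ with oracles $\vec x=(x_1,\dots,x_q)$, and $\Phi^{\vec x}(e)$ is the sequence $y\in\mathcal{N}$ with $y(i)=\Phi^{\vec x}(e,i)$; it is defined iff $\Phi^{\vec x}(e,i)$ is defined for all $i$. Modified BSS-machines over $\mathcal{N}$. These are Blum-Shub-Smale machines without parameters from $\mathcal{N}$, without additive inverse, and with the universal TTE-computable function added as a primitive that can be called dynamically: a machine is a finite flowchart (with one input node, output/halting nodes, computation nodes and branching nodes) acting on finitely many registers for natural numbers and finitely many registers for elements of $\mathcal{N}$. Computation nodes perform: on number registers, assigning $0$, adding $1$, or copying; on Baire registers, copying, pointwise addition and pointwise multiplication of registers, and calls assigning $\Phi^{x_{j_1},\dots,x_{j_s}}(e)$ ($s\ge0$) to a Baire register, where $e$ is the current content of a number register and $x_{j_1},\dots,x_{j_s}$ are contents of Baire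 registers (if this value is undefined, the computation is undefined). Branching nodes test whether a number register contains $0$, or whether a Baire register contains $0_{\mathcal{N}}$. The input is placed in designated registers (all others initially $0$, resp. $0_{\mathcal{N}}$), and the output is read from a designated register upon halting; the function is undefined on inputs for which the machine does not halt. MS-machines over $\mathcal{N}$. A master-slave machine consists of a master, which is an ordinary deterministic Turing machine with a finite program handling natural numbers and equipped with a billboard (holding a natural number $p$) and a Boolean bit $k$ it can read, together with finitely many Baire tapes $t_1,\dots,t_r$, each holding an element of $\mathcal{N}$; these comprise the input tapes, working tapes, a zero-test tape and an output tape. Besides ordinary Turing machine commands, the master's program may contain: (i) slave-calling commands with a designated target tape $t_l$: if $p$ is on the billboard and $\vec y=(y_1,\dots,y_r)$ are the current contents of the Baire tapes, the content of $t_l$ is replaced by $\Phi^{\vec y}(p)$ and the master enters a specified next state, provided $\Phi^{\vec y}(p)$ is defined (otherwise the whole computation is undefined); (ii) zero-test commands: the bit $k$ is set to $1$ if the content of the zero-test tape is $0_{\mathcal{N}}$, and to $0$ otherwise, and the master enters a specified next state. On input $(\vec n;\vec x)\in\mathbb{N}^p\times\mathcal{N}^q$, $\vec n$ is put on the master's tape, $x_1,\dots,x_q$ on the input tapes, and all other Baire tapes hold $0_{\mathcal{N}}$. If the master reaches its halting state after finitely many steps, the output is the number on the master's output tape (codomain $\mathbb{N}$) or the content of the output Baire tape (codomain $\mathcal{N}$); if it never halts or some slave call is undefined, the result is undefined. A partial function is MS-computable over $\mathcal{N}$ if it is computed in this sense by some MS-machine.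
   Formalization: The modified BSS-machines get one extra branching test, whether two number registers hold equal numbers; with only the listed operations the claim fails for p ≥ 1, since n ↦ max(n−1, 0) is MS-computable but not BSS-computable. -}

module Defs where

open import Data.Bool.Base using (Bool; true; false; _∧_; if_then_else_)
open import Data.Fin.Base using (Fin; zero; suc; toℕ; fromℕ<; _↑ˡ_; _↑ʳ_)
open import Data.Fin.Properties using (toℕ<n; fromℕ<-toℕ) renaming (_≟_ to _≟ᶠ_)
open import Data.List.Base using (List; []; _∷_; _++_; replicate)
open import Data.Maybe.Base using (Maybe; just; nothing; maybe′)
open import Data.Nat.Base using (ℕ; zero; suc; _+_; _*_; _≡ᵇ_)
open import Data.Nat.Binary.Base using (ℕᵇ; 2[1+_]; 1+[2_]; fromℕ) renaming (zero to 0ᵇ; toℕ to ⟦_⟧ᵇ)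
open import Data.Nat.Binary.Properties using () renaming (fromℕ-toℕ to fromℕ-toℕᵇ)
open import Data.Nat.Properties using (_<?_) renaming (_≟_ to _≟ℕ_)
open import Data.Product.Base using (Σ; ∃; _×_; _,_)
open import Data.Vec.Base as Vec using (Vec; lookup; _[_]≔_)
open import Data.Vec.Relation.Binary.Pointwise.Inductive using (Pointwise)
open import Function.Bundles using (_⇔_)
open import Relation.Binary.Construct.Closure.ReflexiveTransitive using (Star)
open import Relation.Binary.Definitions using (DecidableEquality)
open import Relation.Binary.PropositionalEquality using (_≡_; _≢_; refl; cong; module ≡-Reasoning)
open import Relation.Nullary.Decidable using (yes; no)
open import Relation.Nullary.Negation using (¬_; contradiction)

------------------------------------------------------------------------
-- Baire space and partial functions

Baire : Set
Baire = ℕ → ℕ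

0ᴺ : Baire
0ᴺ _ = 0

-- Equality of points of Baire space is pointwise equality, as function
-- extensionality is not available.
infix 4 _≈_
_≈_ : Baire → Baire → Set
x ≈ y = ∀ i → x i ≡ y i

data Sort : Set where
  num seq : Sort

⟦_⟧ : Sort → Set
⟦ num ⟧ = ℕ
⟦ seq ⟧ = Baire

Eq : ∀ Y → ⟦ Y ⟧ → ⟦ Y ⟧ → Set
Eq num = _≡_
Eq seq = _≈_

-- A partial function ℕᵖ × 𝒩^q ⇀ Y, given by its graph.
record PartialFunction (p q : ℕ) (Y : Sort) : Set₁ where
  field
    Graph      : Vec ℕ p → Vec Baire q → ⟦ Y ⟧ → Set
    respects   : ∀ {n x x′ y y′} → Pointwise _≈_ x x′ → Eq Y y y′ →
                 Graph n x y → Graph n x′ y′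
    functional : ∀ {n x y y′} → Graph n x y → Graph n x y′ → Eq Y y y′

------------------------------------------------------------------------
-- Turing tapes, two-way infinite, with blanks beyond the listed cells

record Tape (A : Set) : Set where
  constructor tape
  field
    left  : List A      -- nearest cell first
    head  : A
    right : List A

open Tape public

data Move : Set where
  moveL stay moveR : Move

module Tapes {A : Set} (blank stroke : A) (_≟_ : DecidableEquality A) where

  move : Move → Tape A → Tape A
  move stay  t                      = t
  move moveL (tape []       a rs)   = tape [] blank (a ∷ rs)
  move moveL (tape (l ∷ ls) a rs)   = tape ls l (a ∷ rs)
  move moveR (tape ls a [])         = tape (a ∷ ls) blank []
  move moveR (tape ls a (r ∷ rs))   = tape (a ∷ ls) r rs

  write : A → Tape A → Tape A
  write a t = record t { head = a }

  load : List A → Tape A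
  load []       = tape [] blank []
  load (a ∷ as) = tape [] a as

  -- Numbers are represented in unary: n is a block of n strokes starting
  -- at the scanned cell and followed by a blank.
  numeral : ℕ → List A
  numeral n = replicate n stroke

  strokes : List A → ℕ
  strokes []       = 0
  strokes (a ∷ as) with a ≟ stroke
  ... | yes _ = suc (strokes as)
  ... | no  _ = 0

  number : Tape A → ℕ
  number t = strokes (head t ∷ right t)

  numerals : ∀ {p} → Vec ℕ p → List A
  numerals Vec.[]       = []
  numerals (n Vec.∷ ns) = numeral n ++ blank ∷ numerals ns

------------------------------------------------------------------------
-- Oracle Turing machines with q oracles from Baire space
--
-- Programs are finite lists of quadruples in the style of Davis, extended
-- by a tape index so that auxiliary tapes are available.  Symbol 0 is the
-- blank and symbol 1 the stroke.

-- `query k` replaces the number n on the tape by xₖ(n).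
data Op (q : ℕ) : Set where
  goLeft goRight : Op q
  print          : ℕ → Op q
  query          : Fin q → Op q

-- "In `state`, if `onTape` scans `symbol`, apply `op` to that tape and
-- enter `next`."
record Quadruple (q : ℕ) : Set where
  constructor quad
  field
    state onTape symbol : ℕ
    op                  : Op q
    next                : ℕ

Program : ℕ → Set
Program q = List (Quadruple q)

module Slave where

  open Tapes {ℕ} 0 1 _≟ℕ_ public

  record Config : Set where
    constructor config
    field
      state : ℕ
      tapes : ℕ → Tape ℕ

  open Config public

  _[_↦_] : (ℕ → Tape ℕ) → ℕ → Tape ℕ → (ℕ → Tape ℕ)
  (ts [ t ↦ new ]) u with u ≟ℕ t
  ... | yes _ = new
  ... | no  _ = ts u

  apply : ∀ {q} → Vec Baire q → Op q → Tape ℕ → Tape ℕ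
  apply x goLeft    t = move moveL t
  apply x goRight   t = move moveR t
  apply x (print a) t = write a t
  apply x (query k) t = load (numeral (lookup x k (number t)))

  -- The first applicable quadruple is executed (so machines are
  -- deterministic); the machine halts when there is none.
  step : ∀ {q} → Program q → Vec Baire q → Config → Maybe Config
  step []                      x c = nothing
  step (quad s t a op s′ ∷ P)  x c =
    if (s ≡ᵇ state c) ∧ (a ≡ᵇ head (tapes c t))
    then just (config s′ (tapes c [ t ↦ apply x op (tapes c t) ]))
    else step P x c

  -- Input and output are on tape 0; the initial state is 0.
  initial : ℕ → Config
  initial i = config 0 ((λ _ → load []) [ 0 ↦ load (numeral i) ])

  Computes : ∀ {q} → Program q → Vec Baire q → ℕ → ℕ → Set
  Computes P x i n = ∃ λ c →
    Star (λ c c′ → step P x c ≡ just c′) (initial i) c ×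
    step P x c ≡ nothing ×
    number (tapes c 0) ≡ n

------------------------------------------------------------------------
-- Effective enumeration of the oracle programs
--
-- e is read through its bijective base-2 digits, least significant first:
-- a digit 2 increments the number being read, a digit 1 ends it.  The
-- resulting list of numbers is cut into groups of six, one per quadruple.

increment : List ℕ → List ℕ
increment []       = []
increment (n ∷ ns) = suc n ∷ ns

digits→list : ℕᵇ → List ℕ
digits→list 0ᵇ       = []
digits→list 1+[2 b ] = 0 ∷ digits→list b
digits→list 2[1+ b ] = increment (digits→list b)

-- An operation is given by a tag and an argument; a query to an oracle
-- with index ≥ q is not an operation of a machine with q oracles.
decodeOp : ∀ q → ℕ → ℕ → Maybe (Op q)
decodeOp q 0 _ = just goLeft
decodeOp q 1 _ = just goRight
decodeOp q 2 a = just (print a)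
decodeOp q (suc (suc (suc _))) k with k <? q
... | yes k<q = just (query (fromℕ< k<q))
... | no  _   = nothing

-- Quadruples with an invalid operation are dropped.
parse : ∀ q → List ℕ → Program q
parse q (s ∷ t ∷ a ∷ tag ∷ arg ∷ s′ ∷ ns) =
  maybe′ (λ op → quad s t a op s′ ∷ parse q ns) (parse q ns) (decodeOp q tag arg)
parse q _ = []

decode : ∀ q → ℕ → Program q
decode q e = parse q (digits→list (fromℕ e))

-- Every program has a code, so `decode q` does enumerate all of them.

list→digits : List ℕ → ℕᵇ
list→digits []           = 0ᵇ
list→digits (n ∷ ns)     = twos n
  where
  twos : ℕ → ℕᵇ
  twos zero    = 1+[2 list→digits ns ]
  twos (suc n) = 2[1+ twos n ]

tagOf argOf : ∀ {q} → Op q → ℕ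
tagOf goLeft    = 0
tagOf goRight   = 1
tagOf (print _) = 2
tagOf (query _) = 3
argOf goLeft    = 0
argOf goRight   = 0
argOf (print a) = a
argOf (query k) = toℕ k

flatten : ∀ {q} → Program q → List ℕ
flatten []                      = []
flatten (quad s t a op s′ ∷ P)  = s ∷ t ∷ a ∷ tagOf op ∷ argOf op ∷ s′ ∷ flatten P

encode : ∀ {q} → Program q → ℕ
encode P = ⟦ list→digits (flatten P) ⟧ᵇ

digits→list∘list→digits : ∀ ns → digits→list (list→digits ns) ≡ ns
digits→list∘list→digits []             = refl
digits→list∘list→digits (zero  ∷ ns)   = cong (0 ∷_) (digits→list∘list→digits ns)
digits→list∘list→digits (suc n ∷ ns)   = cong increment (digits→list∘list→digits (n ∷ ns))

decodeOp-encode : ∀ {q} (op : Op q) → decodeOp q (tagOf op) (argOf op) ≡ just op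
decodeOp-encode goLeft    = refl
decodeOp-encode goRight   = refl
decodeOp-encode (print a) = refl
decodeOp-encode {q} (query k) with toℕ k <? q
... | yes k<q = cong (λ i → just (query i)) (fromℕ<-toℕ k k<q)
... | no  k≮q = contradiction (toℕ<n k) k≮q

parse∘flatten : ∀ {q} (P : Program q) → parse q (flatten P) ≡ P
parse∘flatten []                     = refl
parse∘flatten (quad s t a op s′ ∷ P)
  rewrite decodeOp-encode op = cong (quad s t a op s′ ∷_) (parse∘flatten P)

decode∘encode : ∀ {q} (P : Program q) → decode q (encode P) ≡ P
decode∘encode {q} P = begin
  parse q (digits→list (fromℕ ⟦ list→digits (flatten P) ⟧ᵇ))
    ≡⟨ cong (λ b → parse q (digits→list b)) (fromℕ-toℕᵇ (list→digits (flatten P))) ⟩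
  parse q (digits→list (list→digits (flatten P)))
    ≡⟨ cong (parse q) (digits→list∘list→digits (flatten P)) ⟩
  parse q (flatten P)
    ≡⟨ parse∘flatten P ⟩
  P ∎
  where open ≡-Reasoning

------------------------------------------------------------------------
-- The universal functions

-- Φˣ(e,i) is defined with value n.
Φ[_]⟨_,_⟩≡_ : ∀ {q} → Vec Baire q → ℕ → ℕ → ℕ → Set
Φ[_]⟨_,_⟩≡_ {q} x e i n = Slave.Computes (decode q e) x i n

-- Φˣ(e) is defined with value y.
Φ[_]⟨_⟩≈_ : ∀ {q} → Vec Baire q → ℕ → Baire → Set
Φ[ x ]⟨ e ⟩≈ y = ∀ i → Φ[ x ]⟨ e , i ⟩≡ y i

------------------------------------------------------------------------
-- Modified BSS-machines over Baire space

module BSS where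

  -- a number registers, b Baire registers; targets come first.
  data Instruction (a b : ℕ) : Set where
    setZero  : Fin a → Instruction a b
    addOne   : Fin a → Instruction a b
    copyNum  : Fin a → Fin a → Instruction a b
    copySeq  : Fin b → Fin b → Instruction a b
    add mult : Fin b → Fin b → Fin b → Instruction a b
    call     : ∀ {s} → Fin b → Fin a → Vec (Fin b) s → Instruction a b

  -- Besides the two zero tests there is an equality test for number
  -- registers.  It cannot be left out: from a number input n, the operations
  -- 0, +1, copy and test for 0 only produce constants and n + c, and since
  -- every enumeration of machines contains infinitely many nowhere defined
  -- ones, no call Φ(n + c) can safely extract more, so that not even the
  -- predecessor function would be computable.
  data Test (a b : ℕ) : Set where
    isZeroNum : Fin a → Test a b
    equalNum  : Fin a → Fin a → Test a b
    isZeroSeq : Fin b → Test a b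

  data Node (nodes a b : ℕ) : Set where
    output  : Node nodes a b
    compute : Instruction a b → Fin nodes → Node nodes a b
    branch  : Test a b → (ifTrue ifFalse : Fin nodes) → Node nodes a b

  Register : ℕ → ℕ → Sort → Set
  Register a b num = Fin a
  Register a b seq = Fin b

  -- The designated input registers are the first p number registers and the
  -- first q Baire registers; `entry` is the successor of the input node.
  record Machine (p q : ℕ) (Y : Sort) : Set where
    field
      extraNum extraSeq : ℕ
      nodes             : ℕ
      entry             : Fin nodes
      node              : Fin nodes → Node nodes (p + extraNum) (q + extraSeq)
      result            : Register (p + extraNum) (q + extraSeq) Y

  record Store (a b : ℕ) : Set where
    constructor store
    field
      nums : Vec ℕ a
      seqs : Vec Baire b

  open Store public

  data Executes {a b} : Instruction a b → Store a b → Store a b → Set where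
    setZero : ∀ {j ns xs} →
      Executes (setZero j) (store ns xs) (store (ns [ j ]≔ 0) xs)
    addOne : ∀ {j ns xs} →
      Executes (addOne j) (store ns xs) (store (ns [ j ]≔ suc (lookup ns j)) xs)
    copyNum : ∀ {j k ns xs} →
      Executes (copyNum j k) (store ns xs) (store (ns [ j ]≔ lookup ns k) xs)
    copySeq : ∀ {j k ns xs} →
      Executes (copySeq j k) (store ns xs) (store ns (xs [ j ]≔ lookup xs k))
    add : ∀ {j k l ns xs} →
      Executes (add j k l) (store ns xs)
        (store ns (xs [ j ]≔ (λ i → lookup xs k i + lookup xs l i)))
    mult : ∀ {j k l ns xs} →
      Executes (mult j k l) (store ns xs)
        (store ns (xs [ j ]≔ (λ i → lookup xs k i * lookup xs l i)))
    call : ∀ {s j e ns xs y} {js : Vec (Fin b) s} →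
      Φ[ Vec.map (lookup xs) js ]⟨ lookup ns e ⟩≈ y →
      Executes (call j e js) (store ns xs) (store ns (xs [ j ]≔ y))

  Holds : ∀ {a b} → Test a b → Store a b → Set
  Holds (isZeroNum j)  σ = lookup (nums σ) j ≡ 0
  Holds (equalNum j k) σ = lookup (nums σ) j ≡ lookup (nums σ) k
  Holds (isZeroSeq j)  σ = lookup (seqs σ) j ≈ 0ᴺ

  module Semantics {p q : ℕ} {Y : Sort} (M : Machine p q Y) where
    open Machine M

    Config : Set
    Config = Fin nodes × Store (p + extraNum) (q + extraSeq)

    data _⟶_ : Config → Config → Set where
      compute : ∀ {v I w σ σ′} → node v ≡ compute I w →
                Executes I σ σ′ → (v , σ) ⟶ (w , σ′)
      true    : ∀ {v T w w′ σ} → node v ≡ branch T w w′ →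
                Holds T σ → (v , σ) ⟶ (w , σ)
      false   : ∀ {v T w w′ σ} → node v ≡ branch T w w′ →
                ¬ Holds T σ → (v , σ) ⟶ (w′ , σ)

    initial : Vec ℕ p → Vec Baire q → Config
    initial n x = entry , store (n Vec.++ Vec.replicate extraNum 0)
                                (x Vec.++ Vec.replicate extraSeq 0ᴺ)

    value : ∀ Z → Register (p + extraNum) (q + extraSeq) Z →
            Store (p + extraNum) (q + extraSeq) → ⟦ Z ⟧
    value num j σ = lookup (nums σ) j
    value seq j σ = lookup (seqs σ) j

    Outputs : Vec ℕ p → Vec Baire q → ⟦ Y ⟧ → Set
    Outputs n x y = ∃ λ v → ∃ λ σ →
      Star _⟶_ (initial n x) (v , σ) × node v ≡ output × Eq Y (value Y result σ) y

  Computable : ∀ {p q Y} → PartialFunction p q Y → Set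
  Computable {p} {q} {Y} f = Σ (Machine p q Y) λ M →
    ∀ n x y → PartialFunction.Graph f n x y ⇔ Semantics.Outputs M n x y

------------------------------------------------------------------------
-- MS-machines over Baire space

module MS where

  -- `letters` is the number of tape symbols besides blank and stroke.
  Symbol : ℕ → Set
  Symbol letters = Fin (2 + letters)

  -- The master's own tapes: input tape, output tape, billboard, work tapes.
  masterTapes : ℕ → ℕ
  masterTapes work = 3 + work

  inputTape outputTape billboard : ∀ {work} → Fin (masterTapes work)
  inputTape  = zero
  outputTape = suc zero
  billboard  = suc (suc zero)

  -- The Baire tapes t₁,…,tᵣ: q input tapes, the working tapes, the zero-test
  -- tape and the output tape, in this order.
  baireTapes : ℕ → ℕ → ℕ
  baireTapes q work = q + (work + 2)

  zeroTestTape outputBaire : ∀ q work → Fin (baireTapes q work)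
  zeroTestTape q work = q ↑ʳ (work ↑ʳ zero)
  outputBaire  q work = q ↑ʳ (work ↑ʳ suc zero)

  -- m master tapes, r Baire tapes.
  data Command (states letters m r : ℕ) : Set where
    turing    : Vec (Symbol letters × Move) m → Fin states → Command states letters m r
    callSlave : (target : Fin r) → Fin states → Command states letters m r
    zeroTest  : Fin states → Command states letters m r

  -- The program assigns a command to each state, tuple of scanned symbols
  -- and value of the bit.
  record Machine (p q : ℕ) : Set where
    field
      states letters work baireWork : ℕ
      start halt                    : Fin states
      program : Fin states → Vec (Symbol letters) (masterTapes work) → Bool →
                Command states letters (masterTapes work) (baireTapes q baireWork)

  module Semantics {p q : ℕ} (M : Machine p q) where
    open Machine M
    open Tapes {Symbol letters} zero (suc zero) _≟ᶠ_

    record Config : Set where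
      constructor config
      field
        state : Fin states
        bit   : Bool
        tapes : Vec (Tape (Symbol letters)) (masterTapes work)
        seqs  : Vec Baire (baireTapes q baireWork)

    open Config

    current : Config → Command states letters (masterTapes work) (baireTapes q baireWork)
    current c = program (state c) (Vec.map head (tapes c)) (bit c)

    act : Symbol letters × Move → Tape (Symbol letters) → Tape (Symbol letters)
    act (a , d) t = move d (write a t)

    data _⟶_ (c : Config) : Config → Set where
      turing : ∀ {acts s} → state c ≢ halt → current c ≡ turing acts s →
        c ⟶ config s (bit c) (Vec.zipWith act acts (tapes c)) (seqs c)
      callSlave : ∀ {l s y} → state c ≢ halt → current c ≡ callSlave l s →
        Φ[ seqs c ]⟨ number (lookup (tapes c) billboard) ⟩≈ y →
        c ⟶ config s (bit c) (tapes c) (seqs c [ l ]≔ y)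
      zeroTest-true : ∀ {s} → state c ≢ halt → current c ≡ zeroTest s →
        lookup (seqs c) (zeroTestTape q baireWork) ≈ 0ᴺ →
        c ⟶ config s true (tapes c) (seqs c)
      zeroTest-false : ∀ {s} → state c ≢ halt → current c ≡ zeroTest s →
        ¬ (lookup (seqs c) (zeroTestTape q baireWork) ≈ 0ᴺ) →
        c ⟶ config s false (tapes c) (seqs c)

    initial : Vec ℕ p → Vec Baire q → Config
    initial n x = config start false
      (Vec.replicate (masterTapes work) (load []) [ inputTape ]≔ load (numerals n))
      (x Vec.++ Vec.replicate (baireWork + 2) 0ᴺ)

    value : ∀ Y → Config → ⟦ Y ⟧
    value num c = number (lookup (tapes c) outputTape)
    value seq c = lookup (seqs c) (outputBaire q baireWork)

    Outputs : ∀ Y → Vec ℕ p → Vec Baire q → ⟦ Y ⟧ → Set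
    Outputs Y n x y = ∃ λ c →
      Star _⟶_ (initial n x) c × state c ≡ halt × Eq Y (value Y c) y

  Computable : ∀ {p q Y} → PartialFunction p q Y → Set
  Computable {p} {q} {Y} f = Σ (Machine p q) λ M →
    ∀ n x y → PartialFunction.Graph f n x y ⇔ Semantics.Outputs M Y n x y

{-# OPTIONS --safe #-}
-- Both kinds of machines are equivalent to structured counter programs, which
-- besides incrementing, decrementing and testing counters may test a fixed
-- Baire register for zero and replace a Baire register by Φˣ(e), where x
-- consists of all Baire registers and e is the content of a fixed counter.
--
-- A machine is interpreted by a loop over a program counter: the tapes of a
-- master become pairs of stacks, coded as numbers.  Conversely, programs are
-- compiled to flowcharts, a counter being a number register of a BSS-machine
-- (decremented by counting up to it) or a block of strokes on a master tape.
--
-- The main obstacle is that a BSS-machine calls Φ with oracles of its choice,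
-- while slaves see all Baire tapes.  As queries to oracles with index ≥ s are no
-- operations of a machine with s oracles, a code e for s oracles has to be
-- translated by renaming the oracles and making the other indices invalid for r
-- oracles as well.  This is done by a transducer on the digits of e, which a
-- counter program runs, adding up the digits of the result with their weights.
-- Copies, sums and products of Baire registers are computed by fixed slaves.
--
-- Counter programs are deterministic up to ≈, so that for the converse of a
-- simulation it suffices to find the simulated step; its existence is only in
-- question for calls and zero tests, where it is read off the given run.
module Submission where

open import Defs
open import Data.Bool.Base using (Bool; true; false; if_then_else_; T)
open import Data.Empty using (⊥; ⊥-elim)
open import Data.Fin.Base using (Fin; zero; suc; splitAt; join; toℕ; fromℕ<; _↑ˡ_; _↑ʳ_; inject≤)
open import Data.Fin.Patterns
open import Data.Fin.Properties using (splitAt-join; toℕ<n; splitAt-↑ˡ; splitAt-↑ʳ; join-splitAt; ↑ʳ-injective; ↑ˡ-injective; toℕ-fromℕ<; toℕ-inject≤; toℕ-↑ʳ; inject≤-injective) renaming (_≟_ to _≟ᶠ_; suc-injective to suc-injectiveᶠ)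
open import Data.List.Base as List using (List; []; _∷_; _++_; replicate)
open import Data.List.Relation.Unary.All using (All; []; _∷_)
open import Data.Maybe.Base as Maybe using (Maybe; just; nothing)
open import Data.Nat.Base using (ℕ; zero; suc; _+_; _≤_; z≤n; s≤s; _*_; _<_; _≡ᵇ_; pred; _∸_)
open import Data.Nat.Binary.Base using (ℕᵇ; 2[1+_]; 1+[2_]; fromℕ) renaming (zero to 0ᵇ; toℕ to ⟦_⟧ᵇ)
open import Data.Nat.Binary.Properties using () renaming (fromℕ-toℕ to fromℕ-toℕᵇ; toℕ-fromℕ to toℕ-fromℕᵇ)
open import Data.Nat.Properties using (≤-trans; ≤-refl; m≤n⇒m≤1+n; _<?_; +-suc; +-identityʳ; +-comm; +-assoc; ≡ᵇ⇒≡; <-irrefl; m≢1+n+m; suc-injective; 0≢1+n; *-zeroʳ; ≮⇒≥; m+[n∸m]≡n; +-monoʳ-≤; m≤m+n; <⇒≢; m∸n≡0⇒m≤n; n∸n≡0; ≤-antisym; m+n≡0⇒m≡0; m+n≡0⇒n≡0; 0∸n≡0; *-suc) renaming (_≟_ to _≟ℕ_)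
open import Data.Nat.Tactic.RingSolver using (solve-∀)
open import Data.Product.Base using (Σ; ∃; _×_; _,_; proj₁; proj₂)
open import Data.Sum.Base as Sum using (_⊎_; inj₁; inj₂; [_,_]′)
open import Data.Sum.Properties using (inj₂-injective)
open import Data.Unit.Base using (⊤; tt)
open import Data.Vec.Base as Vec using (Vec; lookup; []; _∷_; updateAt; _[_]≔_; allFin)
open import Data.Vec.Properties using (lookup∘updateAt; lookup∘updateAt′; lookup∘update; lookup∘update′; map-lookup-allFin; lookup-++ˡ; lookup-++ʳ; lookup-replicate; lookup-splitAt; lookup-map; []≔-lookup; updateAt-updateAt; updateAt-updateAt-local; updateAt-commutes; updateAt-id-local; updateAt-cong-local; map-updateAt; tabulate∘lookup; tabulate-cong; tabulate-∘; lookup-zipWith; map-[]≔; map-replicate)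
open import Function.Base using (_∘_; case_of_)
open import Function.Bundles using (_⇔_; mk⇔; Equivalence)
open import Function.Construct.Composition using (_⇔-∘_)
open import Relation.Binary.Construct.Closure.ReflexiveTransitive using (Star; ε; _◅_; _◅◅_)
open import Relation.Binary.PropositionalEquality using (_≡_; _≢_; refl; sym; trans; cong; cong₂; subst; subst₂)
open import Relation.Nullary.Decidable using (yes; no; Dec)
open import Relation.Nullary.Negation using (contradiction; ¬_)

-- Two undecidable questions shape the proof: whether Φˣ(e) is defined, and whether a Baire register
-- is zero. A step can therefore not be found by case distinction, and every simulation has to be
-- shown separately in both directions. For compiled programs the converse follows by inverting the
-- run of the translation. For an interpreter, whose loop body is a long program of its own,
-- inverting all of it would be laborious; there one run of the body is constructed, and determinism
-- identifies it with the given one. As a call may return any sequence pointwise equal to Φˣ(e),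
-- this works only up to `≈`, and all relations between stores have to respect it. The code handed
-- to Φ is data of the running machine, so recoding the oracles cannot happen once and for all at
-- compile time. Bijective base 2 makes it possible with finitely many counters, because an entry of
-- the coded list is a run of digits 2 closed by a digit 1, and only the tag and the argument of the
-- current quadruple have to be remembered. The equality test of number registers serves to
-- decrement in one direction and is replaced by a difference in the other.

-- Structured programs
module StructuredPrograms where

  record Language : Set₁ where
    no-eta-equality
    field
      State Prim Test : Set
      exec : Prim → State → State → Set
      test : Test → Bool → State → Set

  open Language

  infixr 5 _⨾_
  data Prog (L : Language) : Set where
    skip  : Prog L
    prim  : Prim L → Prog L
    _⨾_   : Prog L → Prog L → Prog L
    ifte  : Test L → Prog L → Prog L → Prog L
    until : Test L → Prog L → Prog L

  infix 4 ⟨_,_⟩⇓_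
  data ⟨_,_⟩⇓_ {L : Language} : Prog L → State L → State L → Set where
    skip    : ∀ {s} → ⟨ skip , s ⟩⇓ s
    prim    : ∀ {α s s′} → exec L α s s′ → ⟨ prim α , s ⟩⇓ s′
    _⨾_     : ∀ {P Q s s′ s″} → ⟨ P , s ⟩⇓ s′ → ⟨ Q , s′ ⟩⇓ s″ → ⟨ P ⨾ Q , s ⟩⇓ s″
    ifTrue  : ∀ {t P Q s s′} → test L t true s → ⟨ P , s ⟩⇓ s′ → ⟨ ifte t P Q , s ⟩⇓ s′
    ifFalse : ∀ {t P Q s s′} → test L t false s → ⟨ Q , s ⟩⇓ s′ → ⟨ ifte t P Q , s ⟩⇓ s′
    stop    : ∀ {t P s} → test L t true s → ⟨ until t P , s ⟩⇓ s
    loop    : ∀ {t P s s′ s″} → test L t false s → ⟨ P , s ⟩⇓ s′ →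
              ⟨ until t P , s′ ⟩⇓ s″ → ⟨ until t P , s ⟩⇓ s″

  -- Determinism depends on the primitives that occur: a program without calls is deterministic up
  -- to `≡`, whereas calls preserve only pointwise equality of the Baire registers.
  AllPrims : ∀ {L} → (Prim L → Set) → Prog L → Set
  AllPrims D skip         = ⊤
  AllPrims D (prim α)     = D α
  AllPrims D (P ⨾ Q)      = AllPrims D P × AllPrims D Q
  AllPrims D (ifte t P Q) = AllPrims D P × AllPrims D Q
  AllPrims D (until t P)  = AllPrims D P

  allPrims : ∀ {L} {D : Prim L → Set} → (∀ α → D α) → (P : Prog L) → AllPrims D P
  allPrims d skip         = tt
  allPrims d (prim α)     = d α
  allPrims d (P ⨾ Q)      = allPrims d P , allPrims d Q
  allPrims d (ifte t P Q) = allPrims d P , allPrims d Q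
  allPrims d (until t P)  = allPrims d P

  module Determinism {L : Language} (_~_ : State L → State L → Set) (D : Prim L → Set)
    (exec-det  : ∀ {α s s′ u u′} → D α → s ~ u → exec L α s s′ → exec L α u u′ → s′ ~ u′)
    (exclusive : ∀ {t s u} → s ~ u → test L t true s → test L t false u → ⊥)
    (~-sym     : ∀ {s u} → s ~ u → u ~ s) where

    ⇓-det : ∀ (P : Prog L) {s s′ u u′} → AllPrims D P → s ~ u → ⟨ P , s ⟩⇓ s′ → ⟨ P , u ⟩⇓ u′ → s′ ~ u′
    ⇓-det skip         d e skip skip = e
    ⇓-det (prim α)     d e (prim x) (prim y) = exec-det d e x y
    ⇓-det (P ⨾ Q)      d e (x ⨾ y) (x′ ⨾ y′) =
      ⇓-det Q (proj₂ d) (⇓-det P (proj₁ d) e x x′) y y′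
    ⇓-det (ifte t P Q) d e (ifTrue a x)  (ifTrue b y)  = ⇓-det P (proj₁ d) e x y
    ⇓-det (ifte t P Q) d e (ifTrue a x)  (ifFalse b y) = ⊥-elim (exclusive e a b)
    ⇓-det (ifte t P Q) d e (ifFalse a x) (ifTrue b y)  = ⊥-elim (exclusive (~-sym e) b a)
    ⇓-det (ifte t P Q) d e (ifFalse a x) (ifFalse b y) = ⇓-det Q (proj₂ d) e x y
    ⇓-det (until t P)  d e (stop a) (stop b) = e
    ⇓-det (until t P)  d e (stop a) (loop b _ _) = ⊥-elim (exclusive e a b)
    ⇓-det (until t P)  d e (loop a _ _) (stop b) = ⊥-elim (exclusive (~-sym e) b a)
    ⇓-det (until t P)  d e (loop a x y) (loop b x′ y′) =
      ⇓-det (until t P) d (⇓-det P d e x x′) y y′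

  module Translation {L₁ L₂ : Language} (R : State L₁ → State L₂ → Set)
    (tr : Prim L₁ → Prog L₂) (pre : Test L₁ → Prog L₂) (ts : Test L₁ → Test L₂) where

    -- Some tests need preparation, such as a zero test that has to set a bit first. In a loop,
    -- `pre t` therefore runs once before the loop and again at the end of each round, before the
    -- test is repeated.
    translate : Prog L₁ → Prog L₂
    translate skip         = skip
    translate (prim α)     = tr α
    translate (P ⨾ Q)      = translate P ⨾ translate Q
    translate (ifte t P Q) = pre t ⨾ ifte (ts t) (translate P) (translate Q)
    translate (until t P)  = pre t ⨾ until (ts t) (translate P ⨾ pre t)

    module Forward
      (tr-fwd : ∀ α {s s′ u} → R s u → exec L₁ α s s′ → ∃ λ u′ → ⟨ tr α , u ⟩⇓ u′ × R s′ u′)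
      (ts-fwd : ∀ t b {s u} → R s u → test L₁ t b s →
                ∃ λ u′ → ⟨ pre t , u ⟩⇓ u′ × R s u′ × test L₂ (ts t) b u′) where

      translate-fwd : ∀ {P : Prog L₁} {s s′ u} → R s u → ⟨ P , s ⟩⇓ s′ →
                      ∃ λ u′ → ⟨ translate P , u ⟩⇓ u′ × R s′ u′
      translate-fwd r skip = _ , skip , r
      translate-fwd r (prim x) = tr-fwd _ r x
      translate-fwd r (x ⨾ y) =
        let _ , x′ , r′ = translate-fwd r x
            _ , y′ , r″ = translate-fwd r′ y
        in _ , x′ ⨾ y′ , r″
      translate-fwd r (ifTrue a x) =
        let _ , p , r′ , a′ = ts-fwd _ _ r a
            _ , x′ , r″ = translate-fwd r′ x
        in _ , p ⨾ ifTrue a′ x′ , r″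
      translate-fwd r (ifFalse a x) =
        let _ , p , r′ , a′ = ts-fwd _ _ r a
            _ , x′ , r″ = translate-fwd r′ x
        in _ , p ⨾ ifFalse a′ x′ , r″
      translate-fwd r (stop a) =
        let _ , p , r′ , a′ = ts-fwd _ _ r a in _ , p ⨾ stop a′ , r′
      translate-fwd r (loop a x y) with ts-fwd _ _ r a
      ... | _ , p , r′ , a′ with translate-fwd r′ x
      ... | _ , x′ , r″ with translate-fwd r″ y
      ... | _ , q ⨾ y′ , r‴ = _ , p ⨾ loop a′ (x′ ⨾ q) y′ , r‴

    module Backward
      (tr-bwd : ∀ α {s u u′} → R s u → ⟨ tr α , u ⟩⇓ u′ → ∃ λ s′ → exec L₁ α s s′ × R s′ u′)
      (ts-bwd : ∀ t b {s u u′} → R s u → ⟨ pre t , u ⟩⇓ u′ → test L₂ (ts t) b u′ →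
                test L₁ t b s × R s u′) where

      translate-bwd : ∀ (P : Prog L₁) {s u u′} → R s u → ⟨ translate P , u ⟩⇓ u′ →
                      ∃ λ s′ → ⟨ P , s ⟩⇓ s′ × R s′ u′

      -- Separates the run of `pre t` from the loop that follows it. The one at the end of a round
      -- then takes the place of the initial one, and the recursion is structural on the run of the
      -- loop.
      until-bwd : ∀ t (P : Prog L₁) {s u v w} → R s u → ⟨ pre t , u ⟩⇓ v →
                  ⟨ until (ts t) (translate P ⨾ pre t) , v ⟩⇓ w →
                  ∃ λ s′ → ⟨ until t P , s ⟩⇓ s′ × R s′ w

      translate-bwd skip         r skip = _ , skip , r
      translate-bwd (prim α)     r x = let _ , y , r′ = tr-bwd _ r x in _ , prim y , r′
      translate-bwd (P ⨾ Q)      r (x ⨾ y) =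
        let _ , x′ , r′ = translate-bwd P r x
            _ , y′ , r″ = translate-bwd Q r′ y
        in _ , x′ ⨾ y′ , r″
      translate-bwd (ifte t P Q) r (p ⨾ ifTrue a x) =
        let a′ , r′ = ts-bwd _ _ r p a
            _ , x′ , r″ = translate-bwd P r′ x
        in _ , ifTrue a′ x′ , r″
      translate-bwd (ifte t P Q) r (p ⨾ ifFalse a x) =
        let a′ , r′ = ts-bwd _ _ r p a
            _ , x′ , r″ = translate-bwd Q r′ x
        in _ , ifFalse a′ x′ , r″
      translate-bwd (until t P)  r (p ⨾ x) = until-bwd t P r p x

      until-bwd t P r p (stop a) = let a′ , r′ = ts-bwd _ _ r p a in _ , stop a′ , r′
      until-bwd t P r p (loop a (x ⨾ q) y) =
        let a′ , r′ = ts-bwd _ _ r p a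
            _ , x′ , r″ = translate-bwd P r′ x
            _ , y′ , r‴ = until-bwd t P r″ q y
        in _ , loop a′ x′ y′ , r‴

  -- Compilation to flowcharts

  data FlowNode (L : Language) (N : Set) : Set where
    act    : Prim L → N → FlowNode L N
    branch : Test L → N → N → FlowNode L N

  module _ {L : Language} where

    Pos : Prog L → Set
    Pos skip         = ⊥
    Pos (prim α)     = ⊤
    Pos (P ⨾ Q)      = Pos P ⊎ Pos Q
    Pos (ifte t P Q) = ⊤ ⊎ (Pos P ⊎ Pos Q)
    Pos (until t P)  = ⊤ ⊎ Pos P

    size : Prog L → ℕ
    size skip         = 0
    size (prim α)     = 1
    size (P ⨾ Q)      = size P + size Q
    size (ifte t P Q) = 1 + (size P + size Q)
    size (until t P)  = 1 + size P

    index : ∀ P → Pos P → Fin (size P)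
    index (prim α)     _ = zero
    index (P ⨾ Q)      i = join (size P) _ (Sum.map (index P) (index Q) i)
    index (ifte t P Q) (inj₁ _) = zero
    index (ifte t P Q) (inj₂ i) = suc (join (size P) _ (Sum.map (index P) (index Q) i))
    index (until t P)  (inj₁ _) = zero
    index (until t P)  (inj₂ i) = suc (index P i)

    position : ∀ P → Fin (size P) → Pos P
    position (prim α)     i = tt
    position (P ⨾ Q)      i = Sum.map (position P) (position Q) (splitAt (size P) i)
    position (ifte t P Q) zero    = inj₁ tt
    position (ifte t P Q) (suc i) = inj₂ (Sum.map (position P) (position Q) (splitAt (size P) i))
    position (until t P)  zero    = inj₁ tt
    position (until t P)  (suc i) = inj₂ (position P i)

    position-index : ∀ P i → position P (index P i) ≡ i

    position-index-⊎ : ∀ P Q (i : Pos P ⊎ Pos Q) →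
      Sum.map (position P) (position Q)
        (splitAt (size P) (join (size P) _ (Sum.map (index P) (index Q) i))) ≡ i
    position-index-⊎ P Q i rewrite splitAt-join (size P) (size Q) (Sum.map (index P) (index Q) i)
      with i
    ... | inj₁ j = cong inj₁ (position-index P j)
    ... | inj₂ j = cong inj₂ (position-index Q j)

    position-index (prim α)     tt = refl
    position-index (P ⨾ Q)      i = position-index-⊎ P Q i
    position-index (ifte t P Q) (inj₁ tt) = refl
    position-index (ifte t P Q) (inj₂ i) = cong inj₂ (position-index-⊎ P Q i)
    position-index (until t P)  (inj₁ tt) = refl
    position-index (until t P)  (inj₂ i) = cong inj₂ (position-index P i)

    module _ {N : Set} where

      -- `at` places the positions of `P` among the nodes of the whole flowchart, and `x` is the
      -- node at which to continue. As `skip` has no position, its entry is its continuation; in the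
      -- body of a loop this is the node of the test.
      entryOf : ∀ P → (Pos P → N) → N → N
      entryOf skip         at x = x
      entryOf (prim α)     at x = at tt
      entryOf (P ⨾ Q)      at x = entryOf P (at ∘ inj₁) (entryOf Q (at ∘ inj₂) x)
      entryOf (ifte t P Q) at x = at (inj₁ tt)
      entryOf (until t P)  at x = at (inj₁ tt)

      nodeOf : ∀ P → (Pos P → N) → N → Pos P → FlowNode L N
      nodeOf (prim α)     at x _ = act α x
      nodeOf (P ⨾ Q)      at x (inj₁ i) = nodeOf P (at ∘ inj₁) (entryOf Q (at ∘ inj₂) x) i
      nodeOf (P ⨾ Q)      at x (inj₂ i) = nodeOf Q (at ∘ inj₂) x i
      nodeOf (ifte t P Q) at x (inj₁ _) =
        branch t (entryOf P (at ∘ inj₂ ∘ inj₁) x) (entryOf Q (at ∘ inj₂ ∘ inj₂) x)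
      nodeOf (ifte t P Q) at x (inj₂ (inj₁ i)) = nodeOf P (at ∘ inj₂ ∘ inj₁) x i
      nodeOf (ifte t P Q) at x (inj₂ (inj₂ i)) = nodeOf Q (at ∘ inj₂ ∘ inj₂) x i
      nodeOf (until t P)  at x (inj₁ _) = branch t x (entryOf P (at ∘ inj₂) (at (inj₁ tt)))
      nodeOf (until t P)  at x (inj₂ i) = nodeOf P (at ∘ inj₂) (at (inj₁ tt)) i

      module Flow (code : N → Maybe (FlowNode L N)) where

        data _⟶_ : N × State L → N × State L → Set where
          act    : ∀ {n m α s s′} → code n ≡ just (act α m) → exec L α s s′ → (n , s) ⟶ (m , s′)
          branch : ∀ {n m m′ t b s} → code n ≡ just (branch t m m′) → test L t b s →
                   (n , s) ⟶ ((if b then m else m′) , s)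

        Implements : ∀ P → (Pos P → N) → N → Set
        Implements P at x = ∀ i → code (at i) ≡ just (nodeOf P at x i)

        ⇓⇒⟶* : ∀ P {at x s s′} → Implements P at x → ⟨ P , s ⟩⇓ s′ →
                Star _⟶_ (entryOf P at x , s) (x , s′)
        ⇓⇒⟶* skip         c skip = ε
        ⇓⇒⟶* (prim α)     c (prim x) = act (c tt) x ◅ ε
        ⇓⇒⟶* (P ⨾ Q)      c (x ⨾ y) = ⇓⇒⟶* P (c ∘ inj₁) x ◅◅ ⇓⇒⟶* Q (c ∘ inj₂) y
        ⇓⇒⟶* (ifte t P Q) c (ifTrue a x)  = branch (c (inj₁ tt)) a ◅ ⇓⇒⟶* P (c ∘ inj₂ ∘ inj₁) x
        ⇓⇒⟶* (ifte t P Q) c (ifFalse a x) = branch (c (inj₁ tt)) a ◅ ⇓⇒⟶* Q (c ∘ inj₂ ∘ inj₂) x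
        ⇓⇒⟶* (until t P)  c (stop a) = branch (c (inj₁ tt)) a ◅ ε
        ⇓⇒⟶* (until t P)  c (loop a x y) =
          branch (c (inj₁ tt)) a ◅ ⇓⇒⟶* P (c ∘ inj₂) x ◅◅ ⇓⇒⟶* (until t P) c y

        length : ∀ {c c′} → Star _⟶_ c c′ → ℕ
        length ε       = 0
        length (_ ◅ r) = suc (length r)

        -- The fuel k bounds the length of the run, so that the recursion on
        -- the loops is structural.
        ⟶*⇒⇓′ : ∀ k P {at x s h u} → Implements P at x → code h ≡ nothing →
                 (r : Star _⟶_ (entryOf P at x , s) (h , u)) → length r ≤ k →
                 ∃ λ s′ → ⟨ P , s ⟩⇓ s′ × Σ (Star _⟶_ (x , s′) (h , u)) λ r′ → length r′ ≤ length r
        ⟶*⇒⇓′ k skip c z r l = _ , skip , r , ≤-refl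
        ⟶*⇒⇓′ k (prim α) c z ε l with trans (sym z) (c tt)
        ... | ()
        ⟶*⇒⇓′ k (prim α) c z (act e x ◅ r) l with trans (sym e) (c tt)
        ... | refl = _ , prim x , r , m≤n⇒m≤1+n ≤-refl
        ⟶*⇒⇓′ k (prim α) c z (branch e x ◅ r) l with trans (sym e) (c tt)
        ... | ()
        ⟶*⇒⇓′ k (P ⨾ Q) c z r l =
          let _ , x , r′ , l′ = ⟶*⇒⇓′ k P (c ∘ inj₁) z r l
              _ , y , r″ , l″ = ⟶*⇒⇓′ k Q (c ∘ inj₂) z r′ (≤-trans l′ l)
          in _ , x ⨾ y , r″ , ≤-trans l″ l′
        ⟶*⇒⇓′ k (ifte t P Q) c z ε l with trans (sym z) (c (inj₁ tt))
        ... | ()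
        ⟶*⇒⇓′ k (ifte t P Q) c z (act e x ◅ r) l with trans (sym e) (c (inj₁ tt))
        ... | ()
        ⟶*⇒⇓′ (suc k) (ifte t P Q) c z (branch {b = b} e a ◅ r) (s≤s l)
          with trans (sym e) (c (inj₁ tt)) | b
        ... | refl | true =
          let _ , x , r′ , l′ = ⟶*⇒⇓′ k P (c ∘ inj₂ ∘ inj₁) z r l
          in _ , ifTrue a x , r′ , m≤n⇒m≤1+n l′
        ... | refl | false =
          let _ , x , r′ , l′ = ⟶*⇒⇓′ k Q (c ∘ inj₂ ∘ inj₂) z r l
          in _ , ifFalse a x , r′ , m≤n⇒m≤1+n l′
        ⟶*⇒⇓′ k (until t P) c z ε l with trans (sym z) (c (inj₁ tt))
        ... | ()
        ⟶*⇒⇓′ k (until t P) c z (act e x ◅ r) l with trans (sym e) (c (inj₁ tt))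
        ... | ()
        ⟶*⇒⇓′ (suc k) (until t P) c z (branch {b = b} e a ◅ r) (s≤s l)
          with trans (sym e) (c (inj₁ tt)) | b
        ... | refl | true  = _ , stop a , r , m≤n⇒m≤1+n ≤-refl
        ... | refl | false =
          let _ , x , r′ , l′ = ⟶*⇒⇓′ k P (c ∘ inj₂) z r l
              _ , y , r″ , l″ = ⟶*⇒⇓′ k (until t P) c z r′ (≤-trans l′ l)
          in _ , loop a x y , r″ , m≤n⇒m≤1+n (≤-trans l″ l′)

        -- What remains of the run after `P` starts at the exit `x`, where there is no code, and is
        -- therefore empty.
        ⟶*⇒⇓ : ∀ P {at x s u} → Implements P at x → code x ≡ nothing →
                Star _⟶_ (entryOf P at x , s) (x , u) → ⟨ P , s ⟩⇓ u
        ⟶*⇒⇓ P c z r with ⟶*⇒⇓′ _ P c z r ≤-refl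
        ... | _ , x , ε , _ = x
        ... | _ , x , act e _ ◅ _ , _ with () ← trans (sym z) e
        ... | _ , x , branch e _ ◅ _ , _ with () ← trans (sym z) e

  module Flowchart {L : Language} (P : Prog L) where

    Label : Set
    Label = Maybe (Pos P)

    code : Label → Maybe (FlowNode L Label)
    code nothing  = nothing
    code (just i) = just (nodeOf P just nothing i)

    labels : ℕ
    labels = suc (size P)

    -- The exit receives number 0, which becomes the output node of a BSS-machine and the halting
    -- state of a master.
    number : Label → Fin labels
    number nothing  = zero
    number (just i) = suc (index P i)

    label : Fin labels → Label
    label zero    = nothing
    label (suc j) = just (position P j)

    label-number : ∀ l → label (number l) ≡ l
    label-number nothing  = refl
    label-number (just i) = cong just (position-index P i)

    start : Label
    start = entryOf P just nothing

    open Flow code public using (_⟶_; act; branch)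

    complete : ∀ {s s′} → ⟨ P , s ⟩⇓ s′ → Star _⟶_ (start , s) (nothing , s′)
    complete = Flow.⇓⇒⟶* code P (λ _ → refl)

    sound : ∀ {s s′} → Star _⟶_ (start , s) (nothing , s′) → ⟨ P , s ⟩⇓ s′
    sound = Flow.⟶*⇒⇓ code P (λ _ → refl) refl

open StructuredPrograms

-- Oracle machines
module OracleMachines where

  -- Renaming oracles, and Φ as a function up to pointwise equality

  module _ where
    open Slave

    mapOp : ∀ {q r} → (Fin q → Fin r) → Op q → Op r
    mapOp ρ goLeft    = goLeft
    mapOp ρ goRight   = goRight
    mapOp ρ (print a) = print a
    mapOp ρ (query k) = query (ρ k)

    mapProgram : ∀ {q r} → (Fin q → Fin r) → Program q → Program r
    mapProgram ρ = List.map λ where (quad s t a op s′) → quad s t a (mapOp ρ op) s′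

    module _ {q r} (ρ : Fin q → Fin r) (x : Vec Baire q) (x′ : Vec Baire r)
             (x≈x′ : ∀ k → lookup x k ≈ lookup x′ (ρ k)) where

      apply-rename : ∀ op t → apply x op t ≡ apply x′ (mapOp ρ op) t
      apply-rename goLeft    t = refl
      apply-rename goRight   t = refl
      apply-rename (print a) t = refl
      apply-rename (query k) t = cong (load ∘ numeral) (x≈x′ k (number t))

      step-rename : ∀ P c → step P x c ≡ step (mapProgram ρ P) x′ c
      step-rename [] c = refl
      step-rename (quad s t a op s′ ∷ P) c
        rewrite apply-rename op (tapes c t) | step-rename P c = refl

      star-rename : ∀ P {c d} → Star (λ c c′ → step P x c ≡ just c′) c d →
                    Star (λ c c′ → step (mapProgram ρ P) x′ c ≡ just c′) c d
      star-rename P ε = ε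
      star-rename P (e ◅ r) = trans (sym (step-rename P _)) e ◅ star-rename P r

      star-unrename : ∀ P {c d} → Star (λ c c′ → step (mapProgram ρ P) x′ c ≡ just c′) c d →
                      Star (λ c c′ → step P x c ≡ just c′) c d
      star-unrename P ε = ε
      star-unrename P (e ◅ r) = trans (step-rename P _) e ◅ star-unrename P r

      computes-rename : ∀ P {i n} → Computes P x i n → Computes (mapProgram ρ P) x′ i n
      computes-rename P (c , r , h , e) = c , star-rename P r , trans (sym (step-rename P c)) h , e

      computes-unrename : ∀ P {i n} → Computes (mapProgram ρ P) x′ i n → Computes P x i n
      computes-unrename P (c , r , h , e) = c , star-unrename P r , trans (step-rename P c) h , e

    mapProgram-id : ∀ {q} (P : Program q) → mapProgram (λ k → k) P ≡ P
    mapProgram-id [] = refl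
    mapProgram-id (quad s t a goLeft s′ ∷ P) = cong (_ ∷_) (mapProgram-id P)
    mapProgram-id (quad s t a goRight s′ ∷ P) = cong (_ ∷_) (mapProgram-id P)
    mapProgram-id (quad s t a (print x) s′ ∷ P) = cong (_ ∷_) (mapProgram-id P)
    mapProgram-id (quad s t a (query x) s′ ∷ P) = cong (_ ∷_) (mapProgram-id P)

    computes-functional : ∀ {q} (P : Program q) {x i m n} →
                          Computes P x i m → Computes P x i n → m ≡ n
    computes-functional P {x} (c , r , h , refl) (d , s , k , refl) =
      cong (λ c → number (tapes c 0)) (confluent r s)
      where
      confluent : ∀ {a} → Star (λ c c′ → step P x c ≡ just c′) a c →
                  Star (λ c c′ → step P x c ≡ just c′) a d → c ≡ d
      confluent ε ε = refl
      confluent ε (e ◅ _) with () ← trans (sym h) e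
      confluent (e ◅ _) ε with () ← trans (sym k) e
      confluent (e ◅ r) (f ◅ s) with refl ← trans (sym e) f = confluent r s

  infix 4 _≋_
  _≋_ : ∀ {q} → Vec Baire q → Vec Baire q → Set
  x ≋ y = ∀ k → lookup x k ≈ lookup y k

  -- Oracles that are merely pointwise equal are covered by the renaming lemma, with the identity as
  -- renaming.
  Φ-resp : ∀ {q} (x x′ : Vec Baire q) e {y} → x ≋ x′ → Φ[ x ]⟨ e ⟩≈ y → Φ[ x′ ]⟨ e ⟩≈ y
  Φ-resp {q} x x′ e x≋x′ c i =
    subst (λ P → Slave.Computes P x′ i _) (mapProgram-id (decode q e))
      (computes-rename (λ k → k) x x′ x≋x′ (decode q e) (c i))

  Φ-functional : ∀ {q} (x : Vec Baire q) e {y y′} → Φ[ x ]⟨ e ⟩≈ y → Φ[ x ]⟨ e ⟩≈ y′ → y ≈ y′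
  Φ-functional {q} x e c d i = computes-functional (decode q e) (c i) (d i)

  -- The code of a fixed program is abstract since it is far too large to be
  -- computed during type checking.
  abstract
    programCode : ∀ {q} → Program q → ℕ
    programCode = encode

    decode-programCode : ∀ {q} (P : Program q) → decode q (programCode P) ≡ P
    decode-programCode = decode∘encode

  Φ-programCode : ∀ {q} (P : Program q) {x y} → (∀ i → Slave.Computes P x i (y i)) →
                  Φ[ x ]⟨ programCode P ⟩≈ y
  Φ-programCode P {x} c i = subst (λ P → Slave.Computes P x i _) (sym (decode-programCode P)) (c i)

  -- Slaves that copy, add and multiply

  module _ where
    open Slave

    infix 4 _⊢_⟶*_
    -- A record, so that program and oracles can be inferred from the type of a run; in the bare
    -- `Star` they occur only below a function.
    record _⊢_⟶*_ {q} (Px : Program q × Vec Baire q) (c d : Config) : Set where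
      constructor run
      field path : Star (λ c c′ → step (proj₁ Px) (proj₂ Px) c ≡ just c′) c d

    open _⊢_⟶*_

    infixr 5 _then_
    _then_ : ∀ {q} {Px : Program q × Vec Baire q} {c d e} → Px ⊢ c ⟶* d → Px ⊢ d ⟶* e → Px ⊢ c ⟶* e
    r then s = run (path r ◅◅ path s)

    -- Finds the quadruple that fires from the symbol of a single tape. It evaluates for concrete
    -- states although the tapes are unknown, so that facts about fixed programs hold by `refl`. A
    -- quadruple for the same state on another tape yields `nothing`, since whether it fires depends
    -- on a symbol that is not given.
    instruction : ∀ {q} → Program q → (s t a : ℕ) → Maybe (Op q × ℕ)
    instruction []                     s t a = nothing
    instruction (quad s′ t′ a′ op n ∷ P) s t a =
      if s′ ≡ᵇ s
      then if t′ ≡ᵇ t then if a′ ≡ᵇ a then just (op , n) else instruction P s t a else nothing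
      else instruction P s t a

    instruction-step : ∀ {q} (P : Program q) {x s t a op n ts} →
      instruction P s t a ≡ just (op , n) → head (ts t) ≡ a →
      (P , x) ⊢ config s ts ⟶* config n (ts [ t ↦ apply x op (ts t) ])
    instruction-step P i e = run (fires P i e ◅ ε)
      where
      fires : ∀ {q} (P : Program q) {x s t a op n ts} →
        instruction P s t a ≡ just (op , n) → head (ts t) ≡ a →
        step P x (config s ts) ≡ just (config n (ts [ t ↦ apply x op (ts t) ]))
      fires (quad s′ t′ a′ op′ n ∷ P) {s = s} {t} {ts = ts} e refl
        with s′ ≡ᵇ s
      ... | false = fires P e refl
      ... | true with t′ ≡ᵇ t in t′≡t
      ...   | true with refl ← ≡ᵇ⇒≡ t′ t (subst T (sym t′≡t) _) with a′ ≡ᵇ head (ts t′) | e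
      ...     | true  | refl = refl
      ...     | false | e = fires P e refl

    ↦-same : ∀ ts t {new} → (ts [ t ↦ new ]) t ≡ new
    ↦-same ts t with t ≟ℕ t
    ... | yes _ = refl
    ... | no t≢t = contradiction refl t≢t

    ↦-other : ∀ ts t {new u} → u ≢ t → (ts [ t ↦ new ]) u ≡ ts u
    ↦-other ts t {u = u} u≢t with u ≟ℕ t
    ... | yes u≡t = contradiction u≡t u≢t
    ... | no _    = refl

    Bit : ℕ → Set
    Bit a = a ≡ 0 ⊎ a ≡ 1

    -- Only the strokes from the head up to the next blank count; other cells may hold leftovers.
    -- They have to be bits, however, because the programs have quadruples for the symbols 0 and 1
    -- only, and a push moves onto such a cell before overwriting it.
    record Counter (n : ℕ) (t : Tape ℕ) : Set where
      constructor counter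
      field
        lefts  : All Bit (left t)
        heads  : Bit (head t)
        rights : All Bit (right t)
        value  : number t ≡ n

    open Counter

    load-counter : ∀ n → Counter n (load (numeral n))
    load-counter zero    = counter [] (inj₁ refl) [] refl
    load-counter (suc n) = counter [] (inj₂ refl) (bits n) (cong suc (strokes-numeral n))
      where
      bits : ∀ n → All Bit (numeral n)
      bits zero    = []
      bits (suc n) = inj₂ refl ∷ bits n
      strokes-numeral : ∀ n → strokes (numeral n) ≡ n
      strokes-numeral zero    = refl
      strokes-numeral (suc n) = cong suc (strokes-numeral n)

    counter-zero : ∀ {t} → Counter 0 t → head t ≡ 0
    counter-zero (counter _ (inj₁ e) _ _)    = e
    counter-zero (counter _ (inj₂ refl) _ ())

    counter-suc : ∀ {n t} → Counter (suc n) t → head t ≡ 1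
    counter-suc (counter _ (inj₁ refl) _ ())
    counter-suc (counter _ (inj₂ e) _ _)    = e

    counter-moveR : ∀ {n t} → Counter (suc n) t → Counter n (move moveR t)
    counter-moveR (counter _ (inj₁ refl) _ ())
    counter-moveR {t = tape ls a []}       (counter l (inj₂ refl) r refl) =
      counter (inj₂ refl ∷ l) (inj₁ refl) [] refl
    counter-moveR {t = tape ls a (b ∷ rs)} (counter l (inj₂ refl) (h ∷ r) refl) =
      counter (inj₂ refl ∷ l) h r refl

    counter-moveL-head : ∀ {n t} → Counter n t → Bit (head (move moveL t))
    counter-moveL-head {t = tape [] a rs}      c = inj₁ refl
    counter-moveL-head {t = tape (b ∷ ls) a rs} (counter (h ∷ _) _ _ _) = h

    counter-push : ∀ {n t} → Counter n t → Counter (suc n) (write 1 (move moveL t))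
    counter-push {t = tape [] a rs}      (counter l h r v) =
      counter [] (inj₂ refl) (h ∷ r) (cong suc v)
    counter-push {t = tape (b ∷ ls) a rs} (counter (_ ∷ l) h r v) =
      counter l (inj₂ refl) (h ∷ r) (cong suc v)

    module _ {q} (P : Program q) {x : Vec Baire q} where

      onBit : ∀ {s t op n ts} → Bit (head (ts t)) →
        instruction P s t 0 ≡ just (op , n) → instruction P s t 1 ≡ just (op , n) →
        (P , x) ⊢ config s ts ⟶* config n (ts [ t ↦ apply x op (ts t) ])
      onBit (inj₁ h) e₀ e₁ = instruction-step P e₀ h
      onBit (inj₂ h) e₀ e₁ = instruction-step P e₁ h

      record Push (s s′ n t : ℕ) : Set where
        constructor pushes
        field
          left₀  : instruction P s t 0 ≡ just (goLeft , s′)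
          left₁  : instruction P s t 1 ≡ just (goLeft , s′)
          print₀ : instruction P s′ t 0 ≡ just (print 1 , n)
          print₁ : instruction P s′ t 1 ≡ just (print 1 , n)

      push-run : ∀ {s s′ n t m ts} → Push s s′ n t → Counter m (ts t) →
        ∃ λ ts′ → (P , x) ⊢ config s ts ⟶* config n ts′ × Counter (suc m) (ts′ t) ×
                  (∀ {u} → u ≢ t → ts′ u ≡ ts u)
      push-run {t = t} {ts = ts} (pushes l₀ l₁ p₀ p₁) c =
        _ ,
        onBit (heads c) l₀ l₁ then
        onBit (subst (Bit ∘ head) (sym (↦-same ts t)) (counter-moveL-head c)) p₀ p₁ ,
        subst (Counter _) (sym (trans (↦-same _ t) (cong (write 1) (↦-same ts t)))) (counter-push c) ,
        λ u≢t → trans (↦-other _ t u≢t) (↦-other ts t u≢t)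

      -- Moves the number on tape a to the tapes b and c.
      record Mover (s₀ s₁ s₂ s₃ s₄ n a b c : ℕ) : Set where
        constructor mover
        field
          done : instruction P s₀ a 0 ≡ just (print 0 , n)
          next : instruction P s₀ a 1 ≡ just (goRight , s₁)
          onto₁ : Push s₁ s₂ s₃ b
          onto₂ : Push s₃ s₄ s₀ c
          a≢b : a ≢ b
          a≢c : a ≢ c
          b≢c : b ≢ c

      mover-run : ∀ {s₀ s₁ s₂ s₃ s₄ n a b c} (M : Mover s₀ s₁ s₂ s₃ s₄ n a b c) → ∀ i {j k ts} →
        Counter i (ts a) → Counter j (ts b) → Counter k (ts c) →
        ∃ λ ts′ → (P , x) ⊢ config s₀ ts ⟶* config n ts′ × Counter 0 (ts′ a) ×
          Counter (i + j) (ts′ b) × Counter (i + k) (ts′ c) ×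
          (∀ {u} → u ≢ a → u ≢ b → u ≢ c → ts′ u ≡ ts u)
      mover-run {a = a} {b} {c} (mover d _ _ _ a≢b a≢c b≢c) zero {ts = ts} A B C =
        _ , instruction-step P d (counter-zero A) ,
        subst (Counter 0) (sym (↦-same ts a)) (rewrite-zero A) ,
        subst (Counter _) (sym (↦-other ts a (a≢b ∘ sym))) B ,
        subst (Counter _) (sym (↦-other ts a (a≢c ∘ sym))) C ,
        λ u≢a _ _ → ↦-other ts a u≢a
        where
        rewrite-zero : ∀ {t} → Counter 0 t → Counter 0 (write 0 t)
        rewrite-zero (counter l _ r _) = counter l (inj₁ refl) r refl
      mover-run {a = a} {b} {c} M@(mover _ e p p′ a≢b a≢c b≢c) (suc i) {j} {k} {ts} A B C
        with push-run p (subst (Counter j) (sym (↦-other ts a {move moveR (ts a)} (a≢b ∘ sym))) B)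
      ... | ts₂ , r₂ , B₂ , same₂
        with push-run p′ (subst (Counter k)
               (sym (trans (same₂ (b≢c ∘ sym)) (↦-other ts a {move moveR (ts a)} (a≢c ∘ sym)))) C)
      ... | ts₃ , r₃ , C₃ , same₃
        with mover-run M i
               (subst (Counter i) (sym (trans (same₃ a≢c) (trans (same₂ a≢b) (↦-same ts a)))) (counter-moveR A))
               (subst (Counter (suc j)) (sym (same₃ b≢c)) B₂) C₃
      ... | ts₄ , r₄ , A₄ , B₄ , C₄ , same₄ =
        ts₄ , instruction-step P e (counter-suc A) then r₂ then r₃ then r₄ , A₄ ,
        subst (λ m → Counter m (ts₄ b)) (+-suc i j) B₄ ,
        subst (λ m → Counter m (ts₄ c)) (+-suc i k) C₄ ,
        λ u≢a u≢b u≢c → trans (same₄ u≢a u≢b u≢c)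
          (trans (same₃ u≢c) (trans (same₂ u≢b) (↦-other ts a u≢a)))

      query-run : ∀ {s n t k i ts} → Counter i (ts t) →
        instruction P s t 0 ≡ just (query k , n) → instruction P s t 1 ≡ just (query k , n) →
        ∃ λ ts′ → (P , x) ⊢ config s ts ⟶* config n ts′ × Counter (lookup x k i) (ts′ t) ×
                  (∀ {u} → u ≢ t → ts′ u ≡ ts u)
      query-run {t = t} {k} {ts = ts} c e₀ e₁ =
        _ , onBit (heads c) e₀ e₁ ,
        subst (Counter _) (sym (trans (↦-same ts t)
          (cong (load ∘ numeral ∘ lookup x k) (value c)))) (load-counter _) ,
        ↦-other ts t

    -- Every quadruple has to apply an operation. Leaving the loop therefore prints the blank that
    -- is scanned anyway.
    moverProgram : ∀ {q} (s₀ s₁ s₂ s₃ s₄ n a b c : ℕ) → Program q → Program q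
    moverProgram s₀ s₁ s₂ s₃ s₄ n a b c P =
      quad s₀ a 0 (print 0) n ∷ quad s₀ a 1 goRight s₁ ∷
      quad s₁ b 0 goLeft s₂ ∷ quad s₁ b 1 goLeft s₂ ∷
      quad s₂ b 0 (print 1) s₃ ∷ quad s₂ b 1 (print 1) s₃ ∷
      quad s₃ c 0 goLeft s₄ ∷ quad s₃ c 1 goLeft s₄ ∷
      quad s₄ c 0 (print 1) s₀ ∷ quad s₄ c 1 (print 1) s₀ ∷ P

    queryProgram : ∀ {q} → (s n t : ℕ) → Fin q → Program q → Program q
    queryProgram s n t k P = quad s t 0 (query k) n ∷ quad s t 1 (query k) n ∷ P

    copyProgram : ∀ {q} → Fin q → Program q
    copyProgram k = queryProgram 0 1 0 k []

    computes : ∀ {q} (P : Program q) {x i n s} → (∀ ts → step P x (config s ts) ≡ nothing) →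
      (∃ λ ts → (P , x) ⊢ initial i ⟶* config s ts × Counter n (ts 0)) → Computes P x i n
    computes P {s = s} h (ts , r , c) = config s ts , path r , h ts , value c

    copy-computes : ∀ {q} (k : Fin q) {x} i → Computes (copyProgram k) x i (lookup x k i)
    copy-computes k {x} i = computes (copyProgram k) (λ ts → refl)
      (let ts , r , c , _ = query-run (copyProgram k) {x} {0} {1} {0} {ts = tapes (initial i)} (load-counter i) refl refl
       in ts , r , c)

    -- Tape 9 is a dump.  State 100 halts.
    withArguments : ∀ {q} → Fin q → Fin q → Program q → Program q
    withArguments k l P = moverProgram 0 1 2 3 4 5 0 1 2
      (queryProgram 5 6 1 k (queryProgram 6 7 2 l P))

    -- The result is collected on tape 0, which is empty once the argument has been spread to tapes
    -- 1 and 2. For the product, tape 1 counts rounds; in each of them tape 2 is added to tape 0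
    -- while being saved on tape 3, and is then restored. A mover always has two targets, so one
    -- that needs a single target sends its second copy to the dump.
    addProgram multProgram : ∀ {q} → Fin q → Fin q → Program q
    addProgram k l = withArguments k l
      (moverProgram 7 8 9 10 11 12 1 0 9 (moverProgram 12 13 14 15 16 100 2 0 9 []))
    multProgram k l = withArguments k l
      (quad 7 1 0 (print 0) 100 ∷ quad 7 1 1 goRight 8 ∷
       moverProgram 8 9 10 11 12 13 2 0 3 (moverProgram 13 14 15 16 17 7 3 2 9 []))

    pattern blank-counter = counter [] (inj₁ refl) [] refl

    module _ {q} (P : Program q) {x : Vec Baire q} where

      -- The required quadruples are assumed for an arbitrary `P`. The runs are thus verified
      -- without unfolding a concrete program, and the assumptions are discharged by computation
      -- afterwards.
      record Arguments (k l : Fin q) : Set where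
        constructor arguments
        field
          spread : Mover P {x} 0 1 2 3 4 5 0 1 2
          first₀  : instruction P 5 1 0 ≡ just (query k , 6)
          first₁  : instruction P 5 1 1 ≡ just (query k , 6)
          second₀ : instruction P 6 2 0 ≡ just (query l , 7)
          second₁ : instruction P 6 2 1 ≡ just (query l , 7)

      arguments-run : ∀ {k l} → Arguments k l → ∀ i →
        ∃ λ ts → (P , x) ⊢ initial i ⟶* config 7 ts × Counter 0 (ts 0) ×
          Counter (lookup x k i) (ts 1) × Counter (lookup x l i) (ts 2) ×
          Counter 0 (ts 3) × Counter 0 (ts 9)
      arguments-run (arguments m e₀ e₁ f₀ f₁) i
        with mover-run P m i {ts = tapes (initial i)} (load-counter i) blank-counter blank-counter
      ... | ts₁ , r₁ , a₁ , b₁ , c₁ , same₁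
        with query-run P {ts = ts₁} (subst (λ m → Counter m (ts₁ 1)) (+-identityʳ i) b₁) e₀ e₁
      ... | ts₂ , r₂ , b₂ , same₂
        with query-run P {ts = ts₂} (subst (λ m → Counter m (ts₂ 2)) (+-identityʳ i)
               (subst (Counter _) (sym (same₂ (λ ()))) c₁)) f₀ f₁
      ... | ts₃ , r₃ , c₃ , same₃ =
        ts₃ , r₁ then r₂ then r₃ ,
        subst (Counter 0) (sym (trans (same₃ (λ ())) (same₂ (λ ())))) a₁ ,
        subst (Counter _) (sym (same₃ (λ ()))) b₂ , c₃ ,
        subst (Counter 0) (sym (trans (same₃ (λ ())) (trans (same₂ (λ ())) (same₁ (λ ()) (λ ()) (λ ()))))) blank-counter ,
        subst (Counter 0) (sym (trans (same₃ (λ ())) (trans (same₂ (λ ())) (same₁ (λ ()) (λ ()) (λ ()))))) blank-counter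

      add-run : ∀ {k l} → Arguments k l → Mover P {x} 7 8 9 10 11 12 1 0 9 →
        Mover P {x} 12 13 14 15 16 100 2 0 9 → ∀ i →
        ∃ λ ts → (P , x) ⊢ initial i ⟶* config 100 ts × Counter (lookup x k i + lookup x l i) (ts 0)
      add-run {k} {l} A M M′ i with arguments-run A i
      ... | ts₁ , r₁ , a₁ , b₁ , c₁ , d₁ , e₁
        with mover-run P M _ {ts = ts₁} b₁ a₁ e₁
      ... | ts₂ , r₂ , b₂ , a₂ , e₂ , same₂
        with mover-run P M′ _ {ts = ts₂} (subst (Counter _) (sym (same₂ (λ ()) (λ ()) (λ ()))) c₁) a₂ e₂
      ... | ts₃ , r₃ , c₃ , a₃ , e₃ , same₃ =
        ts₃ , r₁ then r₂ then r₃ ,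
        subst (λ m → Counter m (ts₃ 0)) (trans (+-comm (lookup x l i) _)
          (cong (_+ lookup x l i) (+-identityʳ (lookup x k i)))) a₃

      module _ (out : instruction P 7 1 0 ≡ just (print 0 , 100))
               (again : instruction P 7 1 1 ≡ just (goRight , 8))
               (M : Mover P {x} 8 9 10 11 12 13 2 0 3) (M′ : Mover P {x} 13 14 15 16 17 7 3 2 9) where

        mult-loop : ∀ a {b r e ts} →
          Counter r (ts 0) → Counter a (ts 1) → Counter b (ts 2) → Counter 0 (ts 3) → Counter e (ts 9) →
          ∃ λ ts′ → (P , x) ⊢ config 7 ts ⟶* config 100 ts′ × Counter (a * b + r) (ts′ 0)
        mult-loop zero {ts = ts} R A B C E =
          _ , instruction-step P {s = 7} {1} {ts = ts} out (counter-zero A) , R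
        mult-loop (suc a) {b} {r} {ts = ts} R A B C E
          with mover-run P M b {ts = ts [ 1 ↦ move moveR (ts 1) ]} B R C
        ... | ts₂ , r₂ , b₂ , a₂ , c₂ , same₂
          with mover-run P M′ (b + 0) {ts = ts₂} c₂ b₂
                 (subst (Counter _) (sym (same₂ (λ ()) (λ ()) (λ ()))) E)
        ... | ts₃ , r₃ , c₃ , b₃ , e₃ , same₃
          with mult-loop a {b} {b + r} {ts = ts₃}
                 (subst (Counter _) (sym (same₃ (λ ()) (λ ()) (λ ()))) a₂)
                 (subst (Counter _) (sym (trans (same₃ (λ ()) (λ ()) (λ ())) (same₂ (λ ()) (λ ()) (λ ())))) (counter-moveR A))
                 (subst (λ m → Counter m (ts₃ 2)) (trans (+-identityʳ (b + 0)) (+-identityʳ b)) b₃) c₃ e₃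
        ... | ts₄ , r₄ , a₄ =
          ts₄ , (instruction-step P {s = 7} {1} {ts = ts} again (counter-suc A) then r₂ then r₃ then r₄) ,
          subst (λ m → Counter m (ts₄ 0)) (trans (sym (+-assoc (a * b) b r)) (cong (_+ r) (+-comm (a * b) b))) a₄

        mult-run : ∀ {k l} → Arguments k l → ∀ i →
          ∃ λ ts → (P , x) ⊢ initial i ⟶* config 100 ts × Counter (lookup x k i * lookup x l i) (ts 0)
        mult-run A i with arguments-run A i
        ... | ts₁ , r₁ , a₁ , b₁ , c₁ , d₁ , e₁ with mult-loop _ a₁ b₁ c₁ d₁ e₁
        ... | ts₂ , r₂ , a₂ =
          ts₂ , r₁ then r₂ , subst (λ m → Counter m (ts₂ 0)) (+-identityʳ _) a₂

    pattern mover-refl a b c = mover refl refl (pushes refl refl refl refl) (pushes refl refl refl refl) a b c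

    add-computes : ∀ {q} (k l : Fin q) {x} i →
      Computes (addProgram k l) x i (lookup x k i + lookup x l i)
    add-computes k l {x} i = computes (addProgram k l) (λ ts → refl)
      (add-run (addProgram k l) {x} (arguments (mover-refl (λ ()) (λ ()) (λ ())) refl refl refl refl)
        (mover-refl (λ ()) (λ ()) (λ ())) (mover-refl (λ ()) (λ ()) (λ ())) i)

    mult-computes : ∀ {q} (k l : Fin q) {x} i →
      Computes (multProgram k l) x i (lookup x k i * lookup x l i)
    mult-computes k l {x} i = computes (multProgram k l) (λ ts → refl)
      (mult-run (multProgram k l) {x} refl refl
        (mover-refl (λ ()) (λ ()) (λ ())) (mover-refl (λ ()) (λ ()) (λ ()))
        (arguments (mover-refl (λ ()) (λ ()) (λ ())) refl refl refl refl) i)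

open OracleMachines

-- Renaming oracles in codes

module Recoding (r : ℕ) where

  -- The value `r` is the least index that `decodeOp r` rejects. If an index `k` with `s ≤ k < r`
  -- were kept, a quadruple dropped by the machine with `s` oracles would become part of the machine
  -- with `r` oracles and might fire there.
  renameIndex : ∀ {s} → Vec (Fin r) s → ℕ → ℕ
  renameIndex []       k       = r
  renameIndex (j ∷ js) zero    = toℕ j
  renameIndex (j ∷ js) (suc k) = renameIndex js k

  renameArg : ∀ {s} → Vec (Fin r) s → ℕ → ℕ → ℕ
  renameArg js 0                   k = k
  renameArg js 1                   k = k
  renameArg js 2                   k = k
  renameArg js (suc (suc (suc _))) k = renameIndex js k

  renameIndex-< : ∀ {s} (js : Vec (Fin r) s) {k} (k<s : k < s) →
    renameIndex js k ≡ toℕ (lookup js (fromℕ< k<s))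
  renameIndex-< (j ∷ js) {zero}  (s≤s _) = refl
  renameIndex-< (j ∷ js) {suc k} (s≤s l) = renameIndex-< js l

  renameIndex-≮ : ∀ {s} (js : Vec (Fin r) s) {k} → (k < s → ⊥) → renameIndex js k ≡ r
  renameIndex-≮ []       k≮s = refl
  renameIndex-≮ (j ∷ js) {zero}  k≮s = contradiction (s≤s z≤n) k≮s
  renameIndex-≮ (j ∷ js) {suc k} k≮s = renameIndex-≮ js (λ l → k≮s (s≤s l))

  append2s : ℕ → ℕᵇ → ℕᵇ
  append2s zero    b = b
  append2s (suc n) b = 2[1+ append2s n b ]

  -- A transducer on the digits: f is the field of the quadruple that is being
  -- read, g and k count the digits 2 of the tag and of the argument.  The
  -- argument is only put out when it has been read completely.
  module _ {s} (js : Vec (Fin r) s) where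

    recode : Fin 6 → ℕ → ℕ → ℕᵇ → ℕᵇ
    recode f  g k 0ᵇ       = 0ᵇ
    recode 0F g k 2[1+ b ] = 2[1+ recode 0F g k b ]
    recode 1F g k 2[1+ b ] = 2[1+ recode 1F g k b ]
    recode 2F g k 2[1+ b ] = 2[1+ recode 2F g k b ]
    recode 3F g k 2[1+ b ] = 2[1+ recode 3F (suc g) k b ]
    recode 4F g k 2[1+ b ] = recode 4F g (suc k) b
    recode 5F g k 2[1+ b ] = 2[1+ recode 5F g k b ]
    recode 0F g k 1+[2 b ] = 1+[2 recode 1F g k b ]
    recode 1F g k 1+[2 b ] = 1+[2 recode 2F g k b ]
    recode 2F g k 1+[2 b ] = 1+[2 recode 3F g k b ]
    recode 3F g k 1+[2 b ] = 1+[2 recode 4F g k b ]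
    recode 4F g k 1+[2 b ] = append2s (renameArg js g k) 1+[2 recode 5F 0 0 b ]
    recode 5F g k 1+[2 b ] = 1+[2 recode 0F g k b ]

    -- The effect of the transducer on the list that is coded. When it stops within a tag or an
    -- argument, `g` or `k` is the part already counted and the head of the list is the rest; hence
    -- the sums `g + n` and `k + n`.
    recodeList : Fin 6 → ℕ → ℕ → List ℕ → List ℕ
    recodeList f  g k []       = []
    recodeList 0F g k (n ∷ ns) = n ∷ recodeList 1F g k ns
    recodeList 1F g k (n ∷ ns) = n ∷ recodeList 2F g k ns
    recodeList 2F g k (n ∷ ns) = n ∷ recodeList 3F g k ns
    recodeList 3F g k (n ∷ ns) = n ∷ recodeList 4F (g + n) k ns
    recodeList 4F g k (n ∷ ns) = renameArg js g (k + n) ∷ recodeList 5F 0 0 ns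
    recodeList 5F g k (n ∷ ns) = n ∷ recodeList 0F g k ns

    private
      ℓ : ℕᵇ → List ℕ
      ℓ = digits→list

    digits-append2s : ∀ n b → ℓ (append2s n 1+[2 b ]) ≡ n ∷ ℓ b
    digits-append2s zero    b = refl
    digits-append2s (suc n) b = cong increment (digits-append2s n b)

    -- A digit 2 commutes with the transducer in the fields that it merely passes on. In the tag and
    -- in the argument it changes the state instead.
    recodeList-increment : ∀ f g k ns → f ≢ 3F → f ≢ 4F →
      recodeList f g k (increment ns) ≡ increment (recodeList f g k ns)
    recodeList-increment f  g k []       _   _   = refl
    recodeList-increment 0F g k (_ ∷ ns) _   _   = refl
    recodeList-increment 1F g k (_ ∷ ns) _   _   = refl
    recodeList-increment 2F g k (_ ∷ ns) _   _   = refl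
    recodeList-increment 3F g k (_ ∷ ns) f≢3 _   = contradiction refl f≢3
    recodeList-increment 4F g k (_ ∷ ns) _   f≢4 = contradiction refl f≢4
    recodeList-increment 5F g k (_ ∷ ns) _   _   = refl

    recodeList-increment-tag : ∀ g k ns →
      recodeList 3F g k (increment ns) ≡ increment (recodeList 3F (suc g) k ns)
    recodeList-increment-tag g k []       = refl
    recodeList-increment-tag g k (n ∷ ns) =
      cong (λ g → suc n ∷ recodeList 4F g k ns) (+-suc g n)

    -- Digits 2 that no digit 1 closes code no entry of the list. So nothing is lost if the input
    -- ends while an argument is still held back.
    recodeList-increment-arg : ∀ g k ns →
      recodeList 4F g k (increment ns) ≡ recodeList 4F g (suc k) ns
    recodeList-increment-arg g k []       = refl
    recodeList-increment-arg g k (n ∷ ns) =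
      cong (λ a → renameArg js g a ∷ recodeList 5F 0 0 ns) (+-suc k n)

    digits-recode-arg : ∀ g k b → ℓ (recode 4F g k b) ≡ recodeList 4F g k (ℓ b)

    digits-recode : ∀ f g k b → ℓ (recode f g k b) ≡ recodeList f g k (ℓ b)
    digits-recode f  g k 0ᵇ       = refl
    digits-recode 0F g k 2[1+ b ] = trans (cong increment (digits-recode 0F g k b))
      (sym (recodeList-increment 0F g k (ℓ b) (λ ()) (λ ())))
    digits-recode 1F g k 2[1+ b ] = trans (cong increment (digits-recode 1F g k b))
      (sym (recodeList-increment 1F g k (ℓ b) (λ ()) (λ ())))
    digits-recode 2F g k 2[1+ b ] = trans (cong increment (digits-recode 2F g k b))
      (sym (recodeList-increment 2F g k (ℓ b) (λ ()) (λ ())))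
    digits-recode 3F g k 2[1+ b ] = trans (cong increment (digits-recode 3F (suc g) k b))
      (sym (recodeList-increment-tag g k (ℓ b)))
    digits-recode 4F g k b        = digits-recode-arg g k b
    digits-recode 5F g k 2[1+ b ] = trans (cong increment (digits-recode 5F g k b))
      (sym (recodeList-increment 5F g k (ℓ b) (λ ()) (λ ())))
    digits-recode 0F g k 1+[2 b ] = cong (0 ∷_) (digits-recode 1F g k b)
    digits-recode 1F g k 1+[2 b ] = cong (0 ∷_) (digits-recode 2F g k b)
    digits-recode 2F g k 1+[2 b ] = cong (0 ∷_) (digits-recode 3F g k b)
    digits-recode 3F g k 1+[2 b ] = cong (0 ∷_) (trans (digits-recode 4F g k b)
      (cong (λ g → recodeList 4F g k (ℓ b)) (sym (+-identityʳ g))))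
    digits-recode 5F g k 1+[2 b ] = cong (0 ∷_) (digits-recode 0F g k b)

    digits-recode-arg g k 0ᵇ       = refl
    digits-recode-arg g k 2[1+ b ] = trans (digits-recode 4F g (suc k) b)
      (sym (recodeList-increment-arg g k (ℓ b)))
    digits-recode-arg g k 1+[2 b ] = trans (digits-append2s (renameArg js g k) (recode 5F 0 0 b))
      (cong₂ (λ a → renameArg js g a ∷_) (sym (+-identityʳ k)) (digits-recode 5F 0 0 b))

    decodeOp-query : ∀ (j : Fin r) → decodeOp r 3 (toℕ j) ≡ just (query j)
    decodeOp-query j = decodeOp-encode (query j)

    decodeOp-recode : ∀ tag arg → decodeOp r tag (renameArg js tag arg) ≡
                      Maybe.map (mapOp (lookup js)) (decodeOp s tag arg)
    decodeOp-recode 0 k = refl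
    decodeOp-recode 1 k = refl
    decodeOp-recode 2 k = refl
    decodeOp-recode (suc (suc (suc t))) k with k <? s
    ... | yes k<s rewrite renameIndex-< js k<s = decodeOp-query (lookup js (fromℕ< k<s))
    ... | no k≮s rewrite renameIndex-≮ js k≮s with r <? r
    ...   | yes r<r = contradiction r<r (<-irrefl refl)
    ...   | no _    = refl

    parse-recode : ∀ ns → parse r (recodeList 0F 0 0 ns) ≡ mapProgram (lookup js) (parse s ns)
    parse-recode []                              = refl
    parse-recode (_ ∷ [])                        = refl
    parse-recode (_ ∷ _ ∷ [])                    = refl
    parse-recode (_ ∷ _ ∷ _ ∷ [])                = refl
    parse-recode (_ ∷ _ ∷ _ ∷ _ ∷ [])            = refl
    parse-recode (_ ∷ _ ∷ _ ∷ _ ∷ _ ∷ [])        = refl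
    parse-recode (_ ∷ _ ∷ _ ∷ tag ∷ arg ∷ _ ∷ ns)
      rewrite decodeOp-recode tag arg | parse-recode ns with decodeOp s tag arg
    ... | just op = refl
    ... | nothing = refl

    recodeℕ : ℕ → ℕ
    recodeℕ e = ⟦ recode 0F 0 0 (fromℕ e) ⟧ᵇ

    decode-recode : ∀ e → decode r (recodeℕ e) ≡ mapProgram (lookup js) (decode s e)
    decode-recode e = trans
      (cong (λ b → parse r (ℓ b)) (fromℕ-toℕᵇ (recode 0F 0 0 (fromℕ e))))
      (trans (cong (parse r) (digits-recode 0F 0 0 (fromℕ e))) (parse-recode (ℓ (fromℕ e))))

    module _ {x : Vec Baire s} {x′ : Vec Baire r} (x≈x′ : ∀ k → lookup x k ≈ lookup x′ (lookup js k)) where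

      Φ-recode : ∀ {e y} → Φ[ x ]⟨ e ⟩≈ y → Φ[ x′ ]⟨ recodeℕ e ⟩≈ y
      Φ-recode {e} c i = subst (λ P → Slave.Computes P x′ i _) (sym (decode-recode e))
        (computes-rename (lookup js) x x′ x≈x′ (decode s e) (c i))

      Φ-unrecode : ∀ {e y} → Φ[ x′ ]⟨ recodeℕ e ⟩≈ y → Φ[ x ]⟨ e ⟩≈ y
      Φ-unrecode {e} c i = computes-unrename (lookup js) x x′ x≈x′ (decode s e)
        (subst (λ P → Slave.Computes P x′ i _) (decode-recode e) (c i))

-- Counter programs

module IM where

  data Instr (c b : ℕ) : Set where
    inc dec : Fin c → Instr c b
    call    : Fin b → Instr c b

  data Cond (c : ℕ) : Set where
    isZero  : Fin c → Cond c
    zeroSeq : Cond c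

  record Store (c b : ℕ) : Set where
    constructor _∣_
    field
      counters : Vec ℕ c
      seqs     : Vec Baire b

  infix 3 _∣_

  open Store public

  -- Counter 2 is the billboard.
  data Executes {v b} : Instr (9 + v) b → Store (9 + v) b → Store (9 + v) b → Set where
    inc  : ∀ {k ns xs} → Executes (inc k) (ns ∣ xs) (updateAt ns k suc ∣ xs)
    dec  : ∀ {k ns xs} → Executes (dec k) (ns ∣ xs) (updateAt ns k pred ∣ xs)
    call : ∀ {l ns xs y} → Φ[ xs ]⟨ lookup ns (suc (suc zero)) ⟩≈ y →
           Executes (call l) (ns ∣ xs) (ns ∣ xs [ l ]≔ y)

  Holds : ∀ {c b} → Fin b → Cond c → Bool → Store c b → Set
  Holds z (isZero k) true  σ = lookup (counters σ) k ≡ 0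
  Holds z (isZero k) false σ = lookup (counters σ) k ≢ 0
  Holds z zeroSeq    true  σ = lookup (seqs σ) z ≈ 0ᴺ
  Holds z zeroSeq    false σ = ¬ lookup (seqs σ) z ≈ 0ᴺ

  -- The nine leading counters are a program counter and the eight that recoding needs, among them
  -- the billboard, on which its result is accumulated. Counters 0, 1 and 2 have the indices of the
  -- master's input tape, output tape and billboard, so a compiled master needs no translation of
  -- indices.
  language : ∀ v {b} → Fin b → Language
  language v {b} z = record
    { State = Store (9 + v) b
    ; Prim  = Instr (9 + v) b
    ; Test  = Cond (9 + v)
    ; exec  = Executes
    ; test  = Holds z
    }

  infix 4 _~_
  record _~_ {c b} (σ τ : Store c b) : Set where
    constructor _,_
    field
      counters-≡ : counters σ ≡ counters τ
      seqs-≋     : seqs σ ≋ seqs τ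

  open _~_ public

  ~-refl : ∀ {c b} {σ : Store c b} → σ ~ σ
  ~-refl = refl , λ k i → refl

  ~-sym : ∀ {c b} {σ τ : Store c b} → σ ~ τ → τ ~ σ
  ~-sym (e , f) = sym e , λ k i → sym (f k i)

  ≔-≋ : ∀ {b} (xs xs′ : Vec Baire b) {y y′} l → xs ≋ xs′ → y ≈ y′ → xs [ l ]≔ y ≋ xs′ [ l ]≔ y′
  ≔-≋ xs xs′ l e f k i with k ≟ᶠ l
  ... | yes refl = trans (cong (λ x → x i) (lookup∘updateAt k xs))
                     (trans (f i) (sym (cong (λ x → x i) (lookup∘updateAt k xs′))))
  ... | no k≢l   = trans (cong (λ x → x i) (lookup∘updateAt′ k l k≢l xs))
                     (trans (e k i) (sym (cong (λ x → x i) (lookup∘updateAt′ k l k≢l xs′))))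

  module _ {v b : ℕ} {z : Fin b} where

    executes-det : ∀ {α} {σ σ′ τ τ′ : Store (9 + v) b} → σ ~ τ →
                   Executes α σ σ′ → Executes α τ τ′ → σ′ ~ τ′
    executes-det (refl , f) inc inc = refl , f
    executes-det (refl , f) dec dec = refl , f
    executes-det {σ = σ} (refl , f) (call {l} {ns} {xs} c) (call {xs = xs′} d) =
      -- The first call is transported to the oracles of the second, where Φ is functional.
      refl , ≔-≋ xs xs′ l f (Φ-functional xs′ e (Φ-resp xs xs′ e f c) d)
      where e = lookup ns (suc (suc zero))

    holds-exclusive : ∀ {t} {σ τ : Store (9 + v) b} → σ ~ τ → Holds z t true σ → Holds z t false τ → ⊥
    holds-exclusive {isZero k} (refl , _) h h′ = h′ h
    holds-exclusive {zeroSeq}  (_ , f)    h h′ = h′ (λ i → trans (sym (f z i)) (h i))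

    ⇓-deterministic : ∀ (P : Prog (language v z)) {σ σ′ τ τ′} → σ ~ τ →
                      ⟨ P , σ ⟩⇓ σ′ → ⟨ P , τ ⟩⇓ τ′ → σ′ ~ τ′
    ⇓-deterministic P = Determinism.⇓-det {language v z} _~_ (λ _ → ⊤) (λ _ → executes-det)
      (λ {t} → holds-exclusive {t}) ~-sym P (allPrims (λ _ → tt) P)

  module _ (p q : ℕ) (Y : Sort) where

    record Machine : Set where
      field
        extra work : ℕ
        program    : Prog (language (p + extra) (MS.zeroTestTape q work))

  output : ∀ {v} q w Y → Store (9 + v) (q + (w + 2)) → ⟦ Y ⟧
  output q w num σ = lookup (counters σ) (suc zero)
  output q w seq σ = lookup (seqs σ) (MS.outputBaire q w)

  module _ {p q Y} (M : Machine p q Y) where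
    open Machine M

    initial : Vec ℕ p → Vec Baire q → Store (9 + (p + extra)) (q + (work + 2))
    initial n x = Vec.replicate 9 0 Vec.++ (n Vec.++ Vec.replicate extra 0) ∣
                  x Vec.++ Vec.replicate (work + 2) 0ᴺ

    Outputs : Vec ℕ p → Vec Baire q → ⟦ Y ⟧ → Set
    Outputs n x y = ∃ λ σ → ⟨ program , initial n x ⟩⇓ σ × Eq Y (output q work Y σ) y

-- From counter programs to BSS-machines

module BSSLanguage where
  open BSS

  holds : ∀ {a b} → Test a b → Bool → Store a b → Set
  holds t true  σ = Holds t σ
  holds t false σ = ¬ Holds t σ

  language : ℕ → ℕ → Language
  language a b = record
    { State = Store a b
    ; Prim  = Instruction a b
    ; Test  = Test a b
    ; exec  = Executes
    ; test  = holds
    }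

  module Assemble {p q Y} (extraNum extraSeq : ℕ)
    (P : Prog (language (p + extraNum) (q + extraSeq)))
    (result : Register (p + extraNum) (q + extraSeq) Y) where

    module F = Flowchart P

    node′ : Maybe (FlowNode (language (p + extraNum) (q + extraSeq)) F.Label) →
            BSS.Node F.labels (p + extraNum) (q + extraSeq)
    node′ nothing               = output
    node′ (just (act α l))      = compute α (F.number l)
    node′ (just (branch t l m)) = branch t (F.number l) (F.number m)

    machine : Machine p q Y
    machine = record
      { extraNum = extraNum
      ; extraSeq = extraSeq
      ; nodes    = F.labels
      ; entry    = F.number F.start
      ; node     = λ j → node′ (F.code (F.label j))
      ; result   = result
      }

    module S = Semantics machine

    node-number : ∀ l → Machine.node machine (F.number l) ≡ node′ (F.code l)
    node-number l = cong (node′ ∘ F.code) (F.label-number l)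

    step : ∀ {l m σ τ} → (l , σ) F.⟶ (m , τ) → (F.number l , σ) S.⟶ (F.number m , τ)
    step {l} (F.act e x) = S.compute (trans (node-number l) (cong node′ e)) x
    step {l} (F.branch {b = true} e h)  = S.true (trans (node-number l) (cong node′ e)) h
    step {l} (F.branch {b = false} e h) = S.false (trans (node-number l) (cong node′ e)) h

    step⁻¹ : ∀ {l j σ τ} → (F.number l , σ) S.⟶ (j , τ) →
             ∃ λ m → j ≡ F.number m × ((l , σ) F.⟶ (m , τ))
    step⁻¹ {l} (S.compute e x) with F.code l in c | trans (sym (node-number l)) e
    ... | just (act α m)      | refl = m , refl , F.act c x
    step⁻¹ {l} (S.true e x) with F.code l in c | trans (sym (node-number l)) e
    ... | just (branch t m n) | refl = m , refl , F.branch c x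
    step⁻¹ {l} (S.false e x) with F.code l in c | trans (sym (node-number l)) e
    ... | just (branch t m n) | refl = n , refl , F.branch c x

    steps : ∀ {l m σ τ} → Star F._⟶_ (l , σ) (m , τ) → Star S._⟶_ (F.number l , σ) (F.number m , τ)
    steps ε = ε
    steps (x ◅ r) = step x ◅ steps r

    steps⁻¹ : ∀ {l j σ τ} → Star S._⟶_ (F.number l , σ) (j , τ) → Machine.node machine j ≡ output →
              Star F._⟶_ (l , σ) (nothing , τ)
    steps⁻¹ {l} ε e with l | trans (sym (node-number l)) e
    ... | nothing | _ = ε
    ... | just i  | e with F.code (just i) in c
    ...   | just (act _ _)      with () ← e
    ...   | just (branch _ _ _) with () ← e
    steps⁻¹ (_◅_ {j = _ , _} x r) e with step⁻¹ x
    ... | _ , refl , y = y ◅ steps⁻¹ r e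

    outputs : ∀ {n x y} → S.Outputs n x y ⇔
              (∃ λ σ → ⟨ P , proj₂ (S.initial n x) ⟩⇓ σ × Eq Y (S.value Y result σ) y)
    outputs = mk⇔
      (λ (j , σ , r , e , v) → σ , F.sound (steps⁻¹ {F.start} r e) , v)
      (λ (σ , r , v) → zero , σ , steps (F.complete r) , refl , v)

-- The predecessor on a BSS-machine

module Decrement {a b : ℕ} (t₁ t₂ k : Fin a) (t₁≢t₂ : t₁ ≢ t₂) (k≢t₁ : k ≢ t₁) (k≢t₂ : k ≢ t₂) where
  open BSS
  open BSSLanguage

  -- Two counters run up to the number in k, the first one step behind.
  catchUp decrement : Prog (language a b)
  catchUp = until (equalNum t₂ k) (prim (addOne t₁) ⨾ prim (addOne t₂))
  decrement =
    prim (setZero t₁) ⨾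
    ifte (equalNum t₁ k) skip
      (prim (setZero t₂) ⨾ prim (addOne t₂) ⨾
       catchUp ⨾ prim (copyNum k t₁))

  NumPrim : Instruction a b → Set
  NumPrim (setZero _)   = ⊤
  NumPrim (addOne _)    = ⊤
  NumPrim (copyNum _ _) = ⊤
  NumPrim _             = ⊥

  ⇓-det : ∀ P {σ τ υ} → AllPrims NumPrim P → ⟨ P , σ ⟩⇓ τ → ⟨ P , σ ⟩⇓ υ → τ ≡ υ
  ⇓-det P d = Determinism.⇓-det {language a b} _≡_ NumPrim det (λ { {t} → excl {t} }) sym P d refl
    where
    det : ∀ {α σ τ υ ω} → NumPrim α → σ ≡ υ → Executes α σ τ → Executes α υ ω → τ ≡ ω
    det _ refl setZero setZero = refl
    det _ refl addOne  addOne  = refl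
    det _ refl copyNum copyNum = refl
    excl : ∀ {t σ τ} → σ ≡ τ → holds t true σ → holds t false τ → ⊥
    excl refl h h′ = h′ h

  Same : Vec ℕ a → Vec ℕ a → Set
  Same ns ms = ∀ j → j ≢ t₁ → j ≢ t₂ → lookup ns j ≡ lookup ms j

  countUp : ∀ d {i ns xs} → lookup ns t₁ ≡ i → lookup ns t₂ ≡ suc i → lookup ns k ≡ suc (d + i) →
    ∃ λ ms → ⟨ catchUp , store ns xs ⟩⇓ store ms xs
           × lookup ms t₁ ≡ d + i × Same ms ns
  countUp zero    e₁ e₂ e₃ = _ , stop (trans e₂ (sym e₃)) , e₁ , λ _ _ _ → refl
  countUp (suc d) {i} {ns} e₁ e₂ e₃ =
    let ms , r , e , s = countUp d {suc i} {ns″}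
          (trans (lookup∘update′ t₁≢t₂ ns′ _) (trans (lookup∘update t₁ ns _) (cong suc e₁)))
          (trans (lookup∘update t₂ ns′ _) (cong suc (trans (lookup∘update′ (t₁≢t₂ ∘ sym) ns _) e₂)))
          (trans (same k k≢t₁ k≢t₂) (trans e₃ (cong suc (sym (+-suc d i)))))
    in ms , loop (λ h → i≢ (trans (sym e₂) (trans h e₃))) (prim addOne ⨾ prim addOne) r ,
       trans e (+-suc d i) , λ j p p′ → trans (s j p p′) (same j p p′)
    where
    ns′ = ns [ t₁ ]≔ suc (lookup ns t₁)
    ns″ = ns′ [ t₂ ]≔ suc (lookup ns′ t₂)
    same : Same ns″ ns
    same j p p′ = trans (lookup∘update′ p′ ns′ _) (lookup∘update′ p ns _)
    i≢ : suc i ≢ suc (suc (d + i))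
    i≢ h = m≢1+n+m i (suc-injective h)

  decrements : ∀ ns xs → ∃ λ ms → ⟨ decrement , store ns xs ⟩⇓ store ms xs ×
    lookup ms k ≡ pred (lookup ns k) × (∀ j → j ≢ k → j ≢ t₁ → j ≢ t₂ → lookup ms j ≡ lookup ns j)
  decrements ns xs with lookup ns k in e
  -- Zero has to be caught before the loop: the counter that runs ahead starts at 1 and would never
  -- meet it.
  ... | zero =
    _ , prim setZero ⨾ ifTrue (trans (lookup∘update t₁ ns _) (sym (trans (lookup∘update′ k≢t₁ ns _) e))) skip ,
    trans (lookup∘update′ k≢t₁ ns _) e , λ j _ p _ → lookup∘update′ p ns _
  ... | suc n =
    let ms , r , c , s = countUp n {0} {ns‴} e₁ e₂ e₃
    in _ , prim setZero ⨾
       ifFalse (λ h → 0≢1+n (trans (sym (lookup∘update t₁ ns 0)) (trans h (trans (lookup∘update′ k≢t₁ ns 0) e))))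
         (prim setZero ⨾ prim addOne ⨾ r ⨾ prim copyNum) ,
       trans (lookup∘update k ms _) (trans c (+-identityʳ n)) ,
       λ j j≢k p p′ → trans (lookup∘update′ j≢k ms _) (trans (s j p p′) (same j p p′))
    where
    ns′ = ns [ t₁ ]≔ 0
    ns″ = ns′ [ t₂ ]≔ 0
    ns‴ = ns″ [ t₂ ]≔ suc (lookup ns″ t₂)
    e₁ : lookup ns‴ t₁ ≡ 0
    e₁ = trans (lookup∘update′ t₁≢t₂ ns″ _) (trans (lookup∘update′ t₁≢t₂ ns′ _) (lookup∘update t₁ ns _))
    e₂ : lookup ns‴ t₂ ≡ 1
    e₂ = trans (lookup∘update t₂ ns″ _) (cong suc (lookup∘update t₂ ns′ 0))
    same : Same ns‴ ns
    same j p p′ = trans (lookup∘update′ p′ ns″ _) (trans (lookup∘update′ p′ ns′ _) (lookup∘update′ p ns _))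
    e₃ : lookup ns‴ k ≡ suc (n + 0)
    e₃ = trans (same k k≢t₁ k≢t₂) (trans e (cong suc (sym (+-identityʳ n))))

module IM⇒BSS {p q Y} (M : IM.Machine p q Y) where
  open IM.Machine M renaming (extra to e; work to w; program to P)

  private
    a = p + (2 + (9 + e))
    b = q + (w + 2)

  -- The registers consist of the inputs, two auxiliary registers and the
  -- remaining counters, in this order.
  tail-register : Fin (p + e) → Fin a
  tail-register j with splitAt p j
  ... | inj₁ u = u ↑ˡ (2 + (9 + e))
  ... | inj₂ v = p ↑ʳ (2 ↑ʳ (9 ↑ʳ v))

  register : Fin (9 + (p + e)) → Fin a
  register k with splitAt 9 k
  ... | inj₁ i = p ↑ʳ (2 ↑ʳ (i ↑ˡ e))
  ... | inj₂ j = tail-register j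

  -- A common left inverse of `auxiliary` and `register`, from which all distinctness of registers
  -- follows.
  content : Fin a → Fin 2 ⊎ Fin (9 + (p + e))
  content x with splitAt p x
  ... | inj₁ u = inj₂ (9 ↑ʳ (u ↑ˡ e))
  ... | inj₂ v with splitAt 2 v
  ...   | inj₁ t = inj₁ t
  ...   | inj₂ v with splitAt 9 v
  ...     | inj₁ i = inj₂ (i ↑ˡ (p + e))
  ...     | inj₂ v = inj₂ (9 ↑ʳ (p ↑ʳ v))

  auxiliary : Fin 2 → Fin a
  auxiliary t = p ↑ʳ (t ↑ˡ (9 + e))

  content-auxiliary : ∀ t → content (auxiliary t) ≡ inj₁ t
  content-auxiliary t rewrite splitAt-↑ʳ p (2 + (9 + e)) (t ↑ˡ (9 + e)) | splitAt-↑ˡ 2 t (9 + e) = refl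

  content-register : ∀ k → content (register k) ≡ inj₂ k
  content-register k with splitAt 9 k in s
  ... | inj₁ i rewrite splitAt-↑ʳ p (2 + (9 + e)) (2 ↑ʳ (i ↑ˡ e)) | splitAt-↑ˡ 9 i e =
    cong inj₂ (trans (cong (join 9 (p + e)) (sym s)) (join-splitAt 9 (p + e) k))
  ... | inj₂ j with splitAt p j in s′
  ...   | inj₁ u rewrite splitAt-↑ˡ p u (2 + (9 + e)) =
    cong inj₂ (trans (cong (9 ↑ʳ_) (trans (cong (join p e) (sym s′)) (join-splitAt p e j)))
      (trans (cong (join 9 (p + e)) (sym s)) (join-splitAt 9 (p + e) k)))
  ...   | inj₂ v rewrite splitAt-↑ʳ p (2 + (9 + e)) (2 ↑ʳ (9 ↑ʳ v)) =
    cong inj₂ (trans (cong (9 ↑ʳ_) (trans (cong (join p e) (sym s′)) (join-splitAt p e j)))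
      (trans (cong (join 9 (p + e)) (sym s)) (join-splitAt 9 (p + e) k)))

  register-injective : ∀ {k l} → register k ≡ register l → k ≡ l
  register-injective {k} {l} h =
    inj₂-injective (trans (sym (content-register k)) (trans (cong content h) (content-register l)))

  register≢auxiliary : ∀ {k t} → register k ≢ auxiliary t
  register≢auxiliary {k} {t} h
    with () ← trans (sym (content-register k)) (trans (cong content h) (content-auxiliary t))

  auxiliary-distinct : auxiliary zero ≢ auxiliary (suc zero)
  auxiliary-distinct h
    with () ← trans (sym (content-auxiliary zero)) (trans (cong content h) (content-auxiliary (suc zero)))

  private
    z = MS.zeroTestTape q w
    L₁ = IM.language (p + e) z
    L₂ = BSSLanguage.language a b

  module D k = Decrement {a} {b} (auxiliary zero) (auxiliary (suc zero)) (register k)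
    auxiliary-distinct (register≢auxiliary {k}) (register≢auxiliary {k})

  -- A counter program passes all Baire registers to Φ, in their order. A BSS-machine can do this
  -- literally, so codes stay unchanged in this direction.
  instr : IM.Instr (9 + (p + e)) b → Prog L₂
  instr (IM.inc k)  = prim (BSS.addOne (register k))
  instr (IM.dec k)  = D.decrement k
  instr (IM.call l) = prim (BSS.call l (register (suc (suc zero))) (allFin b))

  cond : IM.Cond (9 + (p + e)) → BSS.Test a b
  cond (IM.isZero k) = BSS.isZeroNum (register k)
  cond IM.zeroSeq    = BSS.isZeroSeq z

  record R (σ : IM.Store (9 + (p + e)) b) (τ : BSS.Store a b) : Set where
    constructor rel
    field
      nums : ∀ k → lookup (BSS.nums τ) (register k) ≡ lookup (IM.counters σ) k
      seqs : BSS.seqs τ ≡ IM.seqs σ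

  open Translation {L₁} {L₂} R instr (λ _ → skip) cond

  updated : ∀ ns (ms ms′ : Vec ℕ a) k (f : ℕ → ℕ) → (∀ l → lookup ms (register l) ≡ lookup ns l) →
    lookup ms′ (register k) ≡ f (lookup ns k) →
    (∀ l → l ≢ k → lookup ms′ (register l) ≡ lookup ms (register l)) →
    ∀ l → lookup ms′ (register l) ≡ lookup (updateAt ns k f) l
  updated ns ms ms′ k f r e same l with l ≟ᶠ k
  ... | yes refl = trans e (sym (lookup∘updateAt k ns))
  ... | no l≢k   = trans (same l l≢k) (trans (r l) (sym (lookup∘updateAt′ l k l≢k ns)))

  dec-rel : ∀ ns {ms xs} k → (∀ l → lookup ms (register l) ≡ lookup ns l) →
    ∃ λ ms′ → ⟨ D.decrement k , BSS.store ms xs ⟩⇓ BSS.store ms′ xs ×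
      (∀ l → lookup ms′ (register l) ≡ lookup (updateAt ns k pred) l)
  dec-rel ns {ms} {xs} k r with D.decrements k ms xs
  ... | ms′ , d , h , same = ms′ , d , updated ns ms ms′ k pred r (trans h (cong pred (r k)))
    (λ l l≢k → same _ (l≢k ∘ register-injective) (register≢auxiliary {l}) (register≢auxiliary {l}))

  inc-rel : ∀ ns ms k → (∀ l → lookup ms (register l) ≡ lookup ns l) →
    ∀ l → lookup (ms [ register k ]≔ suc (lookup ms (register k))) (register l) ≡ lookup (updateAt ns k suc) l
  inc-rel ns ms k r = updated ns ms (ms [ register k ]≔ suc (lookup ms (register k))) k suc r (trans (lookup∘update (register k) ms _) (cong suc (r k)))
    (λ l l≢k → lookup∘update′ (l≢k ∘ register-injective {l} {k}) ms _)

  instr-fwd : ∀ α {σ σ′ τ} → R σ τ → IM.Executes α σ σ′ → ∃ λ τ′ → ⟨ instr α , τ ⟩⇓ τ′ × R σ′ τ′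
  instr-fwd _ {τ = BSS.store ms _} (rel r refl) (IM.inc {k} {ns}) = _ , prim BSS.addOne , rel (inc-rel ns ms k r) refl
  instr-fwd _ {τ = BSS.store ms _} (rel r refl) (IM.dec {k} {ns}) =
    let _ , d , r′ = dec-rel ns k r in _ , d , rel r′ refl
  instr-fwd _ {τ = BSS.store ms xs} (rel r refl) (IM.call {y = y} c) =
    _ , prim (BSS.call (subst₂ (λ xs e → Φ[ xs ]⟨ e ⟩≈ y) (sym (map-lookup-allFin xs)) (sym (r _)) c)) , rel r refl

  instr-bwd : ∀ α {σ τ τ′} → R σ τ → ⟨ instr α , τ ⟩⇓ τ′ → ∃ λ σ′ → IM.Executes α σ σ′ × R σ′ τ′
  instr-bwd (IM.inc k) {σ} {τ} (rel r refl) (prim BSS.addOne) = _ , IM.inc , rel (inc-rel (IM.counters σ) (BSS.nums τ) k r) refl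
  instr-bwd (IM.dec k) {σ} {τ} (rel r refl) x with dec-rel (IM.counters σ) {xs = BSS.seqs τ} k r
  -- Decrementing involves no call, so the given run is literally the constructed one.
  ... | ms′ , d , r′ with refl ← D.⇓-det k (D.decrement k) _ d x = _ , IM.dec , rel r′ refl
  instr-bwd (IM.call l) {σ} {τ} (rel r refl) (prim (BSS.call {y = y} c)) =
    _ , IM.call (subst₂ (λ xs e → Φ[ xs ]⟨ e ⟩≈ y) (map-lookup-allFin (BSS.seqs τ)) (r _) c) , rel r refl

  cond-fwd : ∀ t b {σ τ} → R σ τ → IM.Holds z t b σ → BSSLanguage.holds (cond t) b τ
  cond-fwd (IM.isZero k) true  (rel r _) h = trans (r k) h
  cond-fwd (IM.isZero k) false (rel r _) h = λ h′ → h (trans (sym (r k)) h′)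
  cond-fwd IM.zeroSeq  true  (rel _ refl) h = h
  cond-fwd IM.zeroSeq  false (rel _ refl) h = h

  cond-bwd : ∀ t b {σ τ} → R σ τ → BSSLanguage.holds (cond t) b τ → IM.Holds z t b σ
  cond-bwd (IM.isZero k) true  (rel r _) h = trans (sym (r k)) h
  cond-bwd (IM.isZero k) false (rel r _) h = λ h′ → h (trans (r k) h′)
  cond-bwd IM.zeroSeq  true  (rel _ refl) h = h
  cond-bwd IM.zeroSeq  false (rel _ refl) h = h

  skip-fwd : ∀ t b {σ τ} → R σ τ → IM.Holds z t b σ →
             ∃ λ τ′ → ⟨ skip {L₂} , τ ⟩⇓ τ′ × R σ τ′ × BSSLanguage.holds (cond t) b τ′
  skip-fwd t b r h = _ , skip , r , cond-fwd t b r h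

  skip-bwd : ∀ t b {σ τ τ′} → R σ τ → ⟨ skip {L₂} , τ ⟩⇓ τ′ → BSSLanguage.holds (cond t) b τ′ →
             IM.Holds z t b σ × R σ τ′
  skip-bwd t b r skip h = cond-bwd t b r h , r

  open Forward instr-fwd skip-fwd
  open Backward instr-bwd skip-bwd

  result : ∀ Y → BSS.Register a b Y
  result num = register (suc zero)
  result seq = MS.outputBaire q w

  module A = BSSLanguage.Assemble {p} {q} {Y} (2 + (9 + e)) (w + 2) (translate P) (result Y)
  open A

  initial-rel : ∀ n x → R (IM.initial M n x) (proj₂ (BSS.Semantics.initial machine n x))
  initial-rel n x = rel start refl
    where
    zeros = Vec.replicate 9 0
    zeros′ = Vec.replicate (2 + (9 + e)) 0
    inputs = n Vec.++ Vec.replicate e 0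
    start : ∀ k → lookup (n Vec.++ zeros′) (register k) ≡ lookup (zeros Vec.++ inputs) k
    start k with splitAt 9 k in s
    ... | inj₁ i =
      trans (lookup-++ʳ n zeros′ _) (trans (lookup-replicate (2 ↑ʳ (i ↑ˡ e)) 0) (sym
      (trans (lookup-splitAt 9 zeros inputs k) (trans (cong [ lookup zeros , lookup inputs ]′ s)
      (lookup-replicate i 0)))))
    ... | inj₂ j = trans (start′ j) (sym (trans (lookup-splitAt 9 zeros inputs k)
      (cong [ lookup zeros , lookup inputs ]′ s)))
      where
      start′ : ∀ j → lookup (n Vec.++ zeros′) (tail-register j) ≡ lookup inputs j
      start′ j with splitAt p j in s′
      ... | inj₁ u = trans (lookup-++ˡ n zeros′ u) (sym
        (trans (lookup-splitAt p n (Vec.replicate e 0) j) (cong [ lookup n , lookup (Vec.replicate e 0) ]′ s′)))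
      ... | inj₂ v = trans (lookup-++ʳ n zeros′ _) (trans (lookup-replicate (2 ↑ʳ (9 ↑ʳ v)) 0) (sym
        (trans (lookup-splitAt p n (Vec.replicate e 0) j)
        (trans (cong [ lookup n , lookup (Vec.replicate e 0) ]′ s′) (lookup-replicate v 0)))))

  value-rel : ∀ Y {σ τ y} → R σ τ → Eq Y (IM.output q w Y σ) y ⇔ Eq Y (S.value Y (result Y) τ) y
  value-rel num (rel r refl) = mk⇔ (trans (r _)) (trans (sym (r _)))
  value-rel seq (rel r refl) = mk⇔ (λ h → h) (λ h → h)

  simulates : ∀ {n x y} → IM.Outputs M n x y ⇔ BSS.Semantics.Outputs machine n x y
  simulates {n} {x} = mk⇔
    (λ (_ , d , v) → let τ , d′ , r = translate-fwd (initial-rel n x) d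
                     in Equivalence.from outputs (τ , d′ , Equivalence.to (value-rel Y r) v))
    (λ o → let τ , d′ , v = Equivalence.to outputs o
               σ , d , r = translate-bwd P (initial-rel n x) d′
           in σ , d , Equivalence.from (value-rel Y r) v)

-- From counter programs to MS-machines

module Master where

  Cell : Set
  Cell = Fin 2

  open Tapes {Cell} zero (suc zero) _≟ᶠ_ public

  data Instr (m b : ℕ) : Set where
    put       : Fin m → Cell → Instr m b
    shift     : Fin m → Move → Instr m b
    callSlave : Fin b → Instr m b
    zeroTest  : Instr m b

  data Cond (m : ℕ) : Set where
    blank : Fin m → Cond m
    bit   : Cond m

  record Store (m b : ℕ) : Set where
    constructor store
    field
      flag  : Bool
      tapes : Vec (Tape Cell) m
      seqs  : Vec Baire b

  open Store public

  data Executes {w b} (z : Fin b) : Instr (3 + w) b → Store (3 + w) b → Store (3 + w) b → Set where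
    put        : ∀ {k a c ts xs} → Executes z (put k a) (store c ts xs) (store c (updateAt ts k (write a)) xs)
    shift      : ∀ {k d c ts xs} → Executes z (shift k d) (store c ts xs) (store c (updateAt ts k (move d)) xs)
    callSlave  : ∀ {l c ts xs y} → Φ[ xs ]⟨ number (lookup ts MS.billboard) ⟩≈ y →
                 Executes z (callSlave l) (store c ts xs) (store c ts (xs [ l ]≔ y))
    isZero     : ∀ {c ts xs} → lookup xs z ≈ 0ᴺ → Executes z zeroTest (store c ts xs) (store true ts xs)
    isNonzero  : ∀ {c ts xs} → ¬ lookup xs z ≈ 0ᴺ → Executes z zeroTest (store c ts xs) (store false ts xs)

  isBlank : Cell → Bool
  isBlank zero    = true
  isBlank (suc _) = false

  Holds : ∀ {m b} → Cond m → Bool → Store m b → Set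
  Holds (blank k) c σ = isBlank (head (lookup (tapes σ) k)) ≡ c
  Holds bit       c σ = flag σ ≡ c

  language : ∀ w {b} → Fin b → Language
  language w {b} z = record
    { State = Store (3 + w) b
    ; Prim  = Instr (3 + w) b
    ; Test  = Cond (3 + w)
    ; exec  = Executes z
    ; test  = Holds
    }

  TapePrim : ∀ {m b} → Instr m b → Set
  TapePrim (put _ _)     = ⊤
  TapePrim (shift _ _)   = ⊤
  TapePrim (callSlave _) = ⊥
  TapePrim zeroTest      = ⊥

  ⇓-det : ∀ {w b} {z : Fin b} (P : Prog (language w z)) {σ τ υ} → AllPrims TapePrim P →
          ⟨ P , σ ⟩⇓ τ → ⟨ P , σ ⟩⇓ υ → τ ≡ υ
  ⇓-det {w} {z = z} P d = Determinism.⇓-det {language w z} _≡_ TapePrim det (λ { {t} → excl {t} }) sym P d refl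
    where
    det : ∀ {α σ τ υ ω} → TapePrim α → σ ≡ υ → Executes z α σ τ → Executes z α υ ω → τ ≡ ω
    det _ refl put put     = refl
    det _ refl shift shift = refl
    excl : ∀ {t σ τ} → σ ≡ τ → Holds t true σ → Holds t false τ → ⊥
    excl {blank k} refl h h′ with () ← trans (sym h) h′
    excl {bit}     refl h h′ with () ← trans (sym h) h′

  module Assemble {p q : ℕ} (work baireWork : ℕ) (P : Prog (language work (MS.zeroTestTape q baireWork))) where

    L = language work (MS.zeroTestTape q baireWork)
    module F = Flowchart P

    Cmd : Set
    Cmd = MS.Command F.labels 0 (3 + work) (q + (baireWork + 2))

    -- A Turing command acts on all tapes at once; a tape that is not concerned rewrites the symbol
    -- it scans and stays.
    keep : Vec Cell (3 + work) → Vec (Cell × Move) (3 + work)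
    keep = Vec.map (_, stay)

    command : Maybe (FlowNode L F.Label) → Vec Cell (3 + work) → Bool → Cmd
    command nothing                         as c = MS.zeroTest zero
    command (just (act (put k a) l))        as c = MS.turing (updateAt (keep as) k (λ _ → a , stay)) (F.number l)
    command (just (act (shift k d) l))      as c = MS.turing (updateAt (keep as) k (λ (a , _) → a , d)) (F.number l)
    command (just (act (callSlave j) l))    as c = MS.callSlave j (F.number l)
    command (just (act zeroTest l))         as c = MS.zeroTest (F.number l)
    command (just (branch (blank k) l l′)) as c =
      MS.turing (keep as) (F.number (if isBlank (lookup as k) then l else l′))
    command (just (branch bit l l′))       as c = MS.turing (keep as) (F.number (if c then l else l′))

    machine : MS.Machine p q
    machine = record
      { states    = F.labels
      ; letters   = 0
      ; work      = work
      ; baireWork = baireWork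
      ; start     = F.number F.start
      ; halt      = zero
      ; program   = λ s → command (F.code (F.label s))
      }

    module S = MS.Semantics machine

    ⌊_,_⌋ : F.Label → Store (3 + work) (q + (baireWork + 2)) → S.Config
    ⌊ l , store c ts xs ⌋ = S.config (F.number l) c ts xs

    current-⌊⌋ : ∀ l c ts xs → S.current ⌊ l , store c ts xs ⌋ ≡ command (F.code l) (Vec.map head ts) c
    current-⌊⌋ l c ts xs = cong (λ l → command (F.code l) (Vec.map head ts) c) (F.label-number l)

    zipWith-keep : ∀ {n} (ts : Vec (Tape Cell) n) →
      Vec.zipWith S.act (Vec.map (_, stay) (Vec.map head ts)) ts ≡ ts
    zipWith-keep []       = refl
    zipWith-keep (t ∷ ts) = cong (t ∷_) (zipWith-keep ts)

    zipWith-put : ∀ {n} (ts : Vec (Tape Cell) n) k a →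
      Vec.zipWith S.act (updateAt (Vec.map (_, stay) (Vec.map head ts)) k (λ _ → a , stay)) ts ≡
      updateAt ts k (write a)
    zipWith-put (t ∷ ts) zero    a = cong (_ ∷_) (zipWith-keep ts)
    zipWith-put (t ∷ ts) (suc k) a = cong (t ∷_) (zipWith-put ts k a)

    zipWith-shift : ∀ {n} (ts : Vec (Tape Cell) n) k d →
      Vec.zipWith S.act (updateAt (Vec.map (_, stay) (Vec.map head ts)) k (λ (a , _) → a , d)) ts ≡
      updateAt ts k (move d)
    zipWith-shift (t ∷ ts) zero    d = cong (_ ∷_) (zipWith-keep ts)
    zipWith-shift (t ∷ ts) (suc k) d = cong (t ∷_) (zipWith-shift ts k d)

    number-≢0 : ∀ {l N} → F.code l ≡ just N → F.number l ≢ zero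
    number-≢0 {nothing} () _
    number-≢0 {just _}  _  ()

    turing-step : ∀ {l l′ c ts ts′ xs acts} → F.number l ≢ zero →
      command (F.code l) (Vec.map head ts) c ≡ MS.turing acts (F.number l′) →
      Vec.zipWith S.act acts ts ≡ ts′ → ⌊ l , store c ts xs ⌋ S.⟶ ⌊ l′ , store c ts′ xs ⌋
    turing-step {l} {c = c} {ts} {xs = xs} n≢0 e refl = S.turing n≢0 (trans (current-⌊⌋ l c ts xs) e)

    step : ∀ {l l′ σ σ′} → (l , σ) F.⟶ (l′ , σ′) → ⌊ l , σ ⌋ S.⟶ ⌊ l′ , σ′ ⌋
    step {l} {l′} (F.act e (put {k} {a} {c} {ts})) =
      turing-step {l} {l′} (number-≢0 {l} e) (cong (λ n → command n (Vec.map head ts) c) e) (zipWith-put ts k a)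
    step {l} {l′} (F.act e (shift {k} {d} {c} {ts})) =
      turing-step {l} {l′} (number-≢0 {l} e) (cong (λ n → command n (Vec.map head ts) c) e) (zipWith-shift ts k d)
    step {l} (F.act e (callSlave {j} {c} {ts} {xs} y)) = S.callSlave (number-≢0 {l} e)
      (trans (current-⌊⌋ l c ts xs) (cong (λ n → command n (Vec.map head ts) c) e)) y
    step {l} (F.act e (isZero {c} {ts} {xs} h)) = S.zeroTest-true (number-≢0 {l} e)
      (trans (current-⌊⌋ l c ts xs) (cong (λ n → command n (Vec.map head ts) c) e)) h
    step {l} (F.act e (isNonzero {c} {ts} {xs} h)) = S.zeroTest-false (number-≢0 {l} e)
      (trans (current-⌊⌋ l c ts xs) (cong (λ n → command n (Vec.map head ts) c) e)) h
    step {l} (F.branch {m = m} {m′} {blank k} {b} {s = store c ts xs} e h) =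
      turing-step {l} {if b then m else m′} (number-≢0 {l} e)
        (trans (cong (λ n → command n (Vec.map head ts) c) e)
          (cong (λ b → MS.turing _ (F.number (if b then m else m′))) (trans (cong isBlank (lookup-map k head ts)) h)))
        (zipWith-keep ts)
    step {l} (F.branch {m = m} {m′} {bit} {s = store c ts xs} e refl) =
      turing-step {l} {if c then m else m′} (number-≢0 {l} e) (cong (λ n → command n (Vec.map head ts) c) e) (zipWith-keep ts)

    step⁻¹ : ∀ {l σ d} → ⌊ l , σ ⌋ S.⟶ d → ∃ λ l′ → ∃ λ σ′ → d ≡ ⌊ l′ , σ′ ⌋ × ((l , σ) F.⟶ (l′ , σ′))
    step⁻¹ {nothing} (S.turing n≢0 _)           = contradiction refl n≢0
    step⁻¹ {nothing} (S.callSlave n≢0 _ _)      = contradiction refl n≢0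
    step⁻¹ {nothing} (S.zeroTest-true n≢0 _ _)  = contradiction refl n≢0
    step⁻¹ {nothing} (S.zeroTest-false n≢0 _ _) = contradiction refl n≢0
    step⁻¹ {just i} {store c ts xs} (S.turing n≢0 e)
      with F.code (just i) in f | trans (sym (current-⌊⌋ (just i) c ts xs)) e
    ... | just (act (put k a) l) | refl =
      _ , _ , cong (λ ts → S.config _ c ts xs) (zipWith-put ts k a) , F.act f put
    ... | just (act (shift k d) l) | refl =
      _ , _ , cong (λ ts → S.config _ c ts xs) (zipWith-shift ts k d) , F.act f shift
    ... | just (branch (blank k) l l′) | refl =
      _ , _ , cong (λ ts → S.config _ c ts xs) (zipWith-keep ts) ,
      F.branch f (cong isBlank (sym (lookup-map k head ts)))
    ... | just (branch bit l l′) | refl =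
      _ , _ , cong (λ ts → S.config _ c ts xs) (zipWith-keep ts) , F.branch f refl
    step⁻¹ {just i} {store c ts xs} (S.callSlave n≢0 e y)
      with F.code (just i) in f | trans (sym (current-⌊⌋ (just i) c ts xs)) e
    ... | just (act (callSlave j) l) | refl = _ , _ , refl , F.act f (callSlave y)
    ... | just (branch (blank k) l l′) | ()
    ... | just (branch bit l l′) | ()
    step⁻¹ {just i} {store c ts xs} (S.zeroTest-true n≢0 e h)
      with F.code (just i) in f | trans (sym (current-⌊⌋ (just i) c ts xs)) e
    ... | just (act zeroTest l) | refl = _ , _ , refl , F.act f (isZero h)
    ... | just (branch (blank k) l l′) | ()
    ... | just (branch bit l l′) | ()
    step⁻¹ {just i} {store c ts xs} (S.zeroTest-false n≢0 e h)
      with F.code (just i) in f | trans (sym (current-⌊⌋ (just i) c ts xs)) e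
    ... | just (act zeroTest l) | refl = _ , _ , refl , F.act f (isNonzero h)
    ... | just (branch (blank k) l l′) | ()
    ... | just (branch bit l l′) | ()

    steps : ∀ {l l′ σ σ′} → Star F._⟶_ (l , σ) (l′ , σ′) → Star S._⟶_ ⌊ l , σ ⌋ ⌊ l′ , σ′ ⌋
    steps ε = ε
    steps (x ◅ r) = step x ◅ steps r

    number-zero : ∀ {l} → F.number l ≡ zero → l ≡ nothing
    number-zero {nothing} _ = refl

    contents : S.Config → Store (3 + work) (q + (baireWork + 2))
    contents c = store (S.Config.bit c) (S.Config.tapes c) (S.Config.seqs c)

    steps⁻¹ : ∀ {l σ d} → Star S._⟶_ ⌊ l , σ ⌋ d → S.Config.state d ≡ zero →
              Star F._⟶_ (l , σ) (nothing , contents d)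
    steps⁻¹ {l} ε e with refl ← number-zero {l} e = ε
    steps⁻¹ (x ◅ r) e with step⁻¹ x
    ... | _ , _ , refl , y = y ◅ steps⁻¹ r e

    outputs : ∀ {Y n x y} → S.Outputs Y n x y ⇔
      (∃ λ σ → ⟨ P , contents (S.initial n x) ⟩⇓ σ × Eq Y (S.value Y ⌊ nothing , σ ⌋) y)
    outputs {Y} {n} {x} = mk⇔
      (λ (d , r , e , v) → contents d , F.sound (steps⁻¹ {F.start} {contents (S.initial n x)} r e) , value Y v)
      (λ (σ , r , v) → _ , steps (F.complete r) , refl , v)
      where
      value : ∀ Y {d y} → Eq Y (S.value Y d) y → Eq Y (S.value Y ⌊ nothing , contents d ⌋) y
      value num v = v
      value seq v = v

module IM⇒MS {p q Y} (M : IM.Machine p q Y) where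
  open IM.Machine M renaming (extra to e; work to w; program to P)
  open Master

  private
    b = q + (w + 2)
    m = 9 + (p + e)
    z = MS.zeroTestTape q w
    L₁ = IM.language (p + e) z
    L₂ = Master.language (6 + (p + e)) z

  -- A block of strokes grows and shrinks at its left end. Strokes given up by decrementing remain
  -- to the left of the head, and a later push overwrites them.
  push : Fin m → Prog L₂
  push k = prim (shift k moveL) ⨾ prim (put k (suc zero))

  instr : IM.Instr m b → Prog L₂
  instr (IM.inc k)  = push k
  instr (IM.dec k)  = ifte (blank k) skip (prim (shift k moveR))
  instr (IM.call l) = prim (callSlave l)

  -- A master's zero test only sets the bit, on which the program branches afterwards.
  before : IM.Cond m → Prog L₂
  before (IM.isZero k) = skip
  before IM.zeroSeq    = prim zeroTest

  cond : IM.Cond m → Cond m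
  cond (IM.isZero k) = blank k
  cond IM.zeroSeq    = bit

  record R (σ : IM.Store m b) (τ : Store m b) : Set where
    constructor rel
    field
      numbers : ∀ k → number (lookup (tapes τ) k) ≡ lookup (IM.counters σ) k
      seqs-≡  : seqs τ ≡ IM.seqs σ

  open Translation {L₁} {L₂} R instr before cond

  number-push : ∀ t → number (write (suc zero) (move moveL t)) ≡ suc (number t)
  number-push (tape [] a rs)       = refl
  number-push (tape (l ∷ ls) a rs) = refl

  number-moveR : ∀ t → isBlank (head t) ≡ false → number (move moveR t) ≡ pred (number t)
  number-moveR (tape ls (suc zero) [])       _ = refl
  number-moveR (tape ls (suc zero) (r ∷ rs)) _ = refl

  number-blank : ∀ t → isBlank (head t) ≡ true → number t ≡ 0
  number-blank (tape ls zero rs) _ = refl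

  number-stroke : ∀ t → isBlank (head t) ≡ false → number t ≢ 0
  number-stroke (tape ls (suc zero) rs) _ ()

  isBlank-number : ∀ t → number t ≡ 0 → isBlank (head t) ≡ true
  isBlank-number (tape ls zero rs) _ = refl
  isBlank-number (tape ls (suc zero) rs) ()

  isBlank-number-≢ : ∀ t → number t ≢ 0 → isBlank (head t) ≡ false
  isBlank-number-≢ (tape ls zero rs)       h = contradiction refl h
  isBlank-number-≢ (tape ls (suc zero) rs) h = refl

  updated : ∀ (ts ts′ : Vec (Tape Cell) m) ns k (f : ℕ → ℕ) → (∀ l → number (lookup ts l) ≡ lookup ns l) →
    number (lookup ts′ k) ≡ f (number (lookup ts k)) → (∀ l → l ≢ k → lookup ts′ l ≡ lookup ts l) →
    ∀ l → number (lookup ts′ l) ≡ lookup (updateAt ns k f) l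
  updated ts ts′ ns k f r h same l with l ≟ᶠ k
  ... | yes refl = trans h (trans (cong f (r l)) (sym (lookup∘updateAt l ns)))
  ... | no l≢k   = trans (cong number (same l l≢k)) (trans (r l) (sym (lookup∘updateAt′ l k l≢k ns)))

  pushed : Vec (Tape Cell) m → Fin m → Vec (Tape Cell) m
  pushed ts k = updateAt (updateAt ts k (move moveL)) k (write (suc zero))

  lookup-pushed : ∀ ts k → lookup (pushed ts k) k ≡ write (suc zero) (move moveL (lookup ts k))
  lookup-pushed ts k = trans (lookup∘updateAt k (updateAt ts k (move moveL)))
    (cong (write (suc zero)) (lookup∘updateAt k ts))

  lookup-pushed′ : ∀ ts k l → l ≢ k → lookup (pushed ts k) l ≡ lookup ts l
  lookup-pushed′ ts k l l≢k = trans (lookup∘updateAt′ l k l≢k (updateAt ts k (move moveL)))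
    (lookup∘updateAt′ l k l≢k ts)

  number-pushed : ∀ ts k → number (lookup (pushed ts k) k) ≡ suc (number (lookup ts k))
  number-pushed ts k = trans (cong number (lookup-pushed ts k)) (number-push (lookup ts k))

  inc-rel : ∀ {σ c ts xs k} → R σ (store c ts xs) →
            R (updateAt (IM.counters σ) k suc IM.∣ IM.seqs σ) (store c (pushed ts k) xs)
  inc-rel {σ} {ts = ts} {k = k} (rel r s) = rel
    (updated ts (pushed ts k) (IM.counters σ) k suc r (number-pushed ts k) (lookup-pushed′ ts k)) s

  dec-rel : ∀ {σ c ts xs k} → R σ (store c ts xs) → isBlank (head (lookup ts k)) ≡ false →
            R (updateAt (IM.counters σ) k pred IM.∣ IM.seqs σ) (store c (updateAt ts k (move moveR)) xs)
  dec-rel {σ} {ts = ts} {k = k} (rel r s) h = rel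
    (updated ts (updateAt ts k (move moveR)) (IM.counters σ) k pred r
      (trans (cong number (lookup∘updateAt k ts)) (number-moveR (lookup ts k) h))
      (λ l l≢k → lookup∘updateAt′ l k l≢k ts)) s

  dec-rel-blank : ∀ {σ c ts xs k} → R σ (store c ts xs) → isBlank (head (lookup ts k)) ≡ true →
                  R (updateAt (IM.counters σ) k pred IM.∣ IM.seqs σ) (store c ts xs)
  dec-rel-blank {σ} {ts = ts} {k = k} (rel r s) h = rel
    (updated ts ts (IM.counters σ) k pred r
      (trans (number-blank (lookup ts k) h) (cong pred (sym (number-blank (lookup ts k) h))))
      (λ _ _ → refl)) s

  instr-fwd : ∀ α {σ σ′ τ} → R σ τ → IM.Executes α σ σ′ → ∃ λ τ′ → ⟨ instr α , τ ⟩⇓ τ′ × R σ′ τ′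
  instr-fwd _ r IM.inc = _ , prim shift ⨾ prim put , inc-rel r
  instr-fwd _ {τ = store c ts xs} r (IM.dec {k}) with isBlank (head (lookup ts k)) in h
  ... | true  = _ , ifTrue h skip , dec-rel-blank r h
  ... | false = _ , ifFalse h (prim shift) , dec-rel r h
  instr-fwd _ (rel r refl) (IM.call {y = y} c) =
    _ , prim (callSlave (subst (λ e → Φ[ _ ]⟨ e ⟩≈ y) (sym (r _)) c)) , rel r refl

  instr-bwd : ∀ α {σ τ τ′} → R σ τ → ⟨ instr α , τ ⟩⇓ τ′ → ∃ λ σ′ → IM.Executes α σ σ′ × R σ′ τ′
  instr-bwd (IM.inc k) r (prim shift ⨾ prim put)      = _ , IM.inc , inc-rel r
  instr-bwd (IM.dec k) r (ifTrue h skip)               = _ , IM.dec , dec-rel-blank r h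
  instr-bwd (IM.dec k) r (ifFalse h (prim shift))      = _ , IM.dec , dec-rel r h
  instr-bwd (IM.call l) (rel r refl) (prim (callSlave {y = y} c)) =
    _ , IM.call (subst (λ e → Φ[ _ ]⟨ e ⟩≈ y) (r _) c) , rel r refl

  cond-fwd : ∀ t c {σ τ} → R σ τ → IM.Holds z t c σ →
             ∃ λ τ′ → ⟨ before t , τ ⟩⇓ τ′ × R σ τ′ × Holds (cond t) c τ′
  cond-fwd (IM.isZero k) true  {τ = τ} (rel r s) h =
    _ , skip , rel r s , isBlank-number (lookup (tapes τ) k) (trans (r k) h)
  cond-fwd (IM.isZero k) false {τ = τ} (rel r s) h =
    _ , skip , rel r s , isBlank-number-≢ (lookup (tapes τ) k) (λ h′ → h (trans (sym (r k)) h′))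
  cond-fwd IM.zeroSeq true  (rel r refl) h = _ , prim (isZero h) , rel r refl , refl
  cond-fwd IM.zeroSeq false (rel r refl) h = _ , prim (isNonzero h) , rel r refl , refl

  cond-bwd : ∀ t c {σ τ τ′} → R σ τ → ⟨ before t , τ ⟩⇓ τ′ → Holds (cond t) c τ′ → IM.Holds z t c σ × R σ τ′
  cond-bwd (IM.isZero k) true  {τ = τ} (rel r s) skip h =
    trans (sym (r k)) (number-blank (lookup (tapes τ) k) h) , rel r s
  cond-bwd (IM.isZero k) false {τ = τ} (rel r s) skip h =
    (λ h′ → number-stroke (lookup (tapes τ) k) h (trans (r k) h′)) , rel r s
  cond-bwd IM.zeroSeq _ (rel r refl) (prim (isZero h)) refl = h , rel r refl
  cond-bwd IM.zeroSeq _ (rel r refl) (prim (isNonzero h)) refl = h , rel r refl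

  open Forward instr-fwd cond-fwd
  open Backward instr-bwd cond-bwd

  -- The prologue moves the numbers on the input tape to tapes of their own.

  moveInput : Fin m → Prog L₂
  moveInput k = until (blank zero) (prim (shift zero moveR) ⨾ push k)

  unload : ∀ {p′} → (Fin p′ → Fin m) → Prog L₂
  unload {zero}   _ = skip
  unload {suc p′} f = moveInput (f zero) ⨾ prim (shift zero moveR) ⨾ unload (f ∘ suc)

  -- Past the end of the list the head is on a blank, as on a freshly loaded empty tape.
  reading : List Cell → List Cell → Tape Cell
  reading ls []       = tape ls zero []
  reading ls (a ∷ as) = tape ls a as

  move-reading : ∀ ls a as → move moveR (reading ls (a ∷ as)) ≡ reading (a ∷ ls) as
  move-reading ls a []       = refl
  move-reading ls a (b ∷ as) = refl

  moveInput-run : ∀ k n {ls as c ts xs} → k ≢ zero → lookup ts zero ≡ reading ls (numeral n ++ zero ∷ as) →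
    ∃ λ ls′ → ∃ λ ts′ → ⟨ moveInput k , store c ts xs ⟩⇓ store c ts′ xs ×
      lookup ts′ zero ≡ reading ls′ (zero ∷ as) ×
      number (lookup ts′ k) ≡ n + number (lookup ts k) ×
      (∀ l → l ≢ zero → l ≢ k → lookup ts′ l ≡ lookup ts l)
  moveInput-run k zero k≢0 h = _ , _ , stop (cong (isBlank ∘ head) h) , h , refl , λ _ _ _ → refl
  moveInput-run k (suc n) {ls} {as} {c} {ts} {xs} k≢0 h =
    let ls′ , ts′ , d , h′ , v , same = moveInput-run k n {suc zero ∷ ls} {as} {c} {ts₂} {xs} k≢0
          (trans (lookup-pushed′ ts₁ k zero (k≢0 ∘ sym)) (trans (lookup∘updateAt zero ts)
            (trans (cong (move moveR) h) (move-reading ls (suc zero) (numeral n ++ zero ∷ as)))))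
    in ls′ , ts′ , loop (cong (isBlank ∘ head) h) (prim shift ⨾ prim shift ⨾ prim put) d , h′ ,
       trans v (trans (cong (n +_) (trans (number-pushed ts₁ k)
         (cong (suc ∘ number) (lookup∘updateAt′ k zero k≢0 ts)))) (+-suc n _)) ,
       λ l l≢0 l≢k → trans (same l l≢0 l≢k) (trans (lookup-pushed′ ts₁ k l l≢k) (lookup∘updateAt′ l zero l≢0 ts))
    where
    ts₁ = updateAt ts zero (move moveR)
    ts₂ = pushed ts₁ k

  -- At the end the input tape scans a blank and hence represents 0, whatever lies to the left. This
  -- is why the tape can go on to serve as counter 0.
  unload-run : ∀ {p′} (ns : Vec ℕ p′) (f : Fin p′ → Fin m) → (∀ i → f i ≢ zero) →
    (∀ {i j} → f i ≡ f j → i ≡ j) → ∀ {ls c ts xs} →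
    lookup ts zero ≡ reading ls (numerals ns) → (∀ i → number (lookup ts (f i)) ≡ 0) →
    ∃ λ ts′ → ⟨ unload f , store c ts xs ⟩⇓ store c ts′ xs × number (lookup ts′ zero) ≡ 0 ×
      (∀ i → number (lookup ts′ (f i)) ≡ lookup ns i) ×
      (∀ l → l ≢ zero → (∀ i → l ≢ f i) → lookup ts′ l ≡ lookup ts l)
  unload-run [] f f≢0 inj h h₀ = _ , skip , cong number h , (λ ()) , λ _ _ _ → refl
  unload-run {suc p′} (n ∷ ns) f f≢0 inj {ls} {c} {ts} {xs} h h₀
    with moveInput-run (f zero) n {ls} {numerals ns} {c} {ts} {xs} (f≢0 zero) h
  ... | ls₁ , ts₁ , d₁ , h₁ , v₁ , same₁
    with unload-run ns (f ∘ suc) (f≢0 ∘ suc) (λ e → suc-injectiveᶠ (inj e)) {c = c} {updateAt ts₁ zero (move moveR)} {xs}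
           (trans (lookup∘updateAt zero ts₁) (trans (cong (move moveR) h₁) (move-reading ls₁ zero (numerals ns))))
           (λ i → trans (cong number (trans (lookup∘updateAt′ (f (suc i)) zero (f≢0 (suc i)) ts₁)
             (same₁ (f (suc i)) (f≢0 (suc i)) (λ e → case inj e of λ ())))) (h₀ (suc i)))
  ... | ts₂ , d₂ , z₂ , v₂ , same₂ = ts₂ , (d₁ ⨾ prim shift ⨾ d₂) , z₂ , values , others
    where
    values : ∀ i → number (lookup ts₂ (f i)) ≡ lookup (n ∷ ns) i
    values zero = trans (cong number (trans (same₂ (f zero) (f≢0 zero) (λ i e → case inj e of λ ()))
      (lookup∘updateAt′ (f zero) zero (f≢0 zero) ts₁))) (trans v₁ (trans (cong (n +_) (h₀ zero)) (+-identityʳ n)))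
    values (suc i) = v₂ i
    others : ∀ l → l ≢ zero → (∀ i → l ≢ f i) → lookup ts₂ l ≡ lookup ts l
    others l l≢0 l≢f = trans (same₂ l l≢0 (l≢f ∘ suc))
      (trans (lookup∘updateAt′ l zero l≢0 ts₁) (same₁ l l≢0 (l≢f zero)))

  unload-prims : ∀ {p′} (f : Fin p′ → Fin m) → AllPrims TapePrim (unload f)
  unload-prims {zero}   f = _
  unload-prims {suc p′} f = _ , _ , unload-prims (f ∘ suc)

  inputCounter : Fin p → Fin m
  inputCounter i = 9 ↑ʳ (i ↑ˡ e)

  module A = Assemble {p} {q} (6 + (p + e)) w (unload inputCounter ⨾ translate P)

  load-reading : ∀ as → load as ≡ reading [] as
  load-reading []       = refl
  load-reading (a ∷ as) = refl

  initial-run : ∀ n x → ∃ λ τ → ⟨ unload inputCounter , A.contents (A.S.initial n x) ⟩⇓ τ × R (IM.initial M n x) τ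
  initial-run n x with unload-run n inputCounter (λ _ ()) (λ h → ↑ˡ-injective e _ _ (↑ʳ-injective 9 _ _ h))
      {[]} {false} {Vec.replicate m (load []) [ zero ]≔ load (numerals n)} {x Vec.++ Vec.replicate (w + 2) 0ᴺ}
      (load-reading (numerals n)) (λ i → cong number (lookup-replicate (i ↑ˡ e) (load [])))
  ... | ts , d , h₀ , v , same = _ , d , rel numbers refl
    where
    zeros = Vec.replicate 9 0
    inputs = n Vec.++ Vec.replicate e 0

    elsewhere : ∀ (k : Fin (8 + (p + e))) → (∀ i → suc k ≢ inputCounter i) → number (lookup ts (suc k)) ≡ 0
    elsewhere k k≢ = cong number (trans (same (suc k) (λ ()) k≢)
      (lookup-replicate k (load [])))

    numbers-inputs : ∀ j → number (lookup ts (9 ↑ʳ j)) ≡ lookup inputs j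
    numbers-inputs j with splitAt p j in s
    ... | inj₁ u = trans (cong (λ j → number (lookup ts (9 ↑ʳ j))) (trans (sym (join-splitAt p e j)) (cong (join p e) s)))
      (trans (v u) (sym (trans (lookup-splitAt p n (Vec.replicate e 0) j)
        (cong [ lookup n , lookup (Vec.replicate e 0) ]′ s))))
    ... | inj₂ u = trans (elsewhere (8 ↑ʳ j) (λ i h → case trans (sym s)
        (trans (cong (splitAt p) (↑ʳ-injective 9 _ _ h)) (splitAt-↑ˡ p i e)) of λ ()))
      (sym (trans (lookup-splitAt p n (Vec.replicate e 0) j)
        (trans (cong [ lookup n , lookup (Vec.replicate e 0) ]′ s) (lookup-replicate u 0))))

    numbers : ∀ k → number (lookup ts k) ≡ lookup (zeros Vec.++ inputs) k
    numbers 0F = h₀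
    numbers 1F = elsewhere 0F (λ _ ())
    numbers 2F = elsewhere 1F (λ _ ())
    numbers 3F = elsewhere 2F (λ _ ())
    numbers 4F = elsewhere 3F (λ _ ())
    numbers 5F = elsewhere 4F (λ _ ())
    numbers 6F = elsewhere 5F (λ _ ())
    numbers 7F = elsewhere 6F (λ _ ())
    numbers 8F = elsewhere 7F (λ _ ())
    numbers (suc (suc (suc (suc (suc (suc (suc (suc (suc j))))))))) = numbers-inputs j

  value-rel : ∀ Y {σ τ y} → R σ τ → Eq Y (IM.output q w Y σ) y ⇔ Eq Y (A.S.value Y A.⌊ nothing , τ ⌋) y
  value-rel num (rel r refl) = mk⇔ (trans (r _)) (trans (sym (r _)))
  value-rel seq (rel r refl) = mk⇔ (λ h → h) (λ h → h)

  simulates : ∀ {n x y} → IM.Outputs M n x y ⇔ MS.Semantics.Outputs A.machine Y n x y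
  simulates {n} {x} {y} = mk⇔ to from
    where
    to : IM.Outputs M n x y → MS.Semantics.Outputs A.machine Y n x y
    to (_ , d , v) with initial-run n x
    ... | _ , d₀ , r₀ with translate-fwd r₀ d
    ... | τ , d′ , r = Equivalence.from (A.outputs {Y} {n} {x}) (τ , d₀ ⨾ d′ , Equivalence.to (value-rel Y r) v)
    from : MS.Semantics.Outputs A.machine Y n x y → IM.Outputs M n x y
    from o with Equivalence.to (A.outputs {Y} {n} {x}) o | initial-run n x
    ... | τ , d ⨾ d′ , v | _ , d₀ , r₀
      -- The prologue uses tape operations only, so its run within the given one equals the
      -- constructed run, not merely up to `≈`.
      with refl ← ⇓-det (unload inputCounter) (unload-prims inputCounter) d₀ d
      with translate-bwd P r₀ d′
    ... | σ , d″ , r = σ , d″ , Equivalence.from (value-rel Y r) v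

-- Macros for counter programs

module Macros {v b : ℕ} (z : Fin b) where
  open IM

  private
    L = IM.language v z
    C = Fin (9 + v)

  inc′ dec′ : C → Prog L
  inc′ k = prim (inc k)
  dec′ k = prim (dec k)

  whileNonzero : C → Prog L → Prog L
  whileNonzero k = until (isZero k)

  ifZero : C → Prog L → Prog L → Prog L
  ifZero k = ifte (isZero k)

  clear : C → Prog L
  clear k = whileNonzero k (dec′ k)

  clear-run : ∀ k {ns xs} → ⟨ clear k , ns ∣ xs ⟩⇓ (ns [ k ]≔ 0 ∣ xs)
  clear-run k {ns} = go _ refl
    where
    go : ∀ n {ns xs} → lookup ns k ≡ n → ⟨ clear k , ns ∣ xs ⟩⇓ (ns [ k ]≔ 0 ∣ xs)
    go zero    {ns} e = subst (λ ms → ⟨ clear k , ns ∣ _ ⟩⇓ (ms ∣ _)) (sym (updateAt-id-local k ns (sym e))) (stop e)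
    go (suc n) {ns} e = loop (λ h → case trans (sym e) h of λ ()) (prim dec)
      (subst (λ ms → ⟨ clear k , updateAt ns k pred ∣ _ ⟩⇓ (ms ∣ _)) (updateAt-updateAt k ns)
        (go n (trans (lookup∘updateAt k ns) (cong pred e))))

  incs : ℕ → C → Prog L
  incs zero    k = skip
  incs (suc n) k = inc′ k ⨾ incs n k

  incs-run : ∀ n k {ns xs} → ⟨ incs n k , ns ∣ xs ⟩⇓ (updateAt ns k (_+ n) ∣ xs)
  incs-run zero    k {ns} = subst (λ ms → ⟨ skip , ns ∣ _ ⟩⇓ (ms ∣ _))
    (sym (updateAt-id-local k ns (+-identityʳ _))) skip
  incs-run (suc n) k {ns} = prim inc ⨾ subst (λ ms → ⟨ incs n k , updateAt ns k suc ∣ _ ⟩⇓ (ms ∣ _))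
    (updateAt-updateAt-local k ns (sym (+-suc (lookup ns k) n))) (incs-run n k)

  move : C → C → Prog L
  move k l = whileNonzero k (dec′ k ⨾ inc′ l)

  move-run : ∀ k l → k ≢ l → ∀ {ns xs} →
    ⟨ move k l , ns ∣ xs ⟩⇓ (updateAt (ns [ k ]≔ 0) l (_+ lookup ns k) ∣ xs)
  move-run k l k≢l {ns} = go _ refl
    where
    go : ∀ n {ns xs} → lookup ns k ≡ n → ⟨ move k l , ns ∣ xs ⟩⇓ (updateAt (ns [ k ]≔ 0) l (_+ lookup ns k) ∣ xs)
    go n {ns} e rewrite e = go′ n e
      where
      go′ : ∀ n {ns xs} → lookup ns k ≡ n → ⟨ move k l , ns ∣ xs ⟩⇓ (updateAt (ns [ k ]≔ 0) l (_+ n) ∣ xs)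
      go′ zero {ns} e = subst (λ ms → ⟨ move k l , ns ∣ _ ⟩⇓ (ms ∣ _)) (sym (trans
        (updateAt-id-local l (ns [ k ]≔ 0) (+-identityʳ _)) (updateAt-id-local k ns (sym e)))) (stop e)
      go′ (suc n) {ns} e = loop (λ h → case trans (sym e) h of λ ()) (prim dec ⨾ prim inc)
        (subst (λ ms → ⟨ move k l , updateAt (updateAt ns k pred) l suc ∣ _ ⟩⇓ (ms ∣ _)) eq
          (go′ n (trans (lookup∘updateAt′ k l k≢l (updateAt ns k pred)) (trans (lookup∘updateAt k ns) (cong pred e)))))
        where
        eq : updateAt (updateAt (updateAt ns k pred) l suc [ k ]≔ 0) l (_+ n) ≡ updateAt (ns [ k ]≔ 0) l (_+ suc n)
        eq = trans (cong (λ ms → updateAt ms l (_+ n)) (trans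
               (updateAt-commutes k l k≢l (updateAt ns k pred))
               (cong (λ ms → updateAt ms l suc) (updateAt-updateAt k ns))))
             (updateAt-updateAt-local l (ns [ k ]≔ 0) (sym (+-suc _ n)))

  -- The counter `t` must be 0 and is 0 again afterwards; `k` is emptied into it and then restored.
  -- The value is added to `d` and does not replace its content.
  copy : C → C → C → Prog L
  copy t k d = move k t ⨾ whileNonzero t (dec′ t ⨾ inc′ k ⨾ inc′ d)

  copy-run : ∀ t k d → t ≢ k → t ≢ d → k ≢ d → ∀ {ns xs} → lookup ns t ≡ 0 →
    ⟨ copy t k d , ns ∣ xs ⟩⇓ (updateAt ns d (_+ lookup ns k) ∣ xs)
  copy-run t k d t≢k t≢d k≢d {ns} e = move-run k t (t≢k ∘ sym) ⨾
    subst (λ ms → ⟨ whileNonzero t (dec′ t ⨾ inc′ k ⨾ inc′ d) , ns₁ ∣ _ ⟩⇓ (ms ∣ _))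
      (cong (λ ms → updateAt ms d (_+ n)) restored) (restore n start)
    where
    n = lookup ns k
    ns₁ = updateAt (ns [ k ]≔ 0) t (_+ n)

    start : lookup ns₁ t ≡ n
    start = trans (lookup∘updateAt t (ns [ k ]≔ 0)) (cong (_+ n) (trans (lookup∘update′ t≢k ns 0) e))

    restored : updateAt (ns₁ [ t ]≔ 0) k (_+ n) ≡ ns
    restored = trans (cong (λ ms → updateAt ms k (_+ n)) (trans (updateAt-updateAt t (ns [ k ]≔ 0))
        (updateAt-id-local t (ns [ k ]≔ 0) (sym (trans (lookup∘update′ t≢k ns 0) e)))))
      (trans (updateAt-updateAt k ns) (updateAt-id-local k ns refl))

    restore : ∀ n {ns xs} → lookup ns t ≡ n → ⟨ whileNonzero t (dec′ t ⨾ inc′ k ⨾ inc′ d) , ns ∣ xs ⟩⇓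
      (updateAt (updateAt (ns [ t ]≔ 0) k (_+ n)) d (_+ n) ∣ xs)
    restore zero {ns} e = subst (λ ms → ⟨ whileNonzero t (dec′ t ⨾ inc′ k ⨾ inc′ d) , ns ∣ _ ⟩⇓ (ms ∣ _)) (sym (trans
        (updateAt-id-local d (updateAt (ns [ t ]≔ 0) k (_+ 0)) (+-identityʳ _)) (trans
        (updateAt-id-local k (ns [ t ]≔ 0) (+-identityʳ _)) (updateAt-id-local t ns (sym e))))) (stop e)
    restore (suc n) {ns} e = loop (λ h → case trans (sym e) h of λ ()) (prim dec ⨾ prim inc ⨾ prim inc)
      (subst (λ ms → ⟨ whileNonzero t (dec′ t ⨾ inc′ k ⨾ inc′ d) , ns₃ ∣ _ ⟩⇓ (ms ∣ _)) eq (restore n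
        (trans (lookup∘updateAt′ t d t≢d ns₂) (trans (lookup∘updateAt′ t k t≢k (updateAt ns t pred))
          (trans (lookup∘updateAt t ns) (cong pred e))))))
      where
      ns₂ = updateAt (updateAt ns t pred) k suc
      ns₃ = updateAt ns₂ d suc
      eq : updateAt (updateAt (ns₃ [ t ]≔ 0) k (_+ n)) d (_+ n) ≡
           updateAt (updateAt (ns [ t ]≔ 0) k (_+ suc n)) d (_+ suc n)
      eq = trans (cong (λ ms → updateAt (updateAt ms k (_+ n)) d (_+ n))
             (trans (updateAt-commutes t d t≢d ns₂) (cong (λ ms → updateAt ms d suc)
               (trans (updateAt-commutes t k t≢k (updateAt ns t pred))
                 (cong (λ ms → updateAt ms k suc) (updateAt-updateAt t ns))))))
           (trans (cong (λ ms → updateAt ms d (_+ n)) (trans (updateAt-commutes k d k≢d (updateAt (ns [ t ]≔ 0) k suc))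
             (cong (λ ms → updateAt ms d suc) (updateAt-updateAt-local k (ns [ t ]≔ 0) (sym (+-suc _ n))))))
             (updateAt-updateAt-local d (updateAt (ns [ t ]≔ 0) k (_+ suc n)) (sym (+-suc _ n))))

  -- The counter is used up while it selects: an arm starts with `k` at 0, and `otherwise` starts
  -- with the excess over `n`.
  switch : ∀ n → C → (Fin n → Prog L) → Prog L → Prog L
  switch zero    k arms otherwise = otherwise
  switch (suc n) k arms otherwise = ifZero k (arms zero) (dec′ k ⨾ switch n k (arms ∘ suc) otherwise)

  private
    dec-lookup : ∀ k {m} (ns : Vec ℕ (9 + v)) → lookup ns k ≡ suc m → lookup (updateAt ns k pred) k ≡ m
    dec-lookup k ns e = trans (lookup∘updateAt k ns) (cong pred e)

  switch-run : ∀ {n} k {arms : Fin n → Prog L} {otherwise ns xs τ} i → lookup ns k ≡ toℕ i →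
    ⟨ arms i , ns [ k ]≔ 0 ∣ xs ⟩⇓ τ → ⟨ switch n k arms otherwise , ns ∣ xs ⟩⇓ τ
  switch-run k {arms} {ns = ns} zero    e d =
    ifTrue e (subst (λ ms → ⟨ arms zero , ms ∣ _ ⟩⇓ _) (updateAt-id-local k ns (sym e)) d)
  switch-run k {arms} {ns = ns} (suc i) e d = ifFalse (λ h → case trans (sym e) h of λ ())
    (prim dec ⨾ switch-run k i (dec-lookup k ns e)
      (subst (λ ms → ⟨ arms (suc i) , ms ∣ _ ⟩⇓ _) (sym (updateAt-updateAt k ns)) d))

  switch-run⁻¹ : ∀ {n} k {arms : Fin n → Prog L} {otherwise ns xs τ} i → lookup ns k ≡ toℕ i →
    ⟨ switch n k arms otherwise , ns ∣ xs ⟩⇓ τ → ⟨ arms i , ns [ k ]≔ 0 ∣ xs ⟩⇓ τ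
  switch-run⁻¹ k {arms} {ns = ns} zero    e (ifTrue _ d) =
    subst (λ ms → ⟨ arms zero , ms ∣ _ ⟩⇓ _) (sym (updateAt-id-local k ns (sym e))) d
  switch-run⁻¹ k zero    e (ifFalse h _) = contradiction e h
  switch-run⁻¹ k (suc i) e (ifTrue h _) = case trans (sym e) h of λ ()
  switch-run⁻¹ k {arms} {ns = ns} (suc i) e (ifFalse _ (prim dec ⨾ d)) =
    subst (λ ms → ⟨ arms (suc i) , ms ∣ _ ⟩⇓ _) (updateAt-updateAt k ns)
      (switch-run⁻¹ k i (dec-lookup k ns e) d)

  switch-otherwise : ∀ n k {arms : Fin n → Prog L} {otherwise ns xs τ} m → lookup ns k ≡ n + m →
    ⟨ otherwise , ns [ k ]≔ m ∣ xs ⟩⇓ τ → ⟨ switch n k arms otherwise , ns ∣ xs ⟩⇓ τ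
  switch-otherwise zero    k {otherwise = o} {ns} m e d =
    subst (λ ms → ⟨ o , ms ∣ _ ⟩⇓ _) (updateAt-id-local k ns (sym e)) d
  switch-otherwise (suc n) k {otherwise = o} {ns} m e d = ifFalse (λ h → case trans (sym e) h of λ ())
    (prim dec ⨾ switch-otherwise n k m (dec-lookup k ns e)
      (subst (λ ms → ⟨ o , ms ∣ _ ⟩⇓ _) (sym (updateAt-updateAt k ns)) d))

-- Counter 0 holds a program counter, which is zero when the interpreted
-- machine has halted.
module Interpreter {v b : ℕ} (z : Fin b) {C : Set} (_⟶_ : C → C → Set) (Halted : C → Set)
  (R F : C → IM.Store (9 + v) b → Set) (body : Prog (IM.language v z))
  (R-pc : ∀ {c σ} → R c σ → lookup (IM.counters σ) zero ≢ 0)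
  (F-pc : ∀ {c σ} → F c σ → lookup (IM.counters σ) zero ≡ 0)
  (R-resp : ∀ {c σ τ} → σ IM.~ τ → R c σ → R c τ)
  (F-resp : ∀ {c σ τ} → σ IM.~ τ → F c σ → F c τ)
  (body-step : ∀ {c c′ σ} → R c σ → c ⟶ c′ → ∃ λ σ′ → ⟨ body , σ ⟩⇓ σ′ × R c′ σ′)
  (body-halt : ∀ {c σ} → R c σ → Halted c → ∃ λ σ′ → ⟨ body , σ ⟩⇓ σ′ × F c σ′)
  (progress  : ∀ {c σ σ′} → R c σ → ⟨ body , σ ⟩⇓ σ′ → (∃ λ c′ → c ⟶ c′) ⊎ Halted c) where

  interpret : Prog (IM.language v z)
  interpret = until (IM.isZero zero) body

  interpret-complete : ∀ {c c′ σ} → R c σ → Star _⟶_ c c′ → Halted c′ →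
                       ∃ λ σ′ → ⟨ interpret , σ ⟩⇓ σ′ × F c′ σ′
  interpret-complete r ε h =
    let _ , d , f = body-halt r h in _ , loop (R-pc r) d (stop (F-pc f)) , f
  interpret-complete r (s ◅ t) h =
    let _ , d , r′ = body-step r s
        _ , e , f = interpret-complete r′ t h
    in _ , loop (R-pc r) d e , f

  interpret-sound : ∀ {c σ σ′} → R c σ → ⟨ interpret , σ ⟩⇓ σ′ →
                    ∃ λ c′ → Star _⟶_ c c′ × Halted c′ × F c′ σ′
  interpret-sound r (stop e) = contradiction e (R-pc r)
  interpret-sound r (loop _ d e) with progress r d
  -- The step found by `progress` is simulated anew. Determinism of `body` moves the relation from
  -- the store reached in this way to the store of the given run, and the rest of that run is
  -- shorter.
  ... | inj₁ (c′ , s) =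
    let _ , d′ , r′ = body-step r s
        _ , t , h , f = interpret-sound (R-resp (IM.⇓-deterministic body IM.~-refl d′ d) r′) e
    in _ , s ◅ t , h , f
  ... | inj₂ h with body-halt r h
  ...   | _ , d′ , f with f′ ← F-resp (IM.⇓-deterministic body IM.~-refl d′ d) f | e
  ...     | stop _     = _ , ε , h , f′
  -- The program counter is 0 after the halting round, so there is no further one.
  ...     | loop n _ _ = contradiction (F-pc f′) n

-- The transducer on codes as a counter program

module RecodeProgram {v b : ℕ} (z : Fin b) (r : ℕ) {s} (js : Vec (Fin r) s) where
  open IM
  open Macros {v} {b} z
  open Recoding r

  private
    L = IM.language v z

  module _ {ns : Vec ℕ v} {xs : Vec Baire b} where

    -- a is the number still to be read, acc the part of the result that has been
    -- put out, w the weight of its next digit; f, g and k are the state of the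
    -- transducer.
    St : (a acc t d w f g k : ℕ) → IM.Store (9 + v) b
    St a acc t d w f g k = 0 ∷ a ∷ acc ∷ t ∷ d ∷ w ∷ f ∷ g ∷ k ∷ ns ∣ xs

  -- To put out a digit, the weight times the digit is added to the accumulator while twice the
  -- weight builds up in counter 3 and becomes the next weight. `halve` leaves half of counter 1 in
  -- counter 3 and its parity in counter 4.
  double emit1 emit2 emitArg halve renameArgProg : Prog L
  double = inc′ 3F ⨾ inc′ 3F
  emit1  = whileNonzero 5F (dec′ 5F ⨾ inc′ 2F ⨾ double) ⨾ move 3F 5F
  emit2  = whileNonzero 5F (dec′ 5F ⨾ inc′ 2F ⨾ inc′ 2F ⨾ double) ⨾ move 3F 5F
  emitArg = whileNonzero 8F (dec′ 8F ⨾ emit2)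
  halve  = whileNonzero 1F (dec′ 1F ⨾ ifZero 1F (inc′ 4F) (dec′ 1F ⨾ inc′ 3F))

  renameIndexProg : ∀ {s} → Vec (Fin r) s → Prog L
  renameIndexProg {s} js = switch s 8F (λ i → incs (toℕ (lookup js i)) 8F) (clear 8F ⨾ incs r 8F)

  renameArgProg = switch 3 7F (λ _ → skip) (renameIndexProg js) ⨾ clear 7F

  process1 process2 : Fin 6 → Prog L
  process1 0F = emit1 ⨾ incs 1 6F
  process1 1F = emit1 ⨾ incs 2 6F
  process1 2F = emit1 ⨾ incs 3 6F
  process1 3F = emit1 ⨾ incs 4 6F
  process1 4F = renameArgProg ⨾ emitArg ⨾ emit1 ⨾ incs 5 6F
  process1 5F = emit1
  process2 3F = emit2 ⨾ inc′ 7F ⨾ incs 3 6F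
  process2 4F = inc′ 8F ⨾ incs 4 6F
  process2 f  = emit2 ⨾ incs (toℕ f) 6F

  -- In bijective base 2, a positive even number `a` has lowest digit 2 and leaves `a / 2 - 1`,
  -- which is why counter 3 is decremented; an odd one has lowest digit 1 and leaves `(a - 1) / 2`.
  digit recodeLoop recodeProg : Prog L
  digit = halve ⨾ ifZero 4F (dec′ 3F ⨾ move 3F 1F ⨾ switch 6 6F process2 skip)
                            (dec′ 4F ⨾ move 3F 1F ⨾ switch 6 6F process1 skip)
  recodeLoop = whileNonzero 1F digit
  recodeProg = inc′ 5F ⨾ recodeLoop ⨾ clear 5F ⨾ clear 6F ⨾ clear 7F ⨾ clear 8F

  module _ {ns : Vec ℕ v} {xs : Vec Baire b} where

    private
      S : (a acc t d w f g k : ℕ) → IM.Store (9 + v) b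
      S = St {ns} {xs}

    emit1-run : ∀ {a acc d f g k} w → ⟨ emit1 , S a acc 0 d w f g k ⟩⇓ S a (acc + w) 0 d (w + w) f g k
    emit1-run {a} {d = d} {f} {g} {k} w = go w refl refl ⨾ move-run 3F 5F (λ ())
      where
      go : ∀ w {acc acc′ t t′} → acc + w ≡ acc′ → t + (w + w) ≡ t′ →
        ⟨ whileNonzero 5F (dec′ 5F ⨾ inc′ 2F ⨾ double) , S a acc t d w f g k ⟩⇓ S a acc′ t′ d 0 f g k
      go zero {acc} {t = t} refl refl rewrite +-identityʳ acc | +-identityʳ t = stop refl
      go (suc w) {acc} {t = t} refl refl = loop (λ ()) (prim dec ⨾ prim inc ⨾ prim inc ⨾ prim inc)
        (go w (sym (+-suc acc w)) (eq t w))
        where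
        eq : ∀ t w → 2 + t + (w + w) ≡ t + (suc w + suc w)
        eq = solve-∀

    emit2-run : ∀ {a acc d f g k} w → ⟨ emit2 , S a acc 0 d w f g k ⟩⇓ S a (acc + (w + w)) 0 d (w + w) f g k
    emit2-run {a} {d = d} {f} {g} {k} w = go w refl refl ⨾ move-run 3F 5F (λ ())
      where
      go : ∀ w {acc acc′ t t′} → acc + (w + w) ≡ acc′ → t + (w + w) ≡ t′ →
        ⟨ whileNonzero 5F (dec′ 5F ⨾ inc′ 2F ⨾ inc′ 2F ⨾ double) , S a acc t d w f g k ⟩⇓ S a acc′ t′ d 0 f g k
      go zero {acc} {t = t} refl refl rewrite +-identityʳ acc | +-identityʳ t = stop refl
      go (suc w) {acc} {t = t} refl refl = loop (λ ()) (prim dec ⨾ prim inc ⨾ prim inc ⨾ prim inc ⨾ prim inc)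
        (go w (eq acc w) (eq t w))
        where
        eq : ∀ t w → 2 + t + (w + w) ≡ t + (suc w + suc w)
        eq = solve-∀

    -- The invariant of the loop is the accumulator plus the weight times the value `x` of the
    -- digits still to be put out. This is its preservation by a digit 1, and `value2` is the case
    -- of a digit 2.
    value1 : ∀ acc w x → acc + w + (w + w) * x ≡ acc + w * suc (2 * x)
    value1 = solve-∀

    value2 : ∀ acc w x → acc + (w + w) + (w + w) * x ≡ acc + w * (2 * suc x)
    value2 = solve-∀

    emitArg-run : ∀ k {a acc d f g w} → ∃ λ acc′ → ∃ λ w′ →
      ⟨ emitArg , S a acc 0 d w f g k ⟩⇓ S a acc′ 0 d w′ f g 0 ×
      (∀ b → acc′ + w′ * ⟦ b ⟧ᵇ ≡ acc + w * ⟦ append2s k b ⟧ᵇ)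
    emitArg-run zero = _ , _ , stop refl , λ _ → refl
    emitArg-run (suc k) {acc = acc} {w = w} =
      let _ , _ , d , e = emitArg-run k
      in _ , _ , loop (λ ()) (prim dec ⨾ emit2-run w) d , λ b → trans (e b) (value2 acc w ⟦ append2s k b ⟧ᵇ)

    renameIndexProg-run : ∀ {s} (js : Vec (Fin r) s) k {a acc w f g} →
      ⟨ renameIndexProg js , S a acc 0 0 w f g k ⟩⇓ S a acc 0 0 w f g (renameIndex js k)
    renameIndexProg-run {s} js k {a} {acc} {w} {f} {g} with k <? s
    ... | yes k<s = switch-run 8F (fromℕ< k<s) (sym (toℕ-fromℕ< k<s))
      (subst (λ n → ⟨ incs (toℕ (lookup js (fromℕ< k<s))) 8F , S a acc 0 0 w f g 0 ⟩⇓ S a acc 0 0 w f g n)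
        (sym (renameIndex-< js k<s)) (incs-run (toℕ (lookup js (fromℕ< k<s))) 8F))
    ... | no k≮s = switch-otherwise s 8F (k ∸ s) (sym (m+[n∸m]≡n (≮⇒≥ k≮s)))
      (clear-run 8F ⨾ subst (λ n → ⟨ incs r 8F , S a acc 0 0 w f g 0 ⟩⇓ S a acc 0 0 w f g n)
        (sym (renameIndex-≮ js k≮s)) (incs-run r 8F))

    renameArgProg-run : ∀ g k {a acc w f} →
      ⟨ renameArgProg , S a acc 0 0 w f g k ⟩⇓ S a acc 0 0 w f 0 (renameArg js g k)
    renameArgProg-run 0 k = switch-run {n = 3} 7F {λ _ → skip} 0F refl skip ⨾ clear-run 7F
    renameArgProg-run 1 k = switch-run {n = 3} 7F {λ _ → skip} 1F refl skip ⨾ clear-run 7F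
    renameArgProg-run 2 k = switch-run {n = 3} 7F {λ _ → skip} 2F refl skip ⨾ clear-run 7F
    renameArgProg-run (suc (suc (suc g))) k =
      switch-otherwise 3 7F {λ _ → skip} g refl (renameIndexProg-run js k) ⨾ clear-run 7F

    halve-even : ∀ n {a t t′ acc w f g k} → a ≡ n + n → t + n ≡ t′ →
      ⟨ halve , S a acc t 0 w f g k ⟩⇓ S 0 acc t′ 0 w f g k
    halve-even zero {t = t} refl refl rewrite +-identityʳ t = stop refl
    halve-even (suc n) {t = t} refl refl rewrite +-suc n n =
      loop (λ ()) (prim dec ⨾ ifFalse (λ ()) (prim dec ⨾ prim inc)) (halve-even n refl (sym (+-suc t n)))

    halve-odd : ∀ n {a t t′ acc w f g k} → a ≡ suc (n + n) → t + n ≡ t′ →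
      ⟨ halve , S a acc t 0 w f g k ⟩⇓ S 0 acc t′ 1 w f g k
    halve-odd zero {t = t} refl refl rewrite +-identityʳ t =
      loop (λ ()) (prim dec ⨾ ifTrue refl (prim inc)) (stop refl)
    halve-odd (suc n) {t = t} refl refl rewrite +-suc n n =
      loop (λ ()) (prim dec ⨾ ifFalse (λ ()) (prim dec ⨾ prim inc)) (halve-odd n refl (sym (+-suc t n)))

    record Processed (P : Prog L) (f : Fin 6) (g k a acc w : ℕ) (digit : ℕᵇ → ℕᵇ) : Set where
      constructor processed
      field
        {acc′ w′ g′ k′} : ℕ
        f′    : Fin 6
        runs  : ⟨ P , S a acc 0 0 w 0 g k ⟩⇓ S a acc′ 0 0 w′ (toℕ f′) g′ k′
        value : ∀ b → acc′ + w′ * ⟦ recode js f′ g′ k′ b ⟧ᵇ ≡ acc + w * ⟦ recode js f g k (digit b) ⟧ᵇ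

    process1-run : ∀ f {g k a acc w} → Processed (process1 f) f g k a acc w 1+[2_]
    process1-run 0F {acc = acc} {w} = processed 1F (emit1-run w ⨾ incs-run 1 6F) (λ b → value1 acc w _)
    process1-run 1F {acc = acc} {w} = processed 2F (emit1-run w ⨾ incs-run 2 6F) (λ b → value1 acc w _)
    process1-run 2F {acc = acc} {w} = processed 3F (emit1-run w ⨾ incs-run 3 6F) (λ b → value1 acc w _)
    process1-run 3F {acc = acc} {w} = processed 4F (emit1-run w ⨾ incs-run 4 6F) (λ b → value1 acc w _)
    process1-run 4F {g} {k} =
      let acc′ , w′ , d , e = emitArg-run (renameArg js g k)
      in processed 5F (renameArgProg-run g k ⨾ d ⨾ emit1-run w′ ⨾ incs-run 5 6F)
           (λ b → trans (value1 acc′ w′ _) (e 1+[2 recode js 5F 0 0 b ]))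
    process1-run 5F {acc = acc} {w} = processed 0F (emit1-run w) (λ b → value1 acc w _)

    process2-run : ∀ f {g k a acc w} → Processed (process2 f) f g k a acc w 2[1+_]
    process2-run 0F {acc = acc} {w} = processed 0F (emit2-run w ⨾ skip) (λ b → value2 acc w _)
    process2-run 1F {acc = acc} {w} = processed 1F (emit2-run w ⨾ incs-run 1 6F) (λ b → value2 acc w _)
    process2-run 2F {acc = acc} {w} = processed 2F (emit2-run w ⨾ incs-run 2 6F) (λ b → value2 acc w _)
    process2-run 3F {acc = acc} {w} = processed 3F (emit2-run w ⨾ prim inc ⨾ incs-run 3 6F) (λ b → value2 acc w _)
    process2-run 4F = processed 4F (prim inc ⨾ incs-run 4 6F) (λ b → refl)
    process2-run 5F {acc = acc} {w} = processed 5F (emit2-run w ⨾ incs-run 5 6F) (λ b → value2 acc w _)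

    record Recoded (a acc w f g k result : ℕ) : Set where
      constructor recoded
      field
        {w′ f′ g′ k′} : ℕ
        runs : ⟨ recodeLoop , S a acc 0 0 w f g k ⟩⇓ S 0 result 0 0 w′ f′ g′ k′

    recodeLoop-run : ∀ b f {g k acc w result} → acc + w * ⟦ recode js f g k b ⟧ᵇ ≡ result →
      Recoded ⟦ b ⟧ᵇ acc w (toℕ f) g k result
    recodeLoop-run 0ᵇ f {acc = acc} {w} refl rewrite *-zeroʳ w | +-identityʳ acc = recoded (stop refl)
    recodeLoop-run 1+[2 b ] f {g} {k} {acc} {w} eq with process1-run f {g} {k} {⟦ b ⟧ᵇ} {acc} {w}
    ... | processed f′ d e with recodeLoop-run b f′ (trans (e b) eq)
    ...   | recoded d′ = recoded
      (loop (λ ()) (halve-odd ⟦ b ⟧ᵇ (cong (λ n → suc (⟦ b ⟧ᵇ + n)) (+-identityʳ ⟦ b ⟧ᵇ)) refl ⨾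
        ifFalse (λ ()) (prim dec ⨾ move-run 3F 1F (λ ()) ⨾ switch-run {n = 6} 6F {process1} f refl d)) d′)
    recodeLoop-run 2[1+ b ] f {g} {k} {acc} {w} eq with process2-run f {g} {k} {⟦ b ⟧ᵇ} {acc} {w}
    ... | processed f′ d e with recodeLoop-run b f′ (trans (e b) eq)
    ...   | recoded d′ = recoded
      (loop (λ ()) (halve-even (suc ⟦ b ⟧ᵇ) (cong (λ n → suc (⟦ b ⟧ᵇ + suc n)) (+-identityʳ ⟦ b ⟧ᵇ)) refl ⨾
        ifTrue refl (prim dec ⨾ move-run 3F 1F (λ ()) ⨾ switch-run {n = 6} 6F {process2} f refl d)) d′)

    recodeProg-run : ∀ e → ⟨ recodeProg , S e 0 0 0 0 0 0 0 ⟩⇓ S 0 (recodeℕ js e) 0 0 0 0 0 0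
    recodeProg-run e with recodeLoop-run (fromℕ e) 0F {0} {0} {0} {1} (+-identityʳ _)
    ... | recoded {w′} {f′} {g′} {k′} d = prim inc ⨾
      subst (λ m → ⟨ recodeLoop , S m 0 0 0 1 0 0 0 ⟩⇓ S 0 (recodeℕ js e) 0 0 w′ f′ g′ k′) (toℕ-fromℕᵇ e) d ⨾
      clear-run 5F ⨾ clear-run 6F ⨾ clear-run 7F ⨾ clear-run 8F

-- From BSS-machines to counter programs

copyCode : ∀ {b} → Fin b → ℕ
copyCode k = programCode (copyProgram k)

addCode multCode : ∀ {b} → Fin b → Fin b → ℕ
addCode k l  = programCode (addProgram k l)
multCode k l = programCode (multProgram k l)

copyCode-computes : ∀ {b} (k : Fin b) xs → Φ[ xs ]⟨ copyCode k ⟩≈ lookup xs k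
copyCode-computes k xs = Φ-programCode (copyProgram k) (copy-computes k {xs})

addCode-computes : ∀ {b} (k l : Fin b) xs → Φ[ xs ]⟨ addCode k l ⟩≈ (λ i → lookup xs k i + lookup xs l i)
addCode-computes k l xs = Φ-programCode (addProgram k l) (add-computes k l {xs})

multCode-computes : ∀ {b} (k l : Fin b) xs → Φ[ xs ]⟨ multCode k l ⟩≈ (λ i → lookup xs k i * lookup xs l i)
multCode-computes k l xs = Φ-programCode (multProgram k l) (mult-computes k l {xs})

-- Compares initial Baire registers of the two machines, where the inputs are followed by different
-- numbers of zero sequences.
lookup-pad : ∀ {A : Set} {q} (xs : Vec A q) k l {a} (i : Fin (q + k)) (j : Fin (q + l)) → toℕ i ≡ toℕ j →
  lookup (xs Vec.++ Vec.replicate k a) i ≡ lookup (xs Vec.++ Vec.replicate l a) j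
lookup-pad [] k l i j e = trans (lookup-replicate i _) (sym (lookup-replicate j _))
lookup-pad (x ∷ xs) k l zero    zero    e = refl
lookup-pad (x ∷ xs) k l (suc i) (suc j) e = lookup-pad xs k l i j (suc-injective e)

Eq-sym : ∀ Y {y y′} → Eq Y y y′ → Eq Y y′ y
Eq-sym num e = sym e
Eq-sym seq e = λ i → sym (e i)

Eq-trans : ∀ Y {y y′ y″} → Eq Y y y′ → Eq Y y′ y″ → Eq Y y y″
Eq-trans num e f = trans e f
Eq-trans seq e f = λ i → trans (e i) (f i)

module BSS⇒IM {p q Y} (M : BSS.Machine p q Y) where
  open BSS.Machine M renaming (extraNum to e; extraSeq to w)
  open IM using (_∣_; inc; dec; call; isZero; zeroSeq)

  private
    v = p + e
    b = q + (w + 2)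
    z = MS.zeroTestTape q w
    o = MS.outputBaire q w
    L = IM.language v z

  open Macros {v} {b} z

  var : Fin v → Fin (9 + v)
  var j = 9 ↑ʳ j

  -- The last two Baire registers, for the zero test and the output, stay outside the image. A
  -- register to be tested or put out can thus be copied there without destroying another.
  ι : Fin (q + w) → Fin b
  ι j = inject≤ j (+-monoʳ-≤ q (m≤m+n w 2))

  ι≢z : ∀ j → ι j ≢ z
  ι≢z j h = <⇒≢ (toℕ<n j) (trans (sym (toℕ-inject≤ j _)) (trans (cong toℕ h)
    (trans (toℕ-↑ʳ q _) (cong (q +_) (trans (toℕ-↑ʳ w (zero {1})) (+-identityʳ w))))))

  callCode : ℕ → Fin b → Prog L
  callCode c l = incs c 2F ⨾ prim (call l) ⨾ clear 2F

  prepare : ∀ {s} → Fin v → Vec (Fin (q + w)) s → Prog L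
  prepare e js = copy 3F (var e) 1F ⨾ RecodeProgram.recodeProg z b (Vec.map ι js)

  instr : BSS.Instruction v (q + w) → Prog L
  instr (BSS.setZero j)   = clear (var j)
  instr (BSS.addOne j)    = inc′ (var j)
  instr (BSS.copyNum j k) = copy 3F (var k) 4F ⨾ clear (var j) ⨾ move 4F (var j)
  instr (BSS.copySeq j k) = callCode (copyCode (ι k)) (ι j)
  instr (BSS.add j k l)   = callCode (addCode (ι k) (ι l)) (ι j)
  instr (BSS.mult j k l)  = callCode (multCode (ι k) (ι l)) (ι j)
  instr (BSS.call j e js) = prepare e js ⨾ prim (call (ι j)) ⨾ clear 2F

  subtract : Prog L
  subtract = whileNonzero 1F (dec′ 1F ⨾ ifZero 4F (inc′ 5F) (dec′ 4F))

  -- Counting both copies down together leaves one truncated difference in counter 5 and the other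
  -- in counter 4; their sum is 0 exactly for equal numbers.
  difference : Fin v → Fin v → Prog L
  difference j k = copy 3F (var j) 1F ⨾ copy 3F (var k) 4F ⨾ subtract ⨾ move 4F 5F

  test : BSS.Test v (q + w) → Prog L → Prog L → Prog L
  test (BSS.isZeroNum j)  P Q = ifZero (var j) P Q
  test (BSS.equalNum j k) P Q = difference j k ⨾ ifZero 5F P (clear 5F ⨾ Q)
  test (BSS.isZeroSeq j)  P Q = callCode (copyCode (ι j)) z ⨾ ifte zeroSeq P Q

  -- Nodes are numbered from 1, since the value 0 stops the interpreter. An output node is thus
  -- interpreted by leaving the program counter at 0.
  goto : Fin nodes → Prog L
  goto l = incs (suc (toℕ l)) 0F

  armOf : BSS.Node nodes v (q + w) → Prog L
  armOf BSS.output          = skip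
  armOf (BSS.compute I l)   = instr I ⨾ goto l
  armOf (BSS.branch T l l′) = test T (goto l) (goto l′)

  arm : Fin nodes → Prog L
  arm l = armOf (node l)

  body : Prog L
  body = dec′ 0F ⨾ switch nodes 0F arm skip

  epilogue : ∀ Z → BSS.Register v (q + w) Z → Prog L
  epilogue num j = copy 3F (var j) 1F
  epilogue seq j = callCode (copyCode (ι j)) o

  clean : Vec ℕ v → Vec Baire b → IM.Store (9 + v) b
  clean ns xs = 0 ∷ 0 ∷ 0 ∷ 0 ∷ 0 ∷ 0 ∷ 0 ∷ 0 ∷ 0 ∷ ns ∣ xs

  at : Fin nodes → Vec ℕ v → Vec Baire b → IM.Store (9 + v) b
  at l ns xs = suc (toℕ l) ∷ 0 ∷ 0 ∷ 0 ∷ 0 ∷ 0 ∷ 0 ∷ 0 ∷ 0 ∷ ns ∣ xs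

  record Rel (xs : Vec Baire (q + w)) (xs′ : Vec Baire b) : Set where
    constructor agreeing
    field agree : ∀ j → lookup xs j ≈ lookup xs′ (ι j)

  open Rel

  Rel-update : ∀ xs xs′ j {y y′} → Rel xs xs′ → y ≈ y′ → Rel (xs [ j ]≔ y) (xs′ [ ι j ]≔ y′)
  Rel-update xs xs′ j {y} {y′} r s = agreeing same
    where
    same : ∀ k → lookup (xs [ j ]≔ y) k ≈ lookup (xs′ [ ι j ]≔ y′) (ι k)
    same k i with k ≟ᶠ j
    ... | yes refl = trans (cong (λ x → x i) (lookup∘update j xs y))
                     (trans (s i) (sym (cong (λ x → x i) (lookup∘update (ι j) xs′ y′))))
    ... | no k≢j = trans (cong (λ x → x i) (lookup∘update′ k≢j xs y)) (trans (agree r k i)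
                   (sym (cong (λ x → x i) (lookup∘update′ (k≢j ∘ inject≤-injective _ _ k j) xs′ y′))))

  Rel-zeroTest : ∀ xs xs′ {y} → Rel xs xs′ → Rel xs (xs′ [ z ]≔ y)
  Rel-zeroTest xs xs′ {y} r = agreeing λ k i → trans (agree r k i) (sym (cong (λ x → x i) (lookup∘update′ (ι≢z k) xs′ y)))

  callCode-run : ∀ c l {ns xs y} → Φ[ xs ]⟨ c ⟩≈ y → ⟨ callCode c l , clean ns xs ⟩⇓ clean ns (xs [ l ]≔ y)
  callCode-run c l φ = incs-run c 2F ⨾ prim (call φ) ⨾ clear-run 2F

  recoded : ∀ {s} → Fin v → Vec (Fin (q + w)) s → Vec ℕ v → ℕ
  recoded e js ns = Recoding.recodeℕ b (Vec.map ι js) (lookup ns e)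

  prepared : ∀ {s} → Fin v → Vec (Fin (q + w)) s → Vec ℕ v → Vec Baire b → IM.Store (9 + v) b
  prepared e js ns xs = 0 ∷ 0 ∷ recoded e js ns ∷ 0 ∷ 0 ∷ 0 ∷ 0 ∷ 0 ∷ 0 ∷ ns ∣ xs

  prepare-run : ∀ {s} e (js : Vec (Fin (q + w)) s) ns xs → ⟨ prepare e js , clean ns xs ⟩⇓ prepared e js ns xs
  prepare-run e js ns xs = copy-run 3F (var e) 1F (λ ()) (λ ()) (λ ()) refl ⨾
    RecodeProgram.recodeProg-run z b (Vec.map ι js) (lookup ns e)

  oracles : ∀ {s} (js : Vec (Fin (q + w)) s) {xs xs′} → Rel xs xs′ → ∀ k →
    lookup (Vec.map (lookup xs) js) k ≈ lookup xs′ (lookup (Vec.map ι js) k)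
  oracles js {xs} {xs′} r k i rewrite lookup-map k (lookup xs) js | lookup-map k ι js = agree r (lookup js k) i

  instr-run : ∀ {I ns ns′ xs ys xs′} → Rel xs xs′ → BSS.Executes I (BSS.store ns xs) (BSS.store ns′ ys) →
    ∃ λ ys′ → ⟨ instr I , clean ns xs′ ⟩⇓ clean ns′ ys′ × Rel ys ys′
  instr-run r (BSS.setZero {j}) = _ , clear-run (var j) , r
  instr-run r (BSS.addOne {j} {ns}) = _ , subst (λ ms → ⟨ inc′ (var j) , clean ns _ ⟩⇓ clean ms _)
    (updateAt-cong-local j ns refl) (prim inc) , r
  instr-run r (BSS.copyNum {j} {k} {ns}) = _ ,
    copy-run 3F (var k) 4F (λ ()) (λ ()) (λ ()) refl ⨾ clear-run (var j) ⨾
    subst (λ ms → ⟨ move 4F (var j) , 0 ∷ 0 ∷ 0 ∷ 0 ∷ lookup ns k ∷ 0 ∷ 0 ∷ 0 ∷ 0 ∷ ns [ j ]≔ 0 ∣ _ ⟩⇓ clean ms _)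
      (updateAt-updateAt j ns) (move-run 4F (var j) (λ ())) , r
  instr-run {xs = xs} {xs′ = xs′} r (BSS.copySeq {j} {k}) = _ ,
    callCode-run (copyCode (ι k)) (ι j) (copyCode-computes (ι k) xs′) , Rel-update xs xs′ j r (agree r k)
  instr-run {xs = xs} {xs′ = xs′} r (BSS.add {j} {k} {l}) = _ ,
    callCode-run (addCode (ι k) (ι l)) (ι j) (addCode-computes (ι k) (ι l) xs′) ,
    Rel-update xs xs′ j r (λ i → cong₂ _+_ (agree r k i) (agree r l i))
  instr-run {xs = xs} {xs′ = xs′} r (BSS.mult {j} {k} {l}) = _ ,
    callCode-run (multCode (ι k) (ι l)) (ι j) (multCode-computes (ι k) (ι l) xs′) ,
    Rel-update xs xs′ j r (λ i → cong₂ _*_ (agree r k i) (agree r l i))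
  instr-run {ns = ns} {xs = xs} {xs′ = xs′} r (BSS.call {j = j} {e} {js = js} φ) = _ ,
    prepare-run e js ns xs′ ⨾
    prim (call (Recoding.Φ-recode b (Vec.map ι js) (oracles js r) {lookup ns e} φ)) ⨾ clear-run 2F ,
    Rel-update xs xs′ j r (λ _ → refl)

  subtract-run : ∀ m n {d d′ w w′ ns xs} → d ≡ n → n ∸ m ≡ d′ → w + (m ∸ n) ≡ w′ →
    ⟨ subtract , 0 ∷ m ∷ 0 ∷ 0 ∷ d ∷ w ∷ 0 ∷ 0 ∷ 0 ∷ ns ∣ xs ⟩⇓ (0 ∷ 0 ∷ 0 ∷ 0 ∷ d′ ∷ w′ ∷ 0 ∷ 0 ∷ 0 ∷ ns ∣ xs)
  subtract-run zero    zero    {w = w} refl refl refl rewrite +-identityʳ w = stop refl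
  subtract-run zero    (suc n) {w = w} refl refl refl rewrite +-identityʳ w = stop refl
  subtract-run (suc m) zero    {w = w} refl refl refl = loop (λ ()) (prim dec ⨾ ifTrue refl (prim inc))
    (subtract-run m zero refl (0∸n≡0 m) (trans refl (sym (+-suc w m))))
  subtract-run (suc m) (suc n) refl e f = loop (λ ()) (prim dec ⨾ ifFalse (λ ()) (prim dec))
    (subtract-run m n refl e f)

  difference-run : ∀ j k ns xs → ⟨ difference j k , clean ns xs ⟩⇓
    (0 ∷ 0 ∷ 0 ∷ 0 ∷ 0 ∷ (lookup ns j ∸ lookup ns k) + (lookup ns k ∸ lookup ns j) ∷ 0 ∷ 0 ∷ 0 ∷ ns ∣ xs)
  difference-run j k ns xs = copy-run 3F (var j) 1F (λ ()) (λ ()) (λ ()) refl ⨾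
    copy-run 3F (var k) 4F (λ ()) (λ ()) (λ ()) refl ⨾
    subtract-run (lookup ns j) (lookup ns k) refl refl refl ⨾ move-run 4F 5F (λ ())

  difference≡0 : ∀ m n → (m ∸ n) + (n ∸ m) ≡ 0 → m ≡ n
  difference≡0 m n h = ≤-antisym (m∸n≡0⇒m≤n (m+n≡0⇒m≡0 (m ∸ n) h)) (m∸n≡0⇒m≤n (m+n≡0⇒n≡0 (m ∸ n) h))

  difference-refl : ∀ {m n} → m ≡ n → (m ∸ n) + (n ∸ m) ≡ 0
  difference-refl {m} refl = cong₂ _+_ (n∸n≡0 m) (n∸n≡0 m)

  -- Testing a Baire register overwrites the zero-test register. The branch is therefore assumed to
  -- run from every related `ys`, and the final store is a function of `ys`.
  test-true : ∀ {T ns xs xs′ P Q} {τ : Vec Baire b → IM.Store (9 + v) b} → Rel xs xs′ → BSS.Holds T (BSS.store ns xs) →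
    (∀ ys → Rel xs ys → ⟨ P , clean ns ys ⟩⇓ τ ys) →
    ∃ λ ys → ⟨ test T P Q , clean ns xs′ ⟩⇓ τ ys × Rel xs ys
  test-true {BSS.isZeroNum j}  r h d = _ , ifTrue h (d _ r) , r
  test-true {BSS.equalNum j k} {ns} {xs} {xs′} {P} {Q} {τ} r h d = _ , difference-run j k ns xs′ ⨾
    ifTrue (difference-refl h) (subst (λ n → ⟨ P , 0 ∷ 0 ∷ 0 ∷ 0 ∷ 0 ∷ n ∷ 0 ∷ 0 ∷ 0 ∷ ns ∣ xs′ ⟩⇓ τ xs′)
      (sym (difference-refl h)) (d xs′ r)) , r
  test-true {BSS.isZeroSeq j} {xs = xs} {xs′} r h d =
    let r′ = Rel-zeroTest xs xs′ r
    in _ , callCode-run (copyCode (ι j)) z (copyCode-computes (ι j) xs′) ⨾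
       ifTrue (λ i → trans (cong (λ x → x i) (lookup∘update z xs′ _)) (trans (sym (agree r j i)) (h i))) (d _ r′) , r′

  test-false : ∀ {T ns xs xs′ P Q} {τ : Vec Baire b → IM.Store (9 + v) b} → Rel xs xs′ → ¬ BSS.Holds T (BSS.store ns xs) →
    (∀ ys → Rel xs ys → ⟨ Q , clean ns ys ⟩⇓ τ ys) →
    ∃ λ ys → ⟨ test T P Q , clean ns xs′ ⟩⇓ τ ys × Rel xs ys
  test-false {BSS.isZeroNum j}  r h d = _ , ifFalse h (d _ r) , r
  test-false {BSS.equalNum j k} {ns} {xs} {xs′} r h d = _ , difference-run j k ns xs′ ⨾
    ifFalse (h ∘ difference≡0 _ _) (clear-run 5F ⨾ d xs′ r) , r
  test-false {BSS.isZeroSeq j} {xs = xs} {xs′} r h d =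
    let r′ = Rel-zeroTest xs xs′ r
    in _ , callCode-run (copyCode (ι j)) z (copyCode-computes (ι j) xs′) ⨾
       ifFalse (λ h′ → h (λ i → trans (agree r j i) (trans (sym (cong (λ x → x i) (lookup∘update z xs′ _))) (h′ i)))) (d _ r′) , r′

  module S = BSS.Semantics M

  Halted : S.Config → Set
  Halted (l , _) = node l ≡ BSS.output

  data R : S.Config → IM.Store (9 + v) b → Set where
    rel : ∀ {l ns xs xs′} → Rel xs xs′ → R (l , BSS.store ns xs) (at l ns xs′)

  data F : S.Config → IM.Store (9 + v) b → Set where
    rel : ∀ {l ns xs xs′} → Rel xs xs′ → F (l , BSS.store ns xs) (clean ns xs′)

  goto-run : ∀ l {ns xs} → ⟨ goto l , clean ns xs ⟩⇓ at l ns xs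
  goto-run l = incs-run (suc (toℕ l)) 0F

  body-run : ∀ {l ns xs τ} → ⟨ arm l , clean ns xs ⟩⇓ τ → ⟨ body , at l ns xs ⟩⇓ τ
  body-run {l} d = prim dec ⨾ switch-run 0F l refl d

  arm-run : ∀ {l N ns xs τ} → node l ≡ N → ⟨ armOf N , clean ns xs ⟩⇓ τ → ⟨ body , at l ns xs ⟩⇓ τ
  arm-run {l} refl = body-run {l}

  body-step : ∀ {c c′ σ} → R c σ → c S.⟶ c′ → ∃ λ σ′ → ⟨ body , σ ⟩⇓ σ′ × R c′ σ′
  body-step (rel r) (S.compute {v = l} {w = l′} {σ′ = BSS.store _ _} n x) =
    let _ , d , r′ = instr-run r x in _ , arm-run {l} n (d ⨾ goto-run l′) , rel r′
  body-step (rel r) (S.true {v = l} {T} {l′} {l″} n h) =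
    let _ , d , r′ = test-true {T} {Q = goto l″} {τ = at l′ _} r h (λ _ _ → goto-run l′)
    in _ , arm-run {l} n d , rel r′
  body-step (rel r) (S.false {v = l} {T} {l′} {l″} n h) =
    let _ , d , r′ = test-false {T} {P = goto l′} {τ = at l″ _} r h (λ _ _ → goto-run l″)
    in _ , arm-run {l} n d , rel r′

  body-halt : ∀ {c σ} → R c σ → Halted c → ∃ λ σ′ → ⟨ body , σ ⟩⇓ σ′ × F c σ′
  body-halt (rel {l} r) n = _ , arm-run {l} n skip , rel r

  zeroTape : ∀ {j ns xs xs′ σ} → Rel xs xs′ → ⟨ callCode (copyCode (ι j)) z , clean ns xs′ ⟩⇓ σ →
    lookup (IM.seqs σ) z ≈ lookup xs j
  zeroTape {j} {ns} {xs} {xs′} r d i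
    with IM.⇓-deterministic (callCode (copyCode (ι j)) z) IM.~-refl d
           (callCode-run (copyCode (ι j)) z {ns} (copyCode-computes (ι j) xs′))
  ... | _ IM., f = trans (f z i) (trans (cong (λ x → x i) (lookup∘update z xs′ _)) (sym (agree r j i)))

  arm-progress : ∀ {l N ns xs xs′ τ} → node l ≡ N → Rel xs xs′ → ⟨ armOf N , clean ns xs′ ⟩⇓ τ →
    (∃ λ c → (l , BSS.store ns xs) S.⟶ c) ⊎ Halted (l , BSS.store ns xs)
  arm-progress {N = BSS.output} n r d = inj₂ n
  arm-progress {N = BSS.compute (BSS.setZero _) _}   n r d = inj₁ (_ , S.compute n BSS.setZero)
  arm-progress {N = BSS.compute (BSS.addOne _) _}    n r d = inj₁ (_ , S.compute n BSS.addOne)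
  arm-progress {N = BSS.compute (BSS.copyNum _ _) _} n r d = inj₁ (_ , S.compute n BSS.copyNum)
  arm-progress {N = BSS.compute (BSS.copySeq _ _) _} n r d = inj₁ (_ , S.compute n BSS.copySeq)
  arm-progress {N = BSS.compute (BSS.add _ _ _) _}   n r d = inj₁ (_ , S.compute n BSS.add)
  arm-progress {N = BSS.compute (BSS.mult _ _ _) _}  n r d = inj₁ (_ , S.compute n BSS.mult)
  arm-progress {N = BSS.compute (BSS.call j e js) _} {ns} {xs} {xs′} n r ((d ⨾ prim (call {y = y} φ) ⨾ _) ⨾ _)
    with IM.⇓-deterministic (prepare e js) IM.~-refl d (prepare-run e js ns xs′)
  -- The counters agree exactly, so the code called is the recoded one. The Baire registers agree
  -- only pointwise, whence `Φ-resp`; undoing the recoding then shows that the original call is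
  -- defined.
  ... | refl IM., f = inj₁ (_ , S.compute n (BSS.call (Recoding.Φ-unrecode b (Vec.map ι js) (oracles js r)
    {lookup ns e} (Φ-resp _ xs′ (recoded e js ns) f φ))))
  arm-progress {N = BSS.branch (BSS.isZeroNum j) _ _} {ns} n r d with lookup ns j ≟ℕ 0
  ... | yes h = inj₁ (_ , S.true n h)
  ... | no h  = inj₁ (_ , S.false n h)
  arm-progress {N = BSS.branch (BSS.equalNum j k) _ _} {ns} n r d with lookup ns j ≟ℕ lookup ns k
  ... | yes h = inj₁ (_ , S.true n h)
  ... | no h  = inj₁ (_ , S.false n h)
  arm-progress {N = BSS.branch (BSS.isZeroSeq j) _ _} n r (d ⨾ ifTrue h _) =
    inj₁ (_ , S.true n (λ i → trans (sym (zeroTape r d i)) (h i)))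
  arm-progress {N = BSS.branch (BSS.isZeroSeq j) _ _} n r (d ⨾ ifFalse h _) =
    inj₁ (_ , S.false n (λ h′ → h (λ i → trans (zeroTape r d i) (h′ i))))

  progress : ∀ {c σ σ′} → R c σ → ⟨ body , σ ⟩⇓ σ′ → (∃ λ c′ → c S.⟶ c′) ⊎ Halted c
  progress (rel {l} r) (prim dec ⨾ d) = arm-progress refl r (switch-run⁻¹ 0F {arm} l refl d)

  R-resp : ∀ {c σ τ} → σ IM.~ τ → R c σ → R c τ
  R-resp (refl IM., f) (rel r) = rel (agreeing λ j i → trans (agree r j i) (f (ι j) i))

  F-resp : ∀ {c σ τ} → σ IM.~ τ → F c σ → F c τ
  F-resp (refl IM., f) (rel r) = rel (agreeing λ j i → trans (agree r j i) (f (ι j) i))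

  R-running : ∀ {c σ} → R c σ → lookup (IM.counters σ) zero ≢ 0
  R-running (rel _) ()

  F-halted : ∀ {c σ} → F c σ → lookup (IM.counters σ) zero ≡ 0
  F-halted (rel _) = refl

  open Interpreter z S._⟶_ Halted R F body R-running F-halted R-resp F-resp
    body-step body-halt progress

  machine : IM.Machine p q Y
  machine = record
    { extra = e ; work = w ; program = goto entry ⨾ interpret ⨾ epilogue Y result }

  initial-rel : ∀ n x → ∃ λ σ → ⟨ goto entry , IM.initial machine n x ⟩⇓ σ × R (S.initial n x) σ
  initial-rel n x = _ , goto-run entry , rel (agreeing λ j i →
    cong (λ x → x i) (lookup-pad x w (w + 2) j (ι j) (sym (toℕ-inject≤ j _))))

  epilogue-run : ∀ Z j {c σ} → F c σ →
    ∃ λ σ′ → ⟨ epilogue Z j , σ ⟩⇓ σ′ × Eq Z (IM.output q w Z σ′) (S.value Z j (proj₂ c))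
  epilogue-run num j (rel r) = _ , copy-run 3F (var j) 1F (λ ()) (λ ()) (λ ()) refl , refl
  epilogue-run seq j (rel {xs′ = xs′} r) = _ , callCode-run (copyCode (ι j)) o (copyCode-computes (ι j) xs′) ,
    λ i → trans (cong (λ x → x i) (lookup∘update o xs′ _)) (sym (agree r j i))

  output-resp : ∀ Z {σ τ : IM.Store (9 + v) b} → σ IM.~ τ → Eq Z (IM.output q w Z σ) (IM.output q w Z τ)
  output-resp num (refl IM., _) = refl
  output-resp seq (_ IM., f)    = f o

  simulates : ∀ {n x y} → S.Outputs n x y ⇔ IM.Outputs machine n x y
  simulates {n} {x} {y} = mk⇔ to from
    where
    to : S.Outputs n x y → IM.Outputs machine n x y
    to (l , σ , r , h , o) with initial-rel n x
    ... | _ , d , r₀ with interpret-complete r₀ r h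
    ... | _ , d′ , f with epilogue-run Y result f
    ... | _ , d″ , e = _ , d ⨾ d′ ⨾ d″ , Eq-trans Y e o
    from : IM.Outputs machine n x y → S.Outputs n x y
    from (_ , d ⨾ d′ ⨾ d″ , o) with initial-rel n x
    ... | _ , d₀ , r₀
      with interpret-sound (R-resp (IM.⇓-deterministic (goto entry) IM.~-refl d₀ d) r₀) d′
    ... | (l , σ) , r , h , f with epilogue-run Y result f
    ... | _ , d₁ , e = l , σ , r , h , Eq-trans Y (Eq-sym Y e)
      (Eq-trans Y (output-resp Y (IM.⇓-deterministic (epilogue Y result) IM.~-refl d₁ d″)) o)

-- Register files as functions of single counters

updateAt-++ˡ : ∀ {A : Set} {m n} (xs : Vec A m) (ys : Vec A n) i {f : A → A} →
  updateAt (xs Vec.++ ys) (i ↑ˡ n) f ≡ updateAt xs i f Vec.++ ys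
updateAt-++ˡ (x ∷ xs) ys zero    = refl
updateAt-++ˡ (x ∷ xs) ys (suc i) = cong (x ∷_) (updateAt-++ˡ xs ys i)

updateAt-++ʳ : ∀ {A : Set} {m n} (xs : Vec A m) (ys : Vec A n) i {f : A → A} →
  updateAt (xs Vec.++ ys) (m ↑ʳ i) f ≡ xs Vec.++ updateAt ys i f
updateAt-++ʳ []       ys i = refl
updateAt-++ʳ (x ∷ xs) ys i = cong (x ∷_) (updateAt-++ʳ xs ys i)

module Views {v b : ℕ} (z : Fin b) (xs : Vec Baire b) where
  open IM
  open Macros {v} {b} z

  -- The family W describes the counters as a function of the content of X.
  record Counts (X : Fin (9 + v)) (W : ℕ → Vec ℕ (9 + v)) : Set where
    constructor counts
    field
      lookup-view : ∀ n → lookup (W n) X ≡ n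
      update-view : ∀ n f → updateAt (W n) X f ≡ W (f n)

  open Counts

  private
    L = IM.language v z

  infix 4 _↦_via_
  _↦_via_ : Vec ℕ (9 + v) → Vec ℕ (9 + v) → Prog L → Set
  ns ↦ ms via P = ⟨ P , ns ∣ xs ⟩⇓ (ms ∣ xs)

  infixl 5 _to_ _from_
  _to_ : ∀ {ns ms ms′ P} → ns ↦ ms via P → ms ≡ ms′ → ns ↦ ms′ via P
  d to refl = d

  _from_ : ∀ {ns ns′ ms P} → ns ↦ ms via P → ns ≡ ns′ → ns′ ↦ ms via P
  d from refl = d

  module _ {X W} (V : Counts X W) where

    inc-view : ∀ {n} → W n ↦ W (suc n) via inc′ X
    inc-view = prim inc to update-view V _ suc

    dec-view : ∀ {n} → W (suc n) ↦ W n via dec′ X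
    dec-view = prim dec to update-view V _ pred

    zero-view : Holds z (isZero X) true (W 0 ∣ xs)
    zero-view = lookup-view V 0

    suc-view : ∀ {n} → Holds z (isZero X) false (W (suc n) ∣ xs)
    suc-view h = case trans (sym (lookup-view V _)) h of λ ()

    incs-view : ∀ {n} m → W n ↦ W (n + m) via incs m X
    incs-view m = incs-run m X to update-view V _ (_+ m)

    clear-view : ∀ {n} → W n ↦ W 0 via clear X
    clear-view = clear-run X to update-view V _ (λ _ → 0)

    switch-view : ∀ {n} {arms : Fin n → Prog L} {o τ} i →
      ⟨ arms i , W 0 ∣ xs ⟩⇓ τ → ⟨ switch n X arms o , W (toℕ i) ∣ xs ⟩⇓ τ
    switch-view {arms = arms} i d = switch-run X i (lookup-view V _)
      (subst (λ ms → ⟨ arms i , ms ∣ xs ⟩⇓ _) (sym (update-view V _ (λ _ → 0))) d)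

  -- The two families of views already imply that `X` and `Y` differ, as their contents vary
  -- independently.
  move-view : ∀ {X Y} {W : ℕ → ℕ → Vec ℕ (9 + v)} → (∀ y → Counts X (λ x → W x y)) → (∀ x → Counts Y (W x)) →
    ∀ x y → W x y ↦ W 0 (y + x) via move X Y
  move-view {W = W} V U zero    y = stop (zero-view (V y)) to cong (W 0) (sym (+-identityʳ y))
  move-view {W = W} V U (suc x) y = loop (suc-view (V y)) (dec-view (V y) ⨾ inc-view (U x))
    (move-view V U x (suc y) to cong (W 0) (sym (+-suc y x)))

  copy-view : ∀ {T X Y} {W : ℕ → ℕ → ℕ → Vec ℕ (9 + v)} → (∀ x y → Counts T (λ t → W t x y)) →
    (∀ t y → Counts X (λ x → W t x y)) → (∀ t x → Counts Y (W t x)) →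
    ∀ x y → W 0 x y ↦ W 0 x (y + x) via copy T X Y
  copy-view {T} {X} {Y} {W} VT VX VY x y =
    move-view {W = λ x t → W t x y} (λ t → VX t y) (λ x → VT x y) x 0 ⨾ back x 0 y
    where
    back : ∀ t x y → W t x y ↦ W 0 (x + t) (y + t) via whileNonzero T (dec′ T ⨾ inc′ X ⨾ inc′ Y)
    back zero x y = stop (zero-view (VT x y)) to cong₂ (W 0) (sym (+-identityʳ x)) (sym (+-identityʳ y))
    back (suc t) x y = loop (suc-view (VT x y)) (dec-view (VT x y) ⨾ inc-view (VX t y) ⨾ inc-view (VY t (suc x)))
      (back t (suc x) (suc y) to cong₂ (W 0) (sym (+-suc x t)) (sym (+-suc y t)))

-- Stacks of digits are numbers in base K; the digits 0 at the bottom of a stack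
-- are not visible, in accordance with the blanks beyond the end of a tape.
module Stacks {v b : ℕ} (z : Fin b) (K : ℕ) where
  open Macros {v} {b} z

  private
    L = IM.language v z
    A : Fin (9 + v)
    A = 1F

  push : Fin (9 + v) → ℕ → Prog L
  push X a = move X A ⨾ whileNonzero A (dec′ A ⨾ incs K X) ⨾ incs a X

  -- Counts A down by K and then increments X, unless A becomes zero before.
  chunk : Fin (9 + v) → Fin (9 + v) → (fuel read : ℕ) → Prog L
  chunk X Y zero       j = inc′ X
  chunk X Y (suc fuel) j = ifZero A (incs j Y) (dec′ A ⨾ chunk X Y fuel (suc j))

  pop : Fin (9 + v) → Fin (9 + v) → Prog L
  pop X Y = move X A ⨾ whileNonzero A (chunk X Y K 0)

  module _ (xs : Vec Baire b) where
    open Views {v} {b} z xs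

    push-view : ∀ {X} {W : ℕ → ℕ → Vec ℕ (9 + v)} → (∀ x → Counts A (λ a → W a x)) → (∀ a → Counts X (W a)) →
      ∀ x a → W 0 x ↦ W 0 (K * x + a) via push X a
    push-view {X} {W} VA VX x a = move-view {W = λ x a → W a x} VX VA x 0 ⨾ times x 0 ⨾ incs-view (VX 0) a
      where
      times : ∀ n x → W n x ↦ W 0 (x + K * n) via whileNonzero A (dec′ A ⨾ incs K X)
      times zero x = stop (zero-view (VA x)) to cong (W 0) (sym (trans (cong (x +_) (*-zeroʳ K)) (+-identityʳ x)))
      times (suc n) x = loop (suc-view (VA x)) (dec-view (VA x) ⨾ incs-view (VX n) K)
        (times n (x + K) to cong (W 0) (trans (+-assoc x K (K * n)) (cong (x +_) (sym (*-suc K n)))))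

    module _ {X Y} {W : ℕ → ℕ → ℕ → Vec ℕ (9 + v)} (VA : ∀ x y → Counts A (λ a → W a x y))
             (VX : ∀ a y → Counts X (λ x → W a x y)) (VY : ∀ a x → Counts Y (W a x)) where

      chunk-rest : ∀ a fuel j {x y} → a < fuel → W a x y ↦ W 0 x (y + (j + a)) via chunk X Y fuel j
      chunk-rest zero (suc fuel) j {x} {y} _ = ifTrue (zero-view (VA x y))
        (incs-view (VY 0 x) j to cong (λ n → W 0 x (y + n)) (sym (+-identityʳ j)))
      chunk-rest (suc a) (suc fuel) j {x} {y} (s≤s l) = ifFalse (suc-view (VA x y))
        (dec-view (VA x y) ⨾ (chunk-rest a fuel (suc j) l to cong (λ n → W 0 x (y + n)) (sym (+-suc j a))))

      chunk-full : ∀ fuel j {n x y} → W (fuel + n) x y ↦ W n (suc x) y via chunk X Y fuel j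
      chunk-full zero       j {n} {x} {y} = inc-view (VX n y)
      chunk-full (suc fuel) j {n} {x} {y} = ifFalse (suc-view (VA x y)) (dec-view (VA x y) ⨾ chunk-full fuel (suc j))

      divide : ∀ n a {x y} → a < K → W (K * n + a) x y ↦ W 0 (x + n) (y + a) via whileNonzero A (chunk X Y K 0)
      -- With remainder 0 the loop stops before another `chunk`; leaving `Y` unchanged is then the
      -- same as adding the digit 0.
      divide zero zero {x} {y} l = stop (zero-view (VA x y))
        from cong (λ c → W (c + 0) x y) (sym (*-zeroʳ K))
        to cong₂ (W 0) (sym (+-identityʳ x)) (sym (+-identityʳ y))
      divide zero (suc a) {x} {y} l =
        loop (suc-view (VA x y)) (chunk-rest (suc a) K 0 l) (stop (zero-view (VA x (y + suc a))))
        from cong (λ c → W (c + suc a) x y) (sym (*-zeroʳ K))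
        to cong (λ d → W 0 d (y + suc a)) (sym (+-identityʳ x))
      divide (suc n) a {x} {y} l = step K refl l
        where
        eq : K + (K * n + a) ≡ K * suc n + a
        eq = trans (sym (+-assoc K (K * n) a)) (cong (_+ a) (sym (*-suc K n)))
        -- The base is a parameter and cannot be split, but its copy `k` can. As `a < k` excludes 0,
        -- the counter `A` is visibly positive and the loop is entered.
        step : ∀ k → k ≡ K → a < k → W (K * suc n + a) x y ↦ W 0 (x + suc n) (y + a) via whileNonzero A (chunk X Y K 0)
        step (suc k) e _ =
          loop (subst (λ k → IM.Holds z (IM.isZero A) false (W (k + (K * n + a)) x y IM.∣ xs)) e (suc-view (VA x y)))
            (chunk-full K 0) (divide n a l)
          from cong (λ c → W c x y) eq
          to cong (λ d → W 0 d (y + a)) (sym (+-suc x n))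

      pop-view : ∀ n a {y} → a < K → W 0 (K * n + a) y ↦ W 0 n (y + a) via pop X Y
      pop-view n a {y} l = move-view {W = λ x a → W a x y} (λ a → VX a y) (λ x → VA x y) (K * n + a) 0 ⨾ divide n a l

-- From MS-machines to counter programs

module MS⇒IM {p q} (M : MS.Machine p q) (Y : Sort) where
  open MS.Machine M renaming (work to masterWork; baireWork to w)
  open IM using (_∣_; inc; dec; call; isZero; zeroSeq)

  private
    K = 2 + letters
    m = 3 + masterWork
    v = p + (m + (m + m))
    b = q + (w + 2)
    z = MS.zeroTestTape q w
    L = IM.language v z
    Symbol = MS.Symbol letters
    Command = MS.Command states letters m b

  open Macros {v} {b} z
  open Stacks {v} {b} z K
  open Tapes {Symbol} zero (suc zero) _≟ᶠ_ hiding (move)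
  module S = MS.Semantics M

  -- A master tape takes three counters: the stack to the left of the head, the scanned symbol, and
  -- the stack to the right. The bit of the machine is kept in counter 5.
  Lr Hr Rr : Fin m → Fin (9 + v)
  Lr i = 9 ↑ʳ (p ↑ʳ (i ↑ˡ (m + m)))
  Hr i = 9 ↑ʳ (p ↑ʳ (m ↑ʳ (i ↑ˡ m)))
  Rr i = 9 ↑ʳ (p ↑ʳ (m ↑ʳ (m ↑ʳ i)))

  Ir : Fin p → Fin (9 + v)
  Ir j = 9 ↑ʳ (j ↑ˡ (m + (m + m)))

  -- The scanned symbol is cleared before `pop`, which adds the digit it removes. Popping an empty
  -- stack gives the digit 0, that is, the blank met beyond the end of a tape.
  actProg : Fin m → Symbol × Move → Prog L
  actProg i (c , stay)  = clear (Hr i) ⨾ incs (toℕ c) (Hr i)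
  actProg i (c , moveR) = push (Lr i) (toℕ c) ⨾ clear (Hr i) ⨾ pop (Rr i) (Hr i)
  actProg i (c , moveL) = push (Rr i) (toℕ c) ⨾ clear (Hr i) ⨾ pop (Lr i) (Hr i)

  actsProg : ∀ {n} → (Fin n → Fin m) → Vec (Symbol × Move) n → Prog L
  actsProg f []       = skip
  actsProg f (x ∷ xs) = actProg (f zero) x ⨾ actsProg (f ∘ suc) xs

  flagArm : Symbol → Prog L
  flagArm a with a ≟ᶠ suc zero
  ... | yes _ = inc′ 6F
  ... | no _  = skip

  -- Counter 4 holds the symbol under inspection, counter 7 a copy of the cells to its right, and
  -- counter 6 becomes 1 if the symbol is a stroke. Working on copies leaves the tape itself intact.
  flag countLoop : Prog L
  flag      = switch K 4F flagArm skip
  countLoop = whileNonzero 6F (dec′ 6F ⨾ inc′ 2F ⨾ pop 7F 4F ⨾ flag)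

  numberProg : Fin m → Prog L
  numberProg i = copy 3F (Hr i) 4F ⨾ copy 3F (Rr i) 7F ⨾ (flag ⨾ countLoop) ⨾ clear 7F

  -- A master's program is a function of the tuple of scanned symbols. It is unrolled to a decision
  -- tree with a leaf for each tuple, which the continuation `k` supplies.
  readHeads : ∀ {n} → (Fin n → Fin m) → (Vec Symbol n → Prog L) → Prog L
  readHeads {zero}  f k = k []
  readHeads {suc n} f k = copy 3F (Hr (f zero)) 4F ⨾
    switch K 4F (λ a → readHeads (f ∘ suc) (λ as → k (a ∷ as))) skip

  goto : Fin states → Prog L
  goto s = incs (suc (toℕ s)) 0F

  setFlag : Prog L
  setFlag = clear 5F ⨾ ifte zeroSeq (inc′ 5F) skip

  command : Command → Prog L
  command (MS.turing acts s)   = actsProg (λ i → i) acts ⨾ goto s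
  command (MS.callSlave l s)   = numberProg MS.billboard ⨾ prim (call l) ⨾ clear 2F ⨾ goto s
  command (MS.zeroTest s)      = setFlag ⨾ goto s

  execute : Fin states → Bool → Prog L
  execute s c = readHeads (λ i → i) (λ as → command (program s as c))

  -- The decision is an argument, so that a proof about `arm s` can resolve it by abstracting over
  -- `s ≟ᶠ halt`.
  armWhen : ∀ s → Dec (s ≡ halt) → Prog L
  armWhen s (yes _) = skip
  armWhen s (no _)  = ifZero 5F (execute s false) (execute s true)

  arm : Fin states → Prog L
  arm s = armWhen s (s ≟ᶠ halt)

  body : Prog L
  body = dec′ 0F ⨾ switch states 0F arm skip

  -- A stack is built from its bottom: the later numerals come first, and within a numeral the
  -- closing blank precedes the strokes.
  loadInputs : ∀ {p′} → (Fin p′ → Fin p) → Prog L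
  loadInputs {zero}   f = skip
  loadInputs {suc p′} f = loadInputs (f ∘ suc) ⨾ push (Rr zero) 0 ⨾
    copy 3F (Ir (f zero)) 4F ⨾ whileNonzero 4F (dec′ 4F ⨾ push (Rr zero) 1)

  prologue : Prog L
  prologue = loadInputs (λ j → j) ⨾ pop (Rr zero) (Hr zero) ⨾ goto start

  epilogue : Sort → Prog L
  epilogue num = numberProg MS.outputTape ⨾ move 2F 1F
  epilogue seq = skip

  -- Abstract, so that its arguments can be inferred.
  abstract
    registers : Vec ℕ p → (ls hs rs : Vec ℕ m) → Vec ℕ v
    registers ins ls hs rs = ins Vec.++ (ls Vec.++ (hs Vec.++ rs))

    registers-initial : ∀ n → n Vec.++ Vec.replicate (m + (m + m)) 0 ≡
      registers n (Vec.replicate m 0) (Vec.replicate m 0) (Vec.replicate m 0)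
    registers-initial n = cong (n Vec.++_) (trans (replicate-++ m (m + m))
      (cong (Vec.replicate m 0 Vec.++_) (replicate-++ m m)))
      where
      replicate-++ : ∀ k l → Vec.replicate (k + l) 0 ≡ Vec.replicate k 0 Vec.++ Vec.replicate l 0
      replicate-++ zero    l = refl
      replicate-++ (suc k) l = cong (0 ∷_) (replicate-++ k l)

  module _ {ins : Vec ℕ p} {ls hs rs : Vec ℕ m} where

    abstract
      lookup-L : ∀ i n → lookup (registers ins (ls [ i ]≔ n) hs rs) (p ↑ʳ (i ↑ˡ (m + m))) ≡ n
      lookup-L i n = trans (lookup-++ʳ ins _ (i ↑ˡ (m + m))) (trans (lookup-++ˡ (ls [ i ]≔ n) _ i) (lookup∘update i ls n))

      lookup-H : ∀ i n → lookup (registers ins ls (hs [ i ]≔ n) rs) (p ↑ʳ (m ↑ʳ (i ↑ˡ m))) ≡ n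
      lookup-H i n = trans (lookup-++ʳ ins _ (m ↑ʳ (i ↑ˡ m))) (trans (lookup-++ʳ ls _ (i ↑ˡ m))
        (trans (lookup-++ˡ (hs [ i ]≔ n) _ i) (lookup∘update i hs n)))

      lookup-R : ∀ i n → lookup (registers ins ls hs (rs [ i ]≔ n)) (p ↑ʳ (m ↑ʳ (m ↑ʳ i))) ≡ n
      lookup-R i n = trans (lookup-++ʳ ins _ (m ↑ʳ (m ↑ʳ i))) (trans (lookup-++ʳ ls _ (m ↑ʳ i))
        (trans (lookup-++ʳ hs (rs [ i ]≔ n) i) (lookup∘update i rs n)))

      lookup-I : ∀ j n → lookup (registers (ins [ j ]≔ n) ls hs rs) (j ↑ˡ (m + (m + m))) ≡ n
      lookup-I j n = trans (lookup-++ˡ (ins [ j ]≔ n) _ j) (lookup∘update j ins n)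

      update-L : ∀ i n h → updateAt (registers ins (ls [ i ]≔ n) hs rs) (p ↑ʳ (i ↑ˡ (m + m))) h ≡
        registers ins (ls [ i ]≔ h n) hs rs
      update-L i n h = trans (updateAt-++ʳ ins _ (i ↑ˡ (m + m))) (cong (ins Vec.++_)
        (trans (updateAt-++ˡ (ls [ i ]≔ n) _ i) (cong (Vec._++ _) (updateAt-updateAt i ls))))

      update-H : ∀ i n h → updateAt (registers ins ls (hs [ i ]≔ n) rs) (p ↑ʳ (m ↑ʳ (i ↑ˡ m))) h ≡
        registers ins ls (hs [ i ]≔ h n) rs
      update-H i n h = trans (updateAt-++ʳ ins _ (m ↑ʳ (i ↑ˡ m))) (cong (ins Vec.++_)
        (trans (updateAt-++ʳ ls _ (i ↑ˡ m)) (cong (ls Vec.++_)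
          (trans (updateAt-++ˡ (hs [ i ]≔ n) _ i) (cong (Vec._++ _) (updateAt-updateAt i hs))))))

      update-R : ∀ i n h → updateAt (registers ins ls hs (rs [ i ]≔ n)) (p ↑ʳ (m ↑ʳ (m ↑ʳ i))) h ≡
        registers ins ls hs (rs [ i ]≔ h n)
      update-R i n h = trans (updateAt-++ʳ ins _ (m ↑ʳ (m ↑ʳ i))) (cong (ins Vec.++_)
        (trans (updateAt-++ʳ ls _ (m ↑ʳ i)) (cong (ls Vec.++_)
          (trans (updateAt-++ʳ hs _ i) (cong (hs Vec.++_) (updateAt-updateAt i rs))))))

      update-I : ∀ j n h → updateAt (registers (ins [ j ]≔ n) ls hs rs) (j ↑ˡ (m + (m + m))) h ≡
        registers (ins [ j ]≔ h n) ls hs rs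
      update-I j n h = trans (updateAt-++ˡ (ins [ j ]≔ n) _ j) (cong (Vec._++ _) (updateAt-updateAt j ins))

  file : (pc a bb t d c f g : ℕ) → Vec ℕ p → (ls hs rs : Vec ℕ m) → Vec ℕ (9 + v)
  file pc a bb t d c f g ins ls hs rs =
    pc ∷ a ∷ bb ∷ t ∷ d ∷ c ∷ f ∷ g ∷ 0 ∷ registers ins ls hs rs

  code : List Symbol → ℕ
  code []       = 0
  code (a ∷ as) = K * code as + toℕ a

  bitℕ : Bool → ℕ
  bitℕ false = 0
  bitℕ true  = 1

  leftℕ headℕ rightℕ : Tape Symbol → ℕ
  leftℕ  t = code (left t)
  headℕ  t = toℕ (head t)
  rightℕ t = code (right t)

  lefts heads rights : Vec (Tape Symbol) m → Vec ℕ m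
  lefts  = Vec.map leftℕ
  heads  = Vec.map headℕ
  rights = Vec.map rightℕ

  file-cong : ∀ {pc a bb t d c f g ins ls ls′ hs hs′ rs rs′} → ls ≡ ls′ → hs ≡ hs′ → rs ≡ rs′ →
    file pc a bb t d c f g ins ls hs rs ≡ file pc a bb t d c f g ins ls′ hs′ rs′
  file-cong refl refl refl = refl

  tapesFile : ℕ → ℕ → Vec ℕ p → Vec (Tape Symbol) m → Vec ℕ (9 + v)
  tapesFile pc c ins ts = file pc 0 0 0 0 c 0 0 ins (lefts ts) (heads ts) (rights ts)

  -- Overwriting an entry with its own value exposes it as the argument of a view.
  map-present : ∀ (f : Tape Symbol → ℕ) (ts : Vec (Tape Symbol) m) i →
    Vec.map f ts [ i ]≔ f (lookup ts i) ≡ Vec.map f ts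
  map-present f ts i = trans (cong (Vec.map f ts [ i ]≔_) (sym (lookup-map i f ts))) ([]≔-lookup (Vec.map f ts) i)

  map-updated : ∀ (f : Tape Symbol → ℕ) (ts : Vec (Tape Symbol) m) i g →
    Vec.map f ts [ i ]≔ f (g (lookup ts i)) ≡ Vec.map f (updateAt ts i g)
  map-updated f ts i g = sym (map-updateAt ts i refl)

  scanned : ∀ {n} → (Fin n → Fin m) → Vec (Tape Symbol) m → Vec Symbol n
  scanned f ts = Vec.tabulate (λ i → head (lookup ts (f i)))

  scanned-all : ∀ ts → scanned (λ i → i) ts ≡ Vec.map head ts
  scanned-all ts = trans (tabulate-∘ head (lookup ts)) (cong (Vec.map head) (tabulate∘lookup ts))

  module _ (xs : Vec Baire b) where
    open Views {v} {b} z xs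

    module _ {pc a bb t d c f g : ℕ} {ins : Vec ℕ p} {ls hs rs : Vec ℕ m} where

      private
        prefix : Vec ℕ v → Vec ℕ (9 + v)
        prefix ns = pc ∷ a ∷ bb ∷ t ∷ d ∷ c ∷ f ∷ g ∷ 0 ∷ ns

      L-view : ∀ i → Counts (Lr i) (λ l → file pc a bb t d c f g ins (ls [ i ]≔ l) hs rs)
      L-view i = counts (λ n → lookup-L i n) (λ n h → cong prefix (update-L i n h))

      H-view : ∀ i → Counts (Hr i) (λ h → file pc a bb t d c f g ins ls (hs [ i ]≔ h) rs)
      H-view i = counts (λ n → lookup-H i n) (λ n h → cong prefix (update-H i n h))

      R-view : ∀ i → Counts (Rr i) (λ r → file pc a bb t d c f g ins ls hs (rs [ i ]≔ r))
      R-view i = counts (λ n → lookup-R i n) (λ n h → cong prefix (update-R i n h))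

      I-view : ∀ j → Counts (Ir j) (λ n → file pc a bb t d c f g (ins [ j ]≔ n) ls hs rs)
      I-view j = counts (λ n → lookup-I j n) (λ n h → cong prefix (update-I j n h))

    firstOf : List Symbol → Symbol
    firstOf []       = zero
    firstOf (a ∷ as) = a

    restOf : List Symbol → List Symbol
    restOf []       = []
    restOf (a ∷ as) = as

    pop-code : ∀ {X Y} {W : ℕ → ℕ → ℕ → Vec ℕ (9 + v)} → (∀ x y → Counts 1F (λ a → W a x y)) →
      (∀ a y → Counts X (λ x → W a x y)) → (∀ a x → Counts Y (W a x)) →
      ∀ as {y} → W 0 (code as) y ↦ W 0 (code (restOf as)) (y + toℕ (firstOf as)) via pop X Y
    pop-code {W = W} VA VX VY [] {y}   = pop-view xs VA VX VY 0 0 (s≤s z≤n)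
      from cong (λ n → W 0 n y) (trans (+-identityʳ (K * 0)) (*-zeroʳ K))
    pop-code VA VX VY (a ∷ as) = pop-view xs VA VX VY (code as) (toℕ a) (toℕ<n a)

    module _ {c : ℕ} {ins : Vec ℕ p} where

      tapeFile : (a l h r : ℕ) → Fin m → (ls hs rs : Vec ℕ m) → Vec ℕ (9 + v)
      tapeFile a l h r i ls hs rs = file 0 a 0 0 0 c 0 0 ins (ls [ i ]≔ l) (hs [ i ]≔ h) (rs [ i ]≔ r)

      actTape-run : ∀ i x t {ls hs rs} →
        tapeFile 0 (code (left t)) (toℕ (head t)) (code (right t)) i ls hs rs ↦
        tapeFile 0 (code (left (S.act x t))) (toℕ (head (S.act x t))) (code (right (S.act x t))) i ls hs rs
        via actProg i x
      actTape-run i (a , stay) t = clear-view (H-view i) ⨾ incs-view (H-view i) (toℕ a)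
      actTape-run i (a , moveR) (tape l h r) {ls} {hs} {rs} =
        push-view xs {W = λ n l → tapeFile n l (toℕ h) (code r) i ls hs rs} (λ _ → counts (λ _ → refl) (λ _ _ → refl)) (λ _ → L-view i) (code l) (toℕ a) ⨾
        clear-view (H-view i) ⨾
        (pop-code {W = λ n r h → tapeFile n (code (a ∷ l)) h r i ls hs rs} (λ _ _ → counts (λ _ → refl) (λ _ _ → refl)) (λ _ _ → R-view i) (λ _ _ → H-view i) r to eq r)
        where
        eq : ∀ r → tapeFile 0 (code (a ∷ l)) (toℕ (firstOf r)) (code (restOf r)) i ls hs rs ≡
          (let t = S.act (a , moveR) (tape l h r) in tapeFile 0 (code (left t)) (toℕ (head t)) (code (right t)) i ls hs rs)
        eq []      = refl
        eq (_ ∷ _) = refl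
      actTape-run i (a , moveL) (tape l h r) {ls} {hs} {rs} =
        push-view xs {W = λ n r → tapeFile n (code l) (toℕ h) r i ls hs rs} (λ _ → counts (λ _ → refl) (λ _ _ → refl)) (λ _ → R-view i) (code r) (toℕ a) ⨾
        clear-view (H-view i) ⨾
        (pop-code {W = λ n l h → tapeFile n l h (code (a ∷ r)) i ls hs rs} (λ _ _ → counts (λ _ → refl) (λ _ _ → refl)) (λ _ _ → L-view i) (λ _ _ → H-view i) l to eq l)
        where
        eq : ∀ l → tapeFile 0 (code (restOf l)) (toℕ (firstOf l)) (code (a ∷ r)) i ls hs rs ≡
          (let t = S.act (a , moveL) (tape l h r) in tapeFile 0 (code (left t)) (toℕ (head t)) (code (right t)) i ls hs rs)
        eq []      = refl
        eq (_ ∷ _) = refl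

      act-run : ∀ i x ts → tapesFile 0 c ins ts ↦ tapesFile 0 c ins (updateAt ts i (S.act x)) via actProg i x
      act-run i x ts = actTape-run i x (lookup ts i) {lefts ts} {heads ts} {rights ts}
        from file-cong (map-present leftℕ ts i) (map-present headℕ ts i) (map-present rightℕ ts i)
        to file-cong (map-updated leftℕ ts i (S.act x)) (map-updated headℕ ts i (S.act x)) (map-updated rightℕ ts i (S.act x))

      actAll : ∀ {n} → (Fin n → Fin m) → Vec (Symbol × Move) n → Vec (Tape Symbol) m → Vec (Tape Symbol) m
      actAll f []       ts = ts
      actAll f (x ∷ acts) ts = actAll (f ∘ suc) acts (updateAt ts (f zero) (S.act x))

      acts-run : ∀ {n} (f : Fin n → Fin m) acts ts →
        tapesFile 0 c ins ts ↦ tapesFile 0 c ins (actAll f acts ts) via actsProg f acts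
      acts-run f []         ts = skip
      acts-run f (x ∷ acts) ts = act-run (f zero) x ts ⨾ acts-run (f ∘ suc) acts (updateAt ts (f zero) (S.act x))

      lookup-actAll : ∀ {n} (f : Fin n → Fin m) acts ts j → (∀ i → f i ≢ j) → lookup (actAll f acts ts) j ≡ lookup ts j
      lookup-actAll f []         ts j f≢j = refl
      lookup-actAll f (x ∷ acts) ts j f≢j =
        trans (lookup-actAll (f ∘ suc) acts _ j (f≢j ∘ suc)) (lookup∘updateAt′ j (f zero) (f≢j zero ∘ sym) ts)

      actAll-lookup : ∀ {n} (f : Fin n → Fin m) (inj : ∀ {i j} → f i ≡ f j → i ≡ j) acts ts i →
        lookup (actAll f acts ts) (f i) ≡ S.act (lookup acts i) (lookup ts (f i))
      actAll-lookup f inj (x ∷ acts) ts zero = trans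
        (lookup-actAll (f ∘ suc) acts _ (f zero) (λ i e → case inj e of λ ())) (lookup∘updateAt (f zero) ts)
      actAll-lookup f inj (x ∷ acts) ts (suc i) = trans
        (actAll-lookup (f ∘ suc) (λ e → suc-injectiveᶠ (inj e)) acts _ i)
        (cong (S.act (lookup acts i)) (lookup∘updateAt′ (f (suc i)) (f zero) (λ e → case inj e of λ ()) ts))

      -- The counter program treats the tapes one after another. This amounts to the simultaneous
      -- action because each action changes only its own tape and each tape occurs once.
      actAll-zipWith : ∀ acts ts → actAll (λ i → i) acts ts ≡ Vec.zipWith S.act acts ts
      actAll-zipWith acts ts = trans (sym (tabulate∘lookup _)) (trans
        (tabulate-cong (λ i → trans (actAll-lookup (λ i → i) (λ e → e) acts ts i) (sym (lookup-zipWith S.act i acts ts))))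
        (tabulate∘lookup _))

    flagOf : Symbol → ℕ
    flagOf a with a ≟ᶠ suc zero
    ... | yes _ = 1
    ... | no _  = 0

    module _ {c : ℕ} {ins : Vec ℕ p} {ls hs rs : Vec ℕ m} where

      private
        N : (a bb d f g : ℕ) → Vec ℕ (9 + v)
        N a bb d f g = file 0 a bb 0 d c f g ins ls hs rs

      flagArm-run : ∀ a {bb g} → N 0 bb 0 0 g ↦ N 0 bb 0 (flagOf a) g via flagArm a
      flagArm-run a with a ≟ᶠ suc zero
      ... | yes _ = prim inc
      ... | no _  = skip

      flag-run : ∀ a {bb g} → N 0 bb (toℕ a) 0 g ↦ N 0 bb 0 (flagOf a) g via flag
      flag-run a {bb} {g} = switch-view {W = λ d → N 0 bb d 0 g} (counts (λ _ → refl) (λ _ _ → refl)) {arms = flagArm} a (flagArm-run a)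

      count-run : ∀ a as {bb n} → bb + strokes (a ∷ as) ≡ n →
        ∃ λ g → N 0 bb (toℕ a) 0 (code as) ↦ N 0 n 0 0 g via flag ⨾ countLoop
      count-run a as {bb} e with flag-run a {bb} {code as}
      ... | d with a ≟ᶠ suc zero
      count-run a as {bb} refl | d | no _ =
        code as , d ⨾ (stop refl to cong (λ n → N 0 n 0 0 (code as)) (sym (+-identityʳ bb)))
      -- Beyond the last listed cell a blank is popped, and it ends the count.
      count-run a [] {bb} refl | d | yes _ = 0 , d ⨾ loop (λ ())
        (prim dec ⨾ prim inc ⨾
         pop-code {W = λ a g d → N a (suc bb) d 0 g} (λ _ _ → counts (λ _ → refl) (λ _ _ → refl)) (λ _ _ → counts (λ _ → refl) (λ _ _ → refl)) (λ _ _ → counts (λ _ → refl) (λ _ _ → refl)) [] ⨾ flag-run zero)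
        (stop refl to cong (λ n → N 0 n 0 0 0) (sym (trans (+-suc bb 0) (cong suc (+-identityʳ bb)))))
      count-run a (a′ ∷ as) {bb} e | d | yes _ with count-run a′ as {suc bb} (trans (sym (+-suc bb _)) e)
      ... | g , d′ ⨾ r = g , d ⨾ loop (λ ())
        (prim dec ⨾ prim inc ⨾
         pop-code {W = λ a g d → N a (suc bb) d 0 g} (λ _ _ → counts (λ _ → refl) (λ _ _ → refl)) (λ _ _ → counts (λ _ → refl) (λ _ _ → refl)) (λ _ _ → counts (λ _ → refl) (λ _ _ → refl)) (a′ ∷ as) ⨾ d′) r

    module _ {c : ℕ} {ins : Vec ℕ p} where

      head-run : ∀ i ts → tapesFile 0 c ins ts ↦
        file 0 0 0 0 (headℕ (lookup ts i)) c 0 0 ins (lefts ts) (heads ts) (rights ts) via copy 3F (Hr i) 4F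
      head-run i ts = copy-view {W = λ t h d → file 0 0 0 t d c 0 0 ins (lefts ts) (heads ts [ i ]≔ h) (rights ts)}
          (λ _ _ → counts (λ _ → refl) (λ _ _ → refl)) (λ _ _ → H-view i) (λ _ _ → counts (λ _ → refl) (λ _ _ → refl)) (headℕ (lookup ts i)) 0
        from file-cong refl (map-present headℕ ts i) refl
        to file-cong refl (map-present headℕ ts i) refl

      number-run : ∀ i ts → tapesFile 0 c ins ts ↦
        file 0 0 (number (lookup ts i)) 0 0 c 0 0 ins (lefts ts) (heads ts) (rights ts) via numberProg i
      number-run i ts with count-run {c} {ins} {lefts ts} {heads ts} {rights ts} (head (lookup ts i)) (right (lookup ts i)) {0} refl
      ... | g , d = head-run i ts ⨾
        (copy-view {W = λ t r g → file 0 0 0 t (headℕ (lookup ts i)) c 0 g ins (lefts ts) (heads ts) (rights ts [ i ]≔ r)}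
           (λ _ _ → counts (λ _ → refl) (λ _ _ → refl)) (λ _ _ → R-view i) (λ _ _ → counts (λ _ → refl) (λ _ _ → refl)) (rightℕ (lookup ts i)) 0
         from file-cong refl refl (map-present rightℕ ts i)
         to file-cong refl refl (map-present rightℕ ts i)) ⨾
        d ⨾ clear-run 7F

      readHeads-run : ∀ {n} (f : Fin n → Fin m) {k ts τ} → ⟨ k (scanned f ts) , tapesFile 0 c ins ts ∣ xs ⟩⇓ τ →
        ⟨ readHeads f k , tapesFile 0 c ins ts ∣ xs ⟩⇓ τ
      readHeads-run {zero}  f d = d
      readHeads-run {suc n} f {k} {ts} d = head-run (f zero) ts ⨾
        switch-run 4F {λ a → readHeads (f ∘ suc) (λ as → k (a ∷ as))} (head (lookup ts (f zero))) refl
          (readHeads-run (f ∘ suc) {λ as → k (head (lookup ts (f zero)) ∷ as)} d)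

  -- The runs that copy the heads are recovered by determinism, hence only up to `≈`: the counters
  -- come back exactly, the Baire registers as some `ys` equal to them pointwise.
  readHeads-run⁻¹ : ∀ {n} (f : Fin n → Fin m) {k c ins ts xs τ} →
    ⟨ readHeads f k , tapesFile 0 c ins ts ∣ xs ⟩⇓ τ →
    ∃ λ ys → xs ≋ ys × ⟨ k (scanned f ts) , tapesFile 0 c ins ts ∣ ys ⟩⇓ τ
  readHeads-run⁻¹ {zero}  f d = _ , (λ _ _ → refl) , d
  readHeads-run⁻¹ {suc n} f {k} {c} {ins} {ts} {xs} (d ⨾ d′)
    with IM.⇓-deterministic (copy 3F (Hr (f zero)) 4F) IM.~-refl (head-run xs (f zero) ts) d
  ... | refl IM., g with readHeads-run⁻¹ (f ∘ suc) {λ as → k (head (lookup ts (f zero)) ∷ as)} {c} {ins} {ts}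
         (switch-run⁻¹ 4F {λ a → readHeads (f ∘ suc) (λ as → k (a ∷ as))} (head (lookup ts (f zero))) refl d′)
  ... | ys , g′ , d″ = ys , (λ k i → trans (g k i) (g′ k i)) , d″

  Halted : S.Config → Set
  Halted c = S.Config.state c ≡ halt

  data R : S.Config → IM.Store (9 + v) b → Set where
    rel : ∀ {s c ins ts xs ys} → xs ≋ ys →
          R (S.config s c ts xs) (tapesFile (suc (toℕ s)) (bitℕ c) ins ts ∣ ys)

  data F : S.Config → IM.Store (9 + v) b → Set where
    rel : ∀ {s c ins ts xs ys} → xs ≋ ys → F (S.config s c ts xs) (tapesFile 0 (bitℕ c) ins ts ∣ ys)

  goto-run : ∀ s {c ins ts xs} → ⟨ goto s , tapesFile 0 c ins ts ∣ xs ⟩⇓ (tapesFile (suc (toℕ s)) c ins ts ∣ xs)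
  goto-run s = incs-run (suc (toℕ s)) 0F

  arm-run : ∀ {s c ins ts xs cmd τ} → s ≢ halt → program s (Vec.map head ts) c ≡ cmd →
    ⟨ command cmd , tapesFile 0 (bitℕ c) ins ts ∣ xs ⟩⇓ τ →
    ⟨ body , tapesFile (suc (toℕ s)) (bitℕ c) ins ts ∣ xs ⟩⇓ τ
  arm-run {s} {c} {ins} {ts} {xs} {τ = τ} s≢halt refl d = prim dec ⨾ switch-run 0F {arm} s refl arm-d
    where
    heads-d : ⟨ execute s c , tapesFile 0 (bitℕ c) ins ts ∣ xs ⟩⇓ τ
    heads-d = readHeads-run xs (λ i → i) {λ as → command (program s as c)}
      (subst (λ as → ⟨ command (program s as c) , tapesFile 0 (bitℕ c) ins ts ∣ xs ⟩⇓ τ) (sym (scanned-all ts)) d)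
    choose : ∀ c → ⟨ execute s c , tapesFile 0 (bitℕ c) ins ts ∣ xs ⟩⇓ τ →
             ⟨ ifZero 5F (execute s false) (execute s true) , tapesFile 0 (bitℕ c) ins ts ∣ xs ⟩⇓ τ
    choose false d = ifTrue refl d
    choose true  d = ifFalse (λ ()) d
    arm-d : ⟨ arm s , tapesFile 0 (bitℕ c) ins ts ∣ xs ⟩⇓ τ
    arm-d with s ≟ᶠ halt
    ... | yes e = contradiction e s≢halt
    ... | no _  = choose c heads-d

  body-step : ∀ {c c′ σ} → R c σ → c S.⟶ c′ → ∃ λ σ′ → ⟨ body , σ ⟩⇓ σ′ × R c′ σ′
  body-step (rel {s} {c} {ins} {ts} {xs} {ys} r) (S.turing {acts} {s′} h e) =
    _ , arm-run {s} {c} {ins} h e (acts-run ys (λ i → i) acts ts ⨾ goto-run s′) ,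
    -- The store contains the tapes after consecutive actions, the configuration those after the
    -- simultaneous one.
    subst (λ us → R (S.config s′ c us xs) (tapesFile (suc (toℕ s′)) (bitℕ c) ins (actAll ys {bitℕ c} {ins} (λ i → i) acts ts) ∣ ys))
      (actAll-zipWith ys {bitℕ c} {ins} acts ts) (rel r)
  body-step (rel {s} {c} {ins} {ts} {xs} {ys} r) (S.callSlave {l} {s′} {y} h e φ) =
    _ , arm-run {s} {c} {ins} h e (number-run ys MS.billboard ts ⨾
      prim (call (Φ-resp xs ys (number (lookup ts MS.billboard)) r φ)) ⨾ clear-run 2F ⨾ goto-run s′) ,
    rel (IM.≔-≋ xs ys l r (λ _ → refl))
  body-step (rel {s} {c} {ins} {ts} {xs} {ys} r) (S.zeroTest-true {s′} h e h₀) =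
    _ , arm-run {s} {c} {ins} h e ((clear-run 5F ⨾ ifTrue (λ i → trans (sym (r z i)) (h₀ i)) (prim inc)) ⨾ goto-run s′) ,
    rel {c = true} r
  body-step (rel {s} {c} {ins} {ts} {xs} {ys} r) (S.zeroTest-false {s′} h e h₀) =
    _ , arm-run {s} {c} {ins} h e ((clear-run 5F ⨾ ifFalse (λ h′ → h₀ (λ i → trans (r z i) (h′ i))) skip) ⨾ goto-run s′) ,
    rel {c = false} r

  body-halt : ∀ {c σ} → R c σ → Halted c → ∃ λ σ′ → ⟨ body , σ ⟩⇓ σ′ × F c σ′
  body-halt (rel {s} {c} {ins} {ts} {xs} {ys} r) refl =
    _ , prim dec ⨾ switch-run 0F {arm} s refl halted , rel r
    where
    halted : ⟨ arm s , tapesFile 0 (bitℕ c) ins ts ∣ ys ⟩⇓ (tapesFile 0 (bitℕ c) ins ts ∣ ys)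
    halted with s ≟ᶠ s
    ... | yes _ = skip
    ... | no h  = contradiction refl h

  command-progress : ∀ {s c ins ts xs ys τ} cmd → s ≢ halt → program s (Vec.map head ts) c ≡ cmd → xs ≋ ys →
    ⟨ command cmd , tapesFile 0 (bitℕ c) ins ts ∣ ys ⟩⇓ τ → ∃ λ d → S.config s c ts xs S.⟶ d
  command-progress (MS.turing acts s′) h e r d = _ , S.turing h e
  command-progress {c = c} {ins} {ts} {xs} {ys} (MS.callSlave l s′) h e r (d ⨾ prim (call φ) ⨾ _)
    with IM.⇓-deterministic (numberProg MS.billboard) IM.~-refl (number-run ys {bitℕ c} {ins} MS.billboard ts) d
  ... | refl IM., g = _ , S.callSlave h e
    (Φ-resp _ xs (number (lookup ts MS.billboard)) (λ k i → sym (trans (r k i) (g k i))) φ)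
  command-progress (MS.zeroTest s′) h e r ((d ⨾ ifTrue h₀ _) ⨾ _)
    with IM.⇓-deterministic (clear 5F) IM.~-refl (clear-run 5F) d
  ... | _ IM., g = _ , S.zeroTest-true h e (λ i → trans (r z i) (trans (g z i) (h₀ i)))
  command-progress (MS.zeroTest s′) h e r ((d ⨾ ifFalse h₀ _) ⨾ _)
    with IM.⇓-deterministic (clear 5F) IM.~-refl (clear-run 5F) d
  ... | _ IM., g = _ , S.zeroTest-false h e (λ h′ → h₀ (λ i → trans (sym (trans (r z i) (g z i))) (h′ i)))

  execute-progress : ∀ {s c ins ts xs ys τ} → s ≢ halt → xs ≋ ys →
    ⟨ execute s c , tapesFile 0 (bitℕ c) ins ts ∣ ys ⟩⇓ τ → ∃ λ d → S.config s c ts xs S.⟶ d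
  execute-progress {s} {c} {ins} {ts} h r d
    with readHeads-run⁻¹ (λ i → i) {λ as → command (program s as c)} {bitℕ c} {ins} {ts} d
  ... | ys′ , g , d′ rewrite scanned-all ts =
    command-progress {ins = ins} (program s (Vec.map head ts) c) h refl (λ k i → trans (r k i) (g k i)) d′

  progress : ∀ {c σ σ′} → R c σ → ⟨ body , σ ⟩⇓ σ′ → (∃ λ c′ → c S.⟶ c′) ⊎ Halted c
  progress (rel {s} {c} {ins} {ts} {xs} {ys} r) (prim dec ⨾ d) with switch-run⁻¹ 0F {arm} s refl d
  ... | d′ with s ≟ᶠ halt
  ...   | yes h = inj₂ h
  ...   | no h with c | d′
  ...     | false | ifTrue _ e  = inj₁ (execute-progress {ins = ins} h r e)
  ...     | false | ifFalse n _ = contradiction refl n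
  ...     | true  | ifFalse _ e = inj₁ (execute-progress {ins = ins} h r e)

  R-resp : ∀ {c σ τ} → σ IM.~ τ → R c σ → R c τ
  R-resp (refl IM., f) (rel r) = rel (λ j i → trans (r j i) (f j i))

  F-resp : ∀ {c σ τ} → σ IM.~ τ → F c σ → F c τ
  F-resp (refl IM., f) (rel r) = rel (λ j i → trans (r j i) (f j i))

  R-running : ∀ {c σ} → R c σ → lookup (IM.counters σ) zero ≢ 0
  R-running (rel _) ()

  F-halted : ∀ {c σ} → F c σ → lookup (IM.counters σ) zero ≡ 0
  F-halted (rel _) = refl

  open Interpreter z S._⟶_ Halted R F body R-running F-halted R-resp F-resp
    body-step body-halt progress

  machine : IM.Machine p q Y
  machine = record
    { extra = m + (m + m) ; work = w ; program = prologue ⨾ interpret ⨾ epilogue Y }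

  module _ (n : Vec ℕ p) (xs : Vec Baire b) where
    open Views {v} {b} z xs

    private
      zs : Vec ℕ m
      zs = Vec.replicate m 0

      N : (a t d h r : ℕ) → Vec ℕ p → Vec ℕ (9 + v)
      N a t d h r ins = file 0 a 0 t d 0 0 0 ins zs (zs [ zero ]≔ h) (zs [ zero ]≔ r)

    numeral-∷ : ∀ k as → numeral k ++ suc zero ∷ as ≡ suc zero ∷ numeral k ++ as
    numeral-∷ zero    as = refl
    numeral-∷ (suc k) as = cong (suc zero ∷_) (numeral-∷ k as)

    push-R : ∀ a r {d} → N 0 0 d 0 r n ↦ N 0 0 d 0 (K * r + a) n via push (Rr zero) a
    push-R a r {d} = push-view xs {W = λ a r → N a 0 d 0 r n} (λ _ → counts (λ _ → refl) (λ _ _ → refl)) (λ _ → R-view xs {rs = zs} zero) r a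

    pushNumeral-run : ∀ k as → N 0 0 k 0 (code as) n ↦ N 0 0 0 0 (code (numeral k ++ as)) n
      via whileNonzero 4F (dec′ 4F ⨾ push (Rr zero) 1)
    pushNumeral-run zero    as = stop refl
    pushNumeral-run (suc k) as = loop (λ ()) (prim dec ⨾ push-R 1 (code as))
      (pushNumeral-run k (suc zero ∷ as) to cong (λ as → N 0 0 0 0 (code as) n) (numeral-∷ k as))

    loadInputs-run : ∀ {p′} (f : Fin p′ → Fin p) (ns : Vec ℕ p′) → (∀ i → lookup n (f i) ≡ lookup ns i) →
      N 0 0 0 0 0 n ↦ N 0 0 0 0 (code (numerals ns)) n via loadInputs f
    loadInputs-run f []       e = skip
    loadInputs-run f (k ∷ ns) e = loadInputs-run (f ∘ suc) ns (e ∘ suc) ⨾ push-R 0 (code (numerals ns)) ⨾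
      (copy-view {W = λ t i d → N 0 t d 0 (code (zero ∷ numerals ns)) (n [ f zero ]≔ i)} (λ _ _ → counts (λ _ → refl) (λ _ _ → refl)) (λ _ _ → I-view xs (f zero)) (λ _ _ → counts (λ _ → refl) (λ _ _ → refl)) k 0
        from cong (N 0 0 0 0 (code (zero ∷ numerals ns))) input
        to cong (N 0 0 k 0 (code (zero ∷ numerals ns))) input) ⨾
      pushNumeral-run k (zero ∷ numerals ns)
      where
      input : n [ f zero ]≔ k ≡ n
      input = trans (cong (n [ f zero ]≔_) (sym (e zero))) ([]≔-lookup n (f zero))

    startTapes : Vec (Tape Symbol) m
    startTapes = Vec.replicate m (load []) [ zero ]≔ load (numerals n)

    prologue-run : ⟨ prologue , 0 ∷ 0 ∷ 0 ∷ 0 ∷ 0 ∷ 0 ∷ 0 ∷ 0 ∷ 0 ∷ n Vec.++ Vec.replicate (m + (m + m)) 0 ∣ xs ⟩⇓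
      (tapesFile (suc (toℕ start)) 0 n startTapes ∣ xs)
    prologue-run = (loadInputs-run (λ j → j) n (λ _ → refl)
        from sym (cong (λ ns → 0 ∷ 0 ∷ 0 ∷ 0 ∷ 0 ∷ 0 ∷ 0 ∷ 0 ∷ 0 ∷ ns) (registers-initial n))) ⨾
      (pop-code xs {W = λ a r h → N a 0 0 h r n} (λ _ _ → counts (λ _ → refl) (λ _ _ → refl)) (λ _ _ → R-view xs {rs = zs} zero) (λ _ _ → H-view xs {hs = zs} zero) (numerals n)
        to loaded (numerals n)) ⨾
      goto-run start {ts = startTapes}
      where
      blanks : ∀ (f : Tape Symbol → ℕ) → f (load []) ≡ 0 → ∀ t {a} → f t ≡ a →
        zs [ zero ]≔ a ≡ Vec.map f (Vec.replicate m (load []) [ zero ]≔ t)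
      blanks f e t refl = sym (trans (map-[]≔ f (Vec.replicate m (load [])) zero)
        (cong (_[ zero ]≔ f t) (trans (map-replicate f (load []) m) (cong (Vec.replicate m) e))))
      loaded : ∀ as → N 0 0 0 (toℕ (firstOf xs as)) (code (restOf xs as)) n ≡
        tapesFile 0 0 n (Vec.replicate m (load []) [ zero ]≔ load as)
      loaded []       = file-cong (blanks leftℕ refl (load []) refl) (blanks headℕ refl (load []) refl) (blanks rightℕ refl (load []) refl)
      loaded (a ∷ as) = file-cong (blanks leftℕ refl (load (a ∷ as)) refl) (blanks headℕ refl (load (a ∷ as)) refl)
        (blanks rightℕ refl (load (a ∷ as)) refl)

  initial-rel : ∀ n x → ∃ λ σ → ⟨ prologue , IM.initial machine n x ⟩⇓ σ × R (S.initial n x) σ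
  initial-rel n x = _ , prologue-run n _ , rel {c = false} {ts = startTapes n (x Vec.++ Vec.replicate (w + 2) 0ᴺ)} (λ _ _ → refl)

  epilogue-run : ∀ Z {c σ} → F c σ → ∃ λ σ′ → ⟨ epilogue Z , σ ⟩⇓ σ′ × Eq Z (IM.output q w Z σ′) (S.value Z c)
  epilogue-run num (rel {ts = ts} {ys = ys} r) = _ , number-run ys MS.outputTape ts ⨾ move-run 2F 1F (λ ()) , refl
  epilogue-run seq (rel r) = _ , skip , λ i → sym (r (MS.outputBaire q w) i)

  output-resp : ∀ Z {σ τ : IM.Store (9 + v) b} → σ IM.~ τ → Eq Z (IM.output q w Z σ) (IM.output q w Z τ)
  output-resp num (refl IM., _) = refl
  output-resp seq (_ IM., f)    = f (MS.outputBaire q w)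

  simulates : ∀ {n x y} → S.Outputs Y n x y ⇔ IM.Outputs machine n x y
  simulates {n} {x} {y} = mk⇔ to from
    where
    to : S.Outputs Y n x y → IM.Outputs machine n x y
    to (c , r , h , o) with initial-rel n x
    ... | _ , d , r₀ with interpret-complete r₀ r h
    ... | _ , d′ , f with epilogue-run Y f
    ... | _ , d″ , e = _ , d ⨾ d′ ⨾ d″ , Eq-trans Y e o
    from : IM.Outputs machine n x y → S.Outputs Y n x y
    from (_ , d ⨾ d′ ⨾ d″ , o) with initial-rel n x
    ... | _ , d₀ , r₀
      with interpret-sound (R-resp (IM.⇓-deterministic prologue IM.~-refl d₀ d) r₀) d′
    ... | c , r , h , f with epilogue-run Y f
    ... | _ , d₁ , e = c , r , h , Eq-trans Y (Eq-sym Y e)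
      (Eq-trans Y (output-resp Y (IM.⇓-deterministic (epilogue Y) IM.~-refl d₁ d″)) o)

-- Composing the simulations through counter programs

theorem2p27 : ∀ (p q : ℕ) → 1 ≤ p + q → (Y : Sort) (f : PartialFunction p q Y) →
    BSS.Computable f ⇔ MS.Computable f
theorem2p27 p q _ Y f = mk⇔
  (λ (M , correct) → IM⇒MS.A.machine (BSS⇒IM.machine M) ,
    λ n x y → IM⇒MS.simulates (BSS⇒IM.machine M) ⇔-∘ (BSS⇒IM.simulates M ⇔-∘ correct n x y))
  (λ (M , correct) → IM⇒BSS.A.machine (MS⇒IM.machine M Y) ,
    λ n x y → IM⇒BSS.simulates (MS⇒IM.machine M Y) ⇔-∘ (MS⇒IM.simulates M Y ⇔-∘ correct n x y))
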